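{- For $t>0$, $b\ge0$ write $a_m(t,b)=[x^m]\mathcal Z_{b,t}(x)$. For every compact $K\subset(0,\infty)\times[0,\infty)$ there are constants $A_K,B_K,c_K>0$ and an integer $r_K$ such that, for all $(t,b)\in K$, $$|a_m(t,b)|\le A_KB_K^m\,m!\quad(m\ge0),\qquad a_{2r}(t,b)\ge c_K^{2r}(2r)!\quad(r\ge r_K).$$ In particular, for every fixed $t>0$ and $b\ge0$, the sequence $(a_m(t,b))_m$ has exact Gevrey order one (it satisfies a bound $|a_m|\le AB^m(m!)^s$ with $s=1$ but with no $s<1$), and the power series $\mathcal Z_{b,t}(x)$ has radius of convergence zero.
   Context: For a partition $\lambda$, $\mathsf C_\alpha(\lambda)=\sum_{(i,j)\in\lambda}(\alpha(j-1)-(i-1))$. The elliptic $b$-Hurwitz numbers are $\mathsf H_{1,b}(d,r)=\sum_{\lambda\vdash d}\mathsf C_{1+b}(\lambda)^r$ (with $\mathsf H_{1,b}(0,0)=1$, $\mathsf H_{1,b}(0,r)=0$ for $r>0$), and $\mathscr H_b(q;\hbar)=\sum_{d,r\ge0}\mathsf H_{1,b}(d,r)q^d\frac{\hbar^r}{r!}$. Shifted arguments are formal: $\mathscr H_b(qe^u;\hbar):=e^{u\,q\frac{d}{dq}}\mathscr H_b(q;\hbar)$, i.e. the degree-$d$ term acquires the factor $e^{ud}$. Put $q_t=e^{ -t/2}$, $\phi(q)=\prod_{k\ge1}(1-q^k)$, $\Theta_{1+b}(t)=\sum_{m\in\mathbb Z}e^{ -\frac t2(1+b)m^2}$, and let $M$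 be a random integer with $\mathbb P(M=m)=e^{ -\frac t2(1+b)m^2}/\Theta_{1+b}(t)$. The formal power series $\mathcal Z_{b,t}(x)$ is $$\mathcal Z_{b,t}(x)=\Theta_{1+b}(t)\,\mathbb E_M\Bigl[e^{\frac12b(1+b)txM^2}\,\mathscr H_b\bigl(q_te^{ -(1+b)tMx};-tx\bigr)\,\mathscr H_b\bigl(q_te^{(1+b)tMx};-tx\bigr)\Bigr],$$ expanded in $x$ with expectation taken coefficientwise. Equivalently, $$[x^r]\mathcal Z_{b,t}(x)=\frac{\Theta_{1+b}(t)}{\phi(q_t)^2}\frac{(-t)^r}{r!}\mathbb E\bigl[F_b(\mu,\nu,M)^r\bigr],$$ $$F_b(\mu,\nu,m)=\mathsf C_{1+b}(\mu)+\mathsf C_{1+b}(\nu)+(1+b)m(|\mu|-|\nu|)-\tfrac{b(1+b)}2m^2,$$ where $\mu,\nu$ are random partitions, independent of each other and of $M$, with $\mathbb P(\mu=\lambda)=\phi(q_t)q_t^{|\lambda|}$ for every partition $\lambda$. -}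

module Defs where

open import Algebra.Bundles using (CommutativeRing; Semiring)
open import Algebra.Core using (Op₁)
open import Axiom.ExcludedMiddle using (ExcludedMiddle)
open import Data.Empty using (⊥-elim)
open import Data.Integer.Base as ℤ using (ℤ; -[1+_])
open import Data.List.Base using (List; []; _∷_; _++_; map; concatMap; filter; foldr; replicate; sum; upTo)
open import Data.List.Membership.Propositional using (_∈_)
open import Data.List.Membership.Propositional.Properties
  using (∈-map⁺; ∈-map⁻; ∈-concat⁺′; ∈-concat⁻′; ∈-filter⁺; ∈-filter⁻; ∈-upTo⁺)
open import Data.List.Properties using (sum-++; ++-cancelˡ; ∷-injectiveˡ; ∷-injectiveʳ)
open import Data.List.Relation.Binary.Disjoint.Propositional using (Disjoint)
open import Data.List.Relation.Unary.All as All using (All; []; _∷_)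
open import Data.List.Relation.Unary.AllPairs as AllPairs using (AllPairs; []; _∷_)
import Data.List.Relation.Unary.AllPairs.Properties as AllPairs
open import Data.List.Relation.Unary.Any using (Any; here; there)
open import Data.List.Relation.Unary.Linked using (Linked; []; [-]; _∷_)
open import Data.List.Relation.Unary.Unique.Propositional using (Unique)
import Data.List.Relation.Unary.All.Properties as All
import Data.List.Relation.Unary.Unique.Propositional.Properties as Unique
open import Data.Nat.Base as ℕ using (ℕ; zero; suc; _∸_; _!)
import Data.Nat.Properties as ℕ
open import Data.Product.Base using (∃; ∃-syntax; _×_; _,_; proj₁; proj₂)
open import Data.Sum.Base using (inj₁; inj₂; [_,_]′)
open import Level using (0ℓ)
open import Relation.Binary.Core using (Rel)
open import Relation.Binary.PropositionalEquality.Core using (_≡_; refl; sym; trans; cong; cong₂; subst)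
open import Relation.Binary.Structures using (IsTotalOrder)
import Relation.Binary.Construct.NonStrictToStrict as NonStrictToStrict
open import Relation.Nullary using (¬_; yes; no)
open import Relation.Unary using (Pred)

record IsPartition (d : ℕ) (parts : List ℕ) : Set where
  constructor isPartition
  field
    decreasing : Linked ℕ._≥_ parts
    positive   : All (0 ℕ.<_) parts
    size       : sum parts ≡ d

-- The partitions of n with all parts at most k, sorted by the
-- multiplicity j of the part k.
boundedPartitions : ℕ → ℕ → List (List ℕ)
boundedPartitions zero    zero    = [] ∷ []
boundedPartitions zero    (suc n) = []
boundedPartitions (suc k) n       =
  concatMap (λ j → map (replicate j (suc k) ++_) (boundedPartitions k (n ∸ j ℕ.* suc k)))
            (filter (λ j → j ℕ.* suc k ℕ.≤? n) (upTo (suc n)))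

partitions : ℕ → List (List ℕ)
partitions d = boundedPartitions d d

-- `partitions d` lists every partition of d exactly once.
private

  multiplicities : ℕ → ℕ → List ℕ
  multiplicities k n = filter (λ j → j ℕ.* suc k ℕ.≤? n) (upTo (suc n))

  block : ℕ → ℕ → ℕ → List (List ℕ)
  block k n j = map (replicate j (suc k) ++_) (boundedPartitions k (n ∸ j ℕ.* suc k))

  ∈-block : ∀ k n {parts} → parts ∈ boundedPartitions (suc k) n →
            ∃[ j ] ∃[ μ ] (j ℕ.* suc k ℕ.≤ n) × μ ∈ boundedPartitions k (n ∸ j ℕ.* suc k)
                          × parts ≡ replicate j (suc k) ++ μ
  ∈-block k n p with ∈-concat⁻′ (map (block k n) (multiplicities k n)) p
  ... | _ , p∈ , ys∈ with ∈-map⁻ (block k n) ys∈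
  ... | j , j∈ , refl with ∈-map⁻ (replicate j (suc k) ++_) p∈
  ... | μ , μ∈ , eq =
    j , μ , proj₂ (∈-filter⁻ (λ i → i ℕ.* suc k ℕ.≤? n) {xs = upTo (suc n)} j∈) , μ∈ , eq

  block-∈ : ∀ k n j {μ} → j ℕ.* suc k ℕ.≤ n → μ ∈ boundedPartitions k (n ∸ j ℕ.* suc k) →
            replicate j (suc k) ++ μ ∈ boundedPartitions (suc k) n
  block-∈ k n j j≤ μ∈ =
    ∈-concat⁺′ (∈-map⁺ (replicate j (suc k) ++_) μ∈)
      (∈-map⁺ (block k n)
        (∈-filter⁺ (λ i → i ℕ.* suc k ℕ.≤? n)
          (∈-upTo⁺ (ℕ.s≤s (ℕ.≤-trans (ℕ.m≤m*n j (suc k)) j≤))) j≤))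

  Bounded : ℕ → List ℕ → Set
  Bounded k = All (ℕ._≤ k)

  prepend : ∀ {k μ} j → Linked ℕ._≥_ μ → Bounded k μ → Linked ℕ._≥_ (replicate j k ++ μ)
  prepend zero                        l  b       = l
  prepend {μ = []}    (suc zero)      l  b       = [-]
  prepend {μ = _ ∷ _} (suc zero)      l  (p ∷ b) = p ∷ l
  prepend             (suc (suc j))   l  b       = ℕ.≤-refl ∷ prepend (suc j) l b

  sum-replicate : ∀ j k → sum (replicate j k) ≡ j ℕ.* k
  sum-replicate zero    k = refl
  sum-replicate (suc j) k = cong (k ℕ.+_) (sum-replicate j k)

  sound : ∀ k n {parts} → parts ∈ boundedPartitions k n → IsPartition n parts × Bounded k parts
  sound zero    zero    (here refl) = isPartition [] [] refl , []
  sound (suc k) n       p with ∈-block k n p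
  ... | j , μ , j≤ , μ∈ , refl with sound k (n ∸ j ℕ.* suc k) μ∈
  ... | isPartition l pos eq , b =
    isPartition (prepend j l b′) (All.++⁺ (All.replicate⁺ j (ℕ.s≤s ℕ.z≤n)) pos)
      (trans (sum-++ (replicate j (suc k)) μ)
        (trans (cong₂ ℕ._+_ (sum-replicate j (suc k)) eq) (ℕ.m+[n∸m]≡n j≤)))
    , All.++⁺ (All.replicate⁺ j ℕ.≤-refl) b′
    where
    b′ : Bounded (suc k) μ
    b′ = All.map ℕ.m≤n⇒m≤1+n b

  cons-∈ : ∀ k n {parts} → parts ∈ boundedPartitions (suc k) n →
           suc k ∷ parts ∈ boundedPartitions (suc k) (suc k ℕ.+ n)
  cons-∈ k n p with ∈-block k n p
  ... | j , μ , j≤ , μ∈ , refl =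
    block-∈ k (suc k ℕ.+ n) (suc j) (ℕ.+-monoʳ-≤ (suc k) j≤)
      (subst (λ m → μ ∈ boundedPartitions k m)
        (sym (ℕ.[m+n]∸[m+o]≡n∸o (suc k) n (j ℕ.* suc k))) μ∈)

  tail : ∀ {x xs} → Linked ℕ._≥_ (x ∷ xs) → Linked ℕ._≥_ xs
  tail [-]     = []
  tail (_ ∷ l) = l

  bound : ∀ {k x xs} → x ℕ.≤ k → Linked ℕ._≥_ (x ∷ xs) → Bounded k (x ∷ xs)
  bound x≤k [-]     = x≤k ∷ []
  bound x≤k (p ∷ l) = x≤k ∷ bound (ℕ.≤-trans p x≤k) l

  complete : ∀ k parts → Linked ℕ._≥_ parts → All (0 ℕ.<_) parts → Bounded k parts →
             parts ∈ boundedPartitions k (sum parts)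
  complete zero    []       _ _         _       = here refl
  complete zero    (x ∷ xs) _ (0<x ∷ _) (x≤0 ∷ _) = ⊥-elim (ℕ.<⇒≱ 0<x x≤0)
  complete (suc k) []       _ _         _       = block-∈ k 0 0 ℕ.z≤n (complete k [] [] [] [])
  complete (suc k) (x ∷ xs) l (0<x ∷ ps) (x≤ ∷ b) =
    [ (λ x<1+k → block-∈ k (x ℕ.+ sum xs) 0 ℕ.z≤n
                   (complete k (x ∷ xs) l (0<x ∷ ps) (bound (ℕ.s≤s⁻¹ x<1+k) l)))
    , (λ x≡1+k → subst (λ y → y ∷ xs ∈ boundedPartitions (suc k) (y ℕ.+ sum xs)) (sym x≡1+k)
                   (cons-∈ k (sum xs) (complete (suc k) xs (tail l) ps b)))
    ]′ (ℕ.m≤n⇒m<n∨m≡n x≤)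

  parts≤sum : ∀ parts → Bounded (sum parts) parts
  parts≤sum []       = []
  parts≤sum (x ∷ xs) =
    ℕ.m≤m+n x (sum xs) ∷ All.map (λ p → ℕ.≤-trans p (ℕ.m≤n+m (sum xs) x)) (parts≤sum xs)

  multiplicity-unique : ∀ i j k {μ ν} → Bounded k μ → Bounded k ν →
                        replicate i (suc k) ++ μ ≡ replicate j (suc k) ++ ν → i ≡ j
  multiplicity-unique zero    zero    k b       b′       eq   = refl
  multiplicity-unique (suc i) (suc j) k b       b′       eq   =
    cong suc (multiplicity-unique i j k b b′ (∷-injectiveʳ eq))
  multiplicity-unique zero    (suc j) k (p ∷ b) b′       refl = ⊥-elim (ℕ.<-irrefl refl p)
  multiplicity-unique (suc i) zero    k b       (p ∷ b′) refl = ⊥-elim (ℕ.<-irrefl refl p)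

  disjoint : ∀ k n {i j} → ¬ i ≡ j → Disjoint (block k n i) (block k n j)
  disjoint k n {i} {j} i≢j (p , q)
    with ∈-map⁻ (replicate i (suc k) ++_) p | ∈-map⁻ (replicate j (suc k) ++_) q
  ... | μ , μ∈ , refl | ν , ν∈ , eq =
    i≢j (multiplicity-unique i j k (proj₂ (sound k _ μ∈)) (proj₂ (sound k _ ν∈)) eq)

  unique : ∀ k n → Unique (boundedPartitions k n)
  unique zero    zero    = [] ∷ []
  unique zero    (suc n) = []
  unique (suc k) n       =
    Unique.concat⁺
      (All.map⁺ (All.universal
        (λ j → Unique.map⁺ (++-cancelˡ (replicate j (suc k)) _ _) (unique k (n ∸ j ℕ.* suc k)))
        (multiplicities k n)))
      (AllPairs.map⁺ (AllPairs.map (disjoint k n)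
        (Unique.filter⁺ (λ j → j ℕ.* suc k ℕ.≤? n) (Unique.upTo⁺ (suc n)))))

∈-partitions⁻ : ∀ {d parts} → parts ∈ partitions d → IsPartition d parts
∈-partitions⁻ {d} p = proj₁ (sound d d p)

∈-partitions⁺ : ∀ {d parts} → IsPartition d parts → parts ∈ partitions d
∈-partitions⁺ {parts = parts} (isPartition l pos refl) =
  complete (sum parts) parts l pos (parts≤sum parts)

partitions-unique : ∀ d → Unique (partitions d)
partitions-unique d = unique d d

-- The real numbers, axiomatised (up to isomorphism) as a complete
-- ordered field.
record CompleteOrderedField : Set₁ where
  infix 4 _≤_
  infix 8 _⁻¹
  field
    commutativeRing : CommutativeRing 0ℓ 0ℓ

  open CommutativeRing commutativeRing public

  field
    0≉1          : ¬ 0# ≈ 1#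
    -- The value of 0# ⁻¹ is unspecified.
    _⁻¹          : Op₁ Carrier
    *-inverseʳ   : ∀ x → ¬ x ≈ 0# → x * x ⁻¹ ≈ 1#
    _≤_          : Rel Carrier 0ℓ
    isTotalOrder : IsTotalOrder _≈_ _≤_
    +-monoˡ-≤    : ∀ z {x y} → x ≤ y → x + z ≤ y + z
    *-nonNeg     : ∀ {x y} → 0# ≤ x → 0# ≤ y → 0# ≤ x * y

  IsUpperBound : Pred Carrier 0ℓ → Pred Carrier 0ℓ
  IsUpperBound S u = ∀ x → S x → x ≤ u

  IsSupremum : Pred Carrier 0ℓ → Pred Carrier 0ℓ
  IsSupremum S s = IsUpperBound S s × (∀ u → IsUpperBound S u → s ≤ u)

  field
    supremum : ∀ (S : Pred Carrier 0ℓ) → ∃ S → ∃ (IsUpperBound S) → ∃ (IsSupremum S)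

module RealAnalysis (em : ExcludedMiddle 0ℓ) (𝓡 : CompleteOrderedField) where

  open CompleteOrderedField 𝓡
  open import Algebra.Definitions.RawSemiring (Semiring.rawSemiring semiring)
    public using (_^_) renaming (_×_ to _·_)

  ℝ : Set
  ℝ = Carrier

  open NonStrictToStrict _≈_ _≤_ public using (_<_)

  module ≤ = IsTotalOrder isTotalOrder

  fromℕ : ℕ → ℝ
  fromℕ n = n · 1#

  fromℤ : ℤ → ℝ
  fromℤ (ℤ.+ n)  = fromℕ n
  fromℤ -[1+ n ] = - fromℕ (suc n)

  ½ : ℝ
  ½ = fromℕ 2 ⁻¹

  ∣_∣ : ℝ → ℝ
  ∣ x ∣ with ≤.total 0# x
  ... | inj₁ 0≤x = x
  ... | inj₂ x≤0 = - x

  infix 4 _⟶_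
  _⟶_ : (ℕ → ℝ) → ℝ → Set
  u ⟶ l = ∀ ε → 0# < ε → ∃[ N ] ∀ n → N ℕ.≤ n → ∣ u n - l ∣ < ε

  -- An element satisfying P, or 0# if there is none.
  choose : Pred ℝ 0ℓ → ℝ
  choose P with em {∃ P}
  ... | yes (x , _) = x
  ... | no  _       = 0#

  lim : (ℕ → ℝ) → ℝ
  lim u = choose (u ⟶_)

  -- ∑< n f is f 0 + ⋯ + f (n - 1).
  ∑< : ℕ → (ℕ → ℝ) → ℝ
  ∑< zero    f = 0#
  ∑< (suc n) f = ∑< n f + f n

  Summable : (ℕ → ℝ) → Set
  Summable f = ∃[ l ] (λ n → ∑< n f) ⟶ l

  -- 0# if the series diverges.
  ∑∞ : (ℕ → ℝ) → ℝ
  ∑∞ f = lim (λ n → ∑< n f)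

  ∑ℤ : (ℤ → ℝ) → ℝ
  ∑ℤ f = ∑∞ (λ n → f (ℤ.+ n)) + ∑∞ (λ n → f -[1+ n ])

  exp : ℝ → ℝ
  exp x = ∑∞ (λ k → x ^ k * fromℕ (k !) ⁻¹)

  -- Meaningful for 0# < x only.
  log : ℝ → ℝ
  log x = choose (λ y → exp y ≈ x)

  infixr 8 _^ᴿ_
  _^ᴿ_ : ℝ → ℝ → ℝ
  x ^ᴿ s = exp (s * log x)

  PowerSeries : Set
  PowerSeries = ℕ → ℝ

  infixl 7 _⊛_
  _⊛_ : PowerSeries → PowerSeries → PowerSeries
  (f ⊛ g) n = ∑< (suc n) (λ k → f k * g (n ∸ k))

  -- e^{cx}
  exp[_x] : ℝ → PowerSeries
  exp[ c x] n = c ^ n * fromℕ (n !) ⁻¹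

  -- f(cx)
  rescale : ℝ → PowerSeries → PowerSeries
  rescale c f n = c ^ n * f n

  HasRadiusOfConvergence : PowerSeries → ℝ → Set
  HasRadiusOfConvergence a =
    IsSupremum (λ r → ∃[ x ] r ≈ ∣ x ∣ × Summable (λ n → a n * x ^ n))

  GevreyBound : PowerSeries → ℝ → Set
  GevreyBound a s = ∃[ A ] ∃[ B ] 0# < A × 0# < B ×
    (∀ m → ∣ a m ∣ ≤ A * B ^ m * fromℕ (m !) ^ᴿ s)

  ExactGevreyOrderOne : PowerSeries → Set
  ExactGevreyOrderOne a = GevreyBound a 1# × (∀ s → s < 1# → ¬ GevreyBound a s)

  IsOpen : Pred (ℝ × ℝ) 0ℓ → Set
  IsOpen U = ∀ x y → U (x , y) → ∃[ ε ] 0# < ε ×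
    (∀ x′ y′ → ∣ x′ - x ∣ < ε → ∣ y′ - y ∣ < ε → U (x′ , y′))

  IsCompact : Pred (ℝ × ℝ) 0ℓ → Set₁
  IsCompact K = ∀ (I : Set) (U : I → Pred (ℝ × ℝ) 0ℓ) → (∀ i → IsOpen (U i)) →
    (∀ p → K p → ∃[ i ] U i p) →
    ∃[ is ] ∀ p → K p → Any (λ i → U i p) is

  -- Rows and columns are numbered from 0 here, so the box in row i and
  -- column j has content αj - i.
  contentFrom : ℕ → ℝ → List ℕ → ℝ
  contentFrom i α []       = 0#
  contentFrom i α (p ∷ ps) = ∑< p (λ j → α * fromℕ j - fromℕ i) + contentFrom (suc i) α ps

  𝖢 : ℝ → List ℕ → ℝ
  𝖢 = contentFrom 0

  -- As 0# ^ 0 is 1#, d = 0 gives 1# for r = 0 and 0# for r > 0.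
  𝖧₁ : ℝ → ℕ → ℕ → ℝ
  𝖧₁ b d r = foldr _+_ 0# (map (λ parts → 𝖢 (1# + b) parts ^ r) (partitions d))

  -- The coefficient of q^d in 𝓗_b(q;ħ), as a power series in ħ.
  𝓗-coeff : ℝ → ℕ → PowerSeries
  𝓗-coeff b d r = 𝖧₁ b d r * fromℕ (r !) ⁻¹

  -- 𝓗_b(q e^{ux}; cx) as a power series in x, for a number q.
  𝓗-shifted : (b q u c : ℝ) → PowerSeries
  𝓗-shifted b q u c n =
    ∑∞ (λ d → q ^ d * (exp[ fromℕ d * u x] ⊛ rescale c (𝓗-coeff b d)) n)

  module _ (b t : ℝ) where

    private
      α : ℝ
      α = 1# + b

    qₜ : ℝ
    qₜ = exp (- (t * ½))

    weight : ℤ → ℝ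
    weight m = exp (- (t * ½ * α * fromℤ m ^ 2))

    Θ : ℝ
    Θ = ∑ℤ weight

    ℙ[M≡_] : ℤ → ℝ
    ℙ[M≡ m ] = weight m * Θ ⁻¹

    -- The expectation of a power series depending on M, taken
    -- coefficientwise.
    𝔼 : (ℤ → PowerSeries) → PowerSeries
    𝔼 f n = ∑ℤ (λ m → ℙ[M≡ m ] * f m n)

    𝓩 : PowerSeries
    𝓩 n = Θ * 𝔼 (λ m → exp[ ½ * b * α * t * fromℤ m ^ 2 x]
                          ⊛ 𝓗-shifted b qₜ (- (α * t * fromℤ m)) (- t)
                          ⊛ 𝓗-shifted b qₜ (α * t * fromℤ m) (- t)) n

{-# OPTIONS --safe #-}

-- Multiplying out the exponentials of 𝓗_b writes the coefficient of x^n in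
-- the m-th term of 𝓩 as the absolutely convergent sum over pairs of partitions
--   ∑ q^(|μ|+|ν|) (-t F_b(μ,ν,m))^n / n!.
-- For even n all terms are nonnegative, and the single term m = 0, ν = ∅,
-- μ = (n+1), whose content is of order n², is at least c^n n!.
-- Conversely |t F_b| ≤ K z² for z = |μ|+|ν|+|m|, and (s z)^(2n) ≤ (2n)! e^(s z)
-- with (2n)! ≤ 4^n n!². For s = t/8 the factor e^(s z) is absorbed by
-- q^(|μ|+|ν|), by the weight of m and by the subexponential growth of the number of
-- partitions, so what remains is a geometric series times (4K/s²)^n n!.
-- Taking s and K uniform over a box containing the compact set gives uniform constants.
-- The lower bound alone excludes Gevrey order s < 1 and a positive radius of
-- convergence, as X^n / n! is bounded for every X.

module Submission where

open import Algebra.Bundles using (RawRing)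
open import Algebra.Solver.Ring.AlmostCommutativeRing
  using (AlmostCommutativeRing; fromCommutativeRing; _-Raw-AlmostCommutative⟶_)
open import Axiom.ExcludedMiddle using (ExcludedMiddle)
open import Data.Integer.Base as ℤ using (ℤ; -[1+_])
import Data.Integer.Properties as ℤ
open import Data.List.Base as List using (List; []; _∷_; _++_; concatMap; filter; foldr; replicate; upTo)
open import Data.List.Membership.Propositional using (_∈_)
open import Data.List.Membership.Propositional.Properties using (∈-map⁺; ∈-map⁻; ∈-concat⁺′; ∈-concat⁻′; ∈-upTo⁺)
open import Data.List.Relation.Unary.All as All using (All; []; _∷_)
open import Data.List.Relation.Unary.Any using (Any; here; there)
open import Data.List.Relation.Unary.Linked using ([]; [-])
import Data.List.Properties as List
open import Data.Maybe.Base using () renaming (map to map′)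
open import Data.Nat.Base as ℕ using (ℕ; zero; suc; _∸_; _!)
open import Data.Nat.ListAction using (sum)
import Data.Nat.Properties as ℕ
open import Data.Product.Base using (∃; ∃-syntax; _×_; _,_; proj₁; proj₂)
open import Data.Sum.Base using (_⊎_; inj₁; inj₂; [_,_]′)
open import Function.Base using (_∘_)
open import Level using (0ℓ)
open import Relation.Binary.Bundles using (Poset)
open import Relation.Binary.Consequences using (dec⇒weaklyDec)
open import Relation.Binary.Definitions using (WeaklyDecidable)
open import Relation.Binary.PropositionalEquality.Core as ≡ using (_≡_)
import Relation.Binary.Reasoning.PartialOrder as PartialOrderReasoning
open import Relation.Nullary using (¬_; yes; no; contradiction)
open import Relation.Unary using (Pred; Decidable)
open import Defs

-- The pairs of partitions are never summed as an infinite double series. Both copies of `𝓗-shifted`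
-- are truncated below degree D, which leaves a finite sum over pairs. The upper bound, the
-- nonnegativity at even n and the comparison with a single term are proved for these truncations,
-- with constants free of D, and then pass to the limit coefficient by coefficient, before m is
-- summed. Even n are singled out because F_b has no fixed sign, so for odd n the terms may cancel.
-- The constant 8 is a budget. As q = e^(-t/2) ≤ e^(-4s), each box of a partition carries four
-- factors e^(-s): one cancels e^s, one pays for the number of partitions, one makes the sum over
-- sizes geometric, and one is spare. The field is known only through its axioms, so convergence of
-- series, the exponential function and its inverse on [1, ∞) all have to be built from least upper
-- bounds; continuity of exp is replaced by (1 - δ) e^δ ≤ 1.

module Growth (em : ExcludedMiddle 0ℓ) (𝓡 : CompleteOrderedField) where

  open CompleteOrderedField 𝓡 renaming (zero to *-zero)
  open RealAnalysis em 𝓡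
  open import Algebra.Properties.Ring ring
  open import Algebra.Properties.Semiring.Mult semiring using (×-homo-+; ×1-homo-*)
  open import Algebra.Properties.CommutativeSemiring.Exp commutativeSemiring
    using (^-congˡ; ^-homo-*; ^-assocʳ; ^-distrib-*)

  ≤-poset : Poset 0ℓ 0ℓ 0ℓ
  ≤-poset = record { isPartialOrder = ≤.isPartialOrder }

  open PartialOrderReasoning ≤-poset

  -- Integer coefficients for the ring solver.

  ℤ-coefficients : RawRing 0ℓ 0ℓ
  ℤ-coefficients = AlmostCommutativeRing.rawRing (fromCommutativeRing ℤ.+-*-commutativeRing)

  almostCommutativeRing : AlmostCommutativeRing 0ℓ 0ℓ
  almostCommutativeRing = fromCommutativeRing commutativeRing

  fromℕ-+ : ∀ m n → fromℕ (m ℕ.+ n) ≈ fromℕ m + fromℕ n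
  fromℕ-+ = ×-homo-+ 1#

  fromℕ-* : ∀ m n → fromℕ (m ℕ.* n) ≈ fromℕ m * fromℕ n
  fromℕ-* = ×1-homo-*

  fromℕ-1 : fromℕ 1 ≈ 1#
  fromℕ-1 = +-identityʳ 1#

  fromℤ-⊖ : ∀ m n → fromℤ (m ℤ.⊖ n) ≈ fromℕ m - fromℕ n
  fromℤ-⊖ zero    zero    = sym (-‿inverseʳ 0#)
  fromℤ-⊖ zero    (suc n) = sym (+-identityˡ _)
  fromℤ-⊖ (suc m) zero    = sym (trans (+-congˡ -0#≈0#) (+-identityʳ _))
  fromℤ-⊖ (suc m) (suc n) = begin-equality
    fromℤ (suc m ℤ.⊖ suc n)                ≡⟨ ≡.cong fromℤ (ℤ.[1+m]⊖[1+n]≡m⊖n m n) ⟩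
    fromℤ (m ℤ.⊖ n)                        ≈⟨ fromℤ-⊖ m n ⟩
    fromℕ m - fromℕ n                      ≈⟨ +-congʳ (xyx⁻¹≈y 1# (fromℕ m)) ⟨
    1# + fromℕ m - 1# - fromℕ n            ≈⟨ +-assoc _ _ _ ⟩
    1# + fromℕ m + (- 1# - fromℕ n)        ≈⟨ +-congˡ (-‿+-comm 1# (fromℕ n)) ⟩
    1# + fromℕ m - (1# + fromℕ n)          ∎

  fromℤ-neg : ∀ i → fromℤ (ℤ.- i) ≈ - fromℤ i
  fromℤ-neg (ℤ.+ zero)  = sym -0#≈0#
  fromℤ-neg (ℤ.+ suc n) = refl
  fromℤ-neg -[1+ n ]    = sym (-‿involutive _)

  fromℤ-+ : ∀ i j → fromℤ (i ℤ.+ j) ≈ fromℤ i + fromℤ j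
  fromℤ-+ (ℤ.+ m)  (ℤ.+ n)  = fromℕ-+ m n
  fromℤ-+ (ℤ.+ m)  -[1+ n ] = fromℤ-⊖ m (suc n)
  fromℤ-+ -[1+ m ] (ℤ.+ n)  = trans (fromℤ-⊖ n (suc m)) (+-comm _ _)
  fromℤ-+ -[1+ m ] -[1+ n ] = begin-equality
    - fromℕ (suc (suc (m ℕ.+ n)))      ≡⟨ ≡.cong (λ k → - fromℕ k) (≡.cong suc (ℕ.+-suc m n)) ⟨
    - fromℕ (suc m ℕ.+ suc n)          ≈⟨ -‿cong (fromℕ-+ (suc m) (suc n)) ⟩
    - (fromℕ (suc m) + fromℕ (suc n))  ≈⟨ -‿+-comm _ _ ⟨
    - fromℕ (suc m) - fromℕ (suc n)    ∎

  fromℤ-*⁺ : ∀ m j → fromℤ (ℤ.+ m ℤ.* j) ≈ fromℕ m * fromℤ j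
  fromℤ-*⁺ m (ℤ.+ n)  = trans (reflexive (≡.cong fromℤ (≡.sym (ℤ.pos-* m n)))) (fromℕ-* m n)
  fromℤ-*⁺ m -[1+ n ] = begin-equality
    fromℤ (ℤ.+ m ℤ.* -[1+ n ])        ≡⟨ ≡.cong fromℤ (ℤ.neg-distribʳ-* (ℤ.+ m) (ℤ.+ suc n)) ⟨
    fromℤ (ℤ.- (ℤ.+ m ℤ.* ℤ.+ suc n)) ≈⟨ fromℤ-neg (ℤ.+ m ℤ.* ℤ.+ suc n) ⟩
    - fromℤ (ℤ.+ m ℤ.* ℤ.+ suc n)     ≈⟨ -‿cong (fromℤ-*⁺ m (ℤ.+ suc n)) ⟩
    - (fromℕ m * fromℕ (suc n))       ≈⟨ -‿distribʳ-* _ _ ⟩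
    fromℕ m * - fromℕ (suc n)         ∎

  fromℤ-* : ∀ i j → fromℤ (i ℤ.* j) ≈ fromℤ i * fromℤ j
  fromℤ-* (ℤ.+ m)  j = fromℤ-*⁺ m j
  fromℤ-* -[1+ m ] j = begin-equality
    fromℤ (-[1+ m ] ℤ.* j)            ≡⟨ ≡.cong fromℤ (ℤ.neg-distribˡ-* (ℤ.+ suc m) j) ⟨
    fromℤ (ℤ.- (ℤ.+ suc m ℤ.* j))     ≈⟨ fromℤ-neg (ℤ.+ suc m ℤ.* j) ⟩
    - fromℤ (ℤ.+ suc m ℤ.* j)         ≈⟨ -‿cong (fromℤ-*⁺ (suc m) j) ⟩
    - (fromℕ (suc m) * fromℤ j)       ≈⟨ -‿distribˡ-* _ _ ⟩
    - fromℕ (suc m) * fromℤ j         ∎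

  -- Agrees with fromℤ, but sends 1 to 1# and not to 1# + 0#, so that the
  -- coefficient 1 of the ring solver is 1# definitionally.
  coefficient : ℤ → ℝ
  coefficient (ℤ.+ 1)  = 1#
  coefficient i        = fromℤ i

  coefficient≈ : ∀ i → coefficient i ≈ fromℤ i
  coefficient≈ (ℤ.+ 0)           = refl
  coefficient≈ (ℤ.+ 1)           = sym fromℕ-1
  coefficient≈ (ℤ.+ suc (suc n)) = refl
  coefficient≈ -[1+ n ]          = refl

  coefficient-homo : ℤ-coefficients -Raw-AlmostCommutative⟶ almostCommutativeRing
  coefficient-homo = record
    { ⟦_⟧    = coefficient
    ; +-homo = λ i j → trans (coefficient≈ (i ℤ.+ j)) (trans (fromℤ-+ i j) (sym (+-cong (coefficient≈ i) (coefficient≈ j))))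
    ; *-homo = λ i j → trans (coefficient≈ (i ℤ.* j)) (trans (fromℤ-* i j) (sym (*-cong (coefficient≈ i) (coefficient≈ j))))
    ; -‿homo = λ i → trans (coefficient≈ (ℤ.- i)) (trans (fromℤ-neg i) (sym (-‿cong (coefficient≈ i))))
    ; 0-homo = refl
    ; 1-homo = refl
    }

  coefficient-≟ : WeaklyDecidable (λ i j → coefficient i ≈ coefficient j)
  coefficient-≟ i j = map′ (λ { ≡.refl → refl }) (dec⇒weaklyDec ℤ._≟_ i j)

  open import Algebra.Solver.Ring ℤ-coefficients almostCommutativeRing coefficient-homo coefficient-≟
    using (solve; _:=_; _:+_; _:*_; _:-_; :-_; _:^_; con)

  -- Ordered field arithmetic, with inequalities reduced to identities for the difference.

  ≤-of-diff : ∀ {x y z} → 0# ≤ z → y - x ≈ z → x ≤ y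
  ≤-of-diff {x} {y} {z} 0≤z eq = begin
    x           ≈⟨ +-identityˡ x ⟨
    0# + x      ≤⟨ +-monoˡ-≤ x 0≤z ⟩
    z + x       ≈⟨ +-congʳ eq ⟨
    y - x + x   ≈⟨ solve 2 (λ x y → y :- x :+ x := y) refl x y ⟩
    y           ∎

  0≤diff : ∀ {x y} → x ≤ y → 0# ≤ y - x
  0≤diff {x} {y} x≤y = begin
    0#     ≈⟨ -‿inverseʳ x ⟨
    x - x  ≤⟨ +-monoˡ-≤ (- x) x≤y ⟩
    y - x  ∎

  ≈⇒≤ : ∀ {x y} → x ≈ y → x ≤ y
  ≈⇒≤ = ≤.reflexive

  <⇒≤ : ∀ {x y} → x < y → x ≤ y
  <⇒≤ = proj₁

  <⇒≱ : ∀ {x y} → x < y → ¬ y ≤ x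
  <⇒≱ (x≤y , x≉y) y≤x = x≉y (≤.antisym x≤y y≤x)

  ≰⇒> : ∀ {x y} → ¬ x ≤ y → y < x
  ≰⇒> {x} {y} x≰y with ≤.total x y
  ... | inj₁ x≤y = contradiction x≤y x≰y
  ... | inj₂ y≤x = y≤x , λ y≈x → x≰y (≈⇒≤ (sym y≈x))

  ≤-or-> : ∀ x y → x ≤ y ⊎ y < x
  ≤-or-> x y with em {x ≤ y}
  ... | yes x≤y = inj₁ x≤y
  ... | no  x≰y = inj₂ (≰⇒> x≰y)

  +-mono-≤ : ∀ {w x y z} → w ≤ x → y ≤ z → w + y ≤ x + z
  +-mono-≤ {w} {x} {y} {z} w≤x y≤z = begin
    w + y ≤⟨ +-monoˡ-≤ y w≤x ⟩
    x + y ≈⟨ +-comm x y ⟩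
    y + x ≤⟨ +-monoˡ-≤ x y≤z ⟩
    z + x ≈⟨ +-comm z x ⟩
    x + z ∎

  +-monoʳ-≤ : ∀ x {y z} → y ≤ z → x + y ≤ x + z
  +-monoʳ-≤ x = +-mono-≤ ≤.refl

  +-nonNeg : ∀ {x y} → 0# ≤ x → 0# ≤ y → 0# ≤ x + y
  +-nonNeg {x} {y} 0≤x 0≤y = begin
    0#      ≈⟨ +-identityˡ 0# ⟨
    0# + 0# ≤⟨ +-mono-≤ 0≤x 0≤y ⟩
    x + y   ∎

  x≤x+y : ∀ {x y} → 0# ≤ y → x ≤ x + y
  x≤x+y {x} {y} 0≤y = ≤-of-diff 0≤y (solve 2 (λ x y → x :+ y :- x := y) refl x y)

  x≤y+x : ∀ {x y} → 0# ≤ y → x ≤ y + x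
  x≤y+x {x} {y} 0≤y = ≤-of-diff 0≤y (solve 2 (λ x y → y :+ x :- x := y) refl x y)

  neg-mono-≤ : ∀ {x y} → x ≤ y → - y ≤ - x
  neg-mono-≤ {x} {y} x≤y = ≤-of-diff (0≤diff x≤y) (solve 2 (λ x y → :- x :- (:- y) := y :- x) refl x y)

  neg-nonNeg : ∀ {x} → x ≤ 0# → 0# ≤ - x
  neg-nonNeg {x} x≤0 = begin
    0#   ≈⟨ -0#≈0# ⟨
    - 0# ≤⟨ neg-mono-≤ x≤0 ⟩
    - x  ∎

  neg-nonPos : ∀ {x} → 0# ≤ x → - x ≤ 0#
  neg-nonPos {x} 0≤x = begin
    - x  ≤⟨ neg-mono-≤ 0≤x ⟩
    - 0# ≈⟨ -0#≈0# ⟩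
    0#   ∎

  *-monoˡ-≤ : ∀ {x y z} → 0# ≤ z → x ≤ y → z * x ≤ z * y
  *-monoˡ-≤ {x} {y} {z} 0≤z x≤y =
    ≤-of-diff (*-nonNeg 0≤z (0≤diff x≤y)) (sym (x[y-z]≈xy-xz z y x))

  *-monoʳ-≤ : ∀ {x y z} → 0# ≤ z → x ≤ y → x * z ≤ y * z
  *-monoʳ-≤ {x} {y} {z} 0≤z x≤y =
    ≤-of-diff (*-nonNeg (0≤diff x≤y) 0≤z) (sym ([y-z]x≈yx-zx z y x))

  *-mono-≤ : ∀ {w x y z} → 0# ≤ w → 0# ≤ y → w ≤ x → y ≤ z → w * y ≤ x * z
  *-mono-≤ 0≤w 0≤y w≤x y≤z =
    ≤.trans (*-monoˡ-≤ 0≤w y≤z) (*-monoʳ-≤ (≤.trans 0≤y y≤z) w≤x)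

  0≤1 : 0# ≤ 1#
  0≤1 with ≤.total 0# 1#
  ... | inj₁ 0≤1 = 0≤1
  ... | inj₂ 1≤0 = begin
    0#          ≤⟨ *-nonNeg (neg-nonNeg 1≤0) (neg-nonNeg 1≤0) ⟩
    - 1# * - 1# ≈⟨ solve 0 (:- con (ℤ.+ 1) :* (:- con (ℤ.+ 1)) := con (ℤ.+ 1)) refl ⟩
    1#          ∎

  0<1 : 0# < 1#
  0<1 = 0≤1 , 0≉1

  +-pos : ∀ {x y} → 0# < x → 0# ≤ y → 0# < x + y
  +-pos {x} {y} 0<x 0≤y = begin-strict
    0#    <⟨ 0<x ⟩
    x     ≤⟨ x≤x+y 0≤y ⟩
    x + y ∎

  square-nonNeg : ∀ x → 0# ≤ x * x
  square-nonNeg x with ≤.total 0# x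
  ... | inj₁ 0≤x = *-nonNeg 0≤x 0≤x
  ... | inj₂ x≤0 = begin
    0#        ≤⟨ *-nonNeg (neg-nonNeg x≤0) (neg-nonNeg x≤0) ⟩
    - x * - x ≈⟨ solve 1 (λ x → :- x :* (:- x) := x :* x) refl x ⟩
    x * x     ∎

  inverseʳ : ∀ {x} → 0# < x → x * x ⁻¹ ≈ 1#
  inverseʳ {x} 0<x = *-inverseʳ x (λ x≈0 → proj₂ 0<x (sym x≈0))

  inverseˡ : ∀ {x} → 0# < x → x ⁻¹ * x ≈ 1#
  inverseˡ 0<x = trans (*-comm _ _) (inverseʳ 0<x)

  ⁻¹-pos : ∀ {x} → 0# < x → 0# < x ⁻¹
  ⁻¹-pos {x} 0<x with ≤-or-> (x ⁻¹) 0#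
  ... | inj₂ 0<x⁻¹ = 0<x⁻¹
  ... | inj₁ x⁻¹≤0 = contradiction 1≤0 (<⇒≱ 0<1)
    where
    1≤0 : 1# ≤ 0#
    1≤0 = begin
      1#        ≈⟨ inverseʳ 0<x ⟨
      x * x ⁻¹  ≤⟨ *-monoˡ-≤ (<⇒≤ 0<x) x⁻¹≤0 ⟩
      x * 0#    ≈⟨ zeroʳ x ⟩
      0#        ∎

  *-cancelˡ-≤ : ∀ {x y z} → 0# < z → z * x ≤ z * y → x ≤ y
  *-cancelˡ-≤ {x} {y} {z} 0<z zx≤zy = begin
    x               ≈⟨ shift x ⟨
    z ⁻¹ * (z * x)  ≤⟨ *-monoˡ-≤ (<⇒≤ (⁻¹-pos 0<z)) zx≤zy ⟩
    z ⁻¹ * (z * y)  ≈⟨ shift y ⟩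
    y               ∎
    where
    shift : ∀ w → z ⁻¹ * (z * w) ≈ w
    shift w = begin-equality
      z ⁻¹ * (z * w)  ≈⟨ *-assoc _ _ _ ⟨
      z ⁻¹ * z * w    ≈⟨ *-congʳ (inverseˡ 0<z) ⟩
      1# * w          ≈⟨ *-identityˡ w ⟩
      w               ∎

  *-cancelˡ-≈ : ∀ {x y z} → 0# < z → z * x ≈ z * y → x ≈ y
  *-cancelˡ-≈ 0<z eq = ≤.antisym (*-cancelˡ-≤ 0<z (≈⇒≤ eq)) (*-cancelˡ-≤ 0<z (≈⇒≤ (sym eq)))

  *-pos : ∀ {x y} → 0# < x → 0# < y → 0# < x * y
  *-pos {x} {y} 0<x 0<y = *-nonNeg (<⇒≤ 0<x) (<⇒≤ 0<y) ,
    λ 0≈xy → proj₂ 0<y (*-cancelˡ-≈ 0<x (trans (zeroʳ x) 0≈xy))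

  *-monoˡ-< : ∀ {x y z} → 0# < z → x < y → z * x < z * y
  *-monoˡ-< 0<z (x≤y , x≉y) = *-monoˡ-≤ (<⇒≤ 0<z) x≤y , λ eq → x≉y (*-cancelˡ-≈ 0<z eq)

  0<diff : ∀ {x y} → x < y → 0# < y - x
  0<diff {x} {y} (x≤y , x≉y) = 0≤diff x≤y , λ eq → x≉y (sym (x∙y⁻¹≈ε⇒x≈y y x (sym eq)))

  -- Natural numbers and powers in the field.

  fromℕ-nonNeg : ∀ n → 0# ≤ fromℕ n
  fromℕ-nonNeg zero    = ≤.refl
  fromℕ-nonNeg (suc n) = +-nonNeg 0≤1 (fromℕ-nonNeg n)

  fromℕ-pos : ∀ {n} → 0 ℕ.< n → 0# < fromℕ n
  fromℕ-pos {suc n} _ = +-pos 0<1 (fromℕ-nonNeg n)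

  fromℕ-mono-≤ : ∀ {m n} → m ℕ.≤ n → fromℕ m ≤ fromℕ n
  fromℕ-mono-≤ {n = n} ℕ.z≤n = fromℕ-nonNeg n
  fromℕ-mono-≤ (ℕ.s≤s m≤n)   = +-monoʳ-≤ 1# (fromℕ-mono-≤ m≤n)

  0<n! : ∀ n → 0# < fromℕ (n !)
  0<n! n = fromℕ-pos (ℕ.1≤n! n)

  1≤fromℕ : ∀ {n} → 0 ℕ.< n → 1# ≤ fromℕ n
  1≤fromℕ {suc n} _ = x≤x+y (fromℕ-nonNeg n)

  0<2 : 0# < fromℕ 2
  0<2 = fromℕ-pos {2} (ℕ.s≤s ℕ.z≤n)

  0<½ : 0# < ½
  0<½ = ⁻¹-pos 0<2

  ½+½ : ½ + ½ ≈ 1#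
  ½+½ = trans (solve 1 (λ h → h :+ h := con (ℤ.+ 2) :* h) refl ½) (inverseʳ 0<2)

  ^-nonNeg : ∀ {x} n → 0# ≤ x → 0# ≤ x ^ n
  ^-nonNeg zero    0≤x = 0≤1
  ^-nonNeg (suc n) 0≤x = *-nonNeg 0≤x (^-nonNeg n 0≤x)

  ^-pos : ∀ {x} n → 0# < x → 0# < x ^ n
  ^-pos zero    0<x = 0<1
  ^-pos (suc n) 0<x = *-pos 0<x (^-pos n 0<x)

  ^-monoˡ-≤ : ∀ {x y} n → 0# ≤ x → x ≤ y → x ^ n ≤ y ^ n
  ^-monoˡ-≤ zero    0≤x x≤y = ≤.refl
  ^-monoˡ-≤ (suc n) 0≤x x≤y = *-mono-≤ 0≤x (^-nonNeg n 0≤x) x≤y (^-monoˡ-≤ n 0≤x x≤y)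

  1^n≈1 : ∀ n → 1# ^ n ≈ 1#
  1^n≈1 zero    = refl
  1^n≈1 (suc n) = trans (*-identityˡ _) (1^n≈1 n)

  x^n≤1 : ∀ {x} n → 0# ≤ x → x ≤ 1# → x ^ n ≤ 1#
  x^n≤1 n 0≤x x≤1 = ≤.trans (^-monoˡ-≤ n 0≤x x≤1) (≈⇒≤ (1^n≈1 n))

  1≤x^n : ∀ {x} n → 1# ≤ x → 1# ≤ x ^ n
  1≤x^n n 1≤x = ≤.trans (≈⇒≤ (sym (1^n≈1 n))) (^-monoˡ-≤ n 0≤1 1≤x)

  ^-antitoneʳ-≤ : ∀ {x m n} → 0# ≤ x → x ≤ 1# → m ℕ.≤ n → x ^ n ≤ x ^ m
  ^-antitoneʳ-≤ {n = n} 0≤x x≤1 ℕ.z≤n       = x^n≤1 n 0≤x x≤1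
  ^-antitoneʳ-≤         0≤x x≤1 (ℕ.s≤s m≤n) = *-monoˡ-≤ 0≤x (^-antitoneʳ-≤ 0≤x x≤1 m≤n)

  ^2n≈[x*x]^n : ∀ x n → x ^ (2 ℕ.* n) ≈ (x * x) ^ n
  ^2n≈[x*x]^n x n = trans (sym (^-assocʳ x 2 n)) (^-congˡ n (*-congˡ (*-identityʳ x)))

  ^2n-nonNeg : ∀ x n → 0# ≤ x ^ (2 ℕ.* n)
  ^2n-nonNeg x n = ≤.trans (^-nonNeg n (square-nonNeg x)) (≈⇒≤ (sym (^2n≈[x*x]^n x n)))

  -- Absolute values and the Archimedean property.

  ∣x∣-cases : ∀ x → (0# ≤ x × ∣ x ∣ ≡ x) ⊎ (x ≤ 0# × ∣ x ∣ ≡ - x)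
  ∣x∣-cases x with ≤.total 0# x
  ... | inj₁ 0≤x = inj₁ (0≤x , ≡.refl)
  ... | inj₂ x≤0 = inj₂ (x≤0 , ≡.refl)

  ∣x∣-nonNeg : ∀ x → 0# ≤ ∣ x ∣
  ∣x∣-nonNeg x with ∣x∣-cases x
  ... | inj₁ (0≤x , eq) = ≤.trans 0≤x (≈⇒≤ (sym (reflexive eq)))
  ... | inj₂ (x≤0 , eq) = ≤.trans (neg-nonNeg x≤0) (≈⇒≤ (sym (reflexive eq)))

  x≤∣x∣ : ∀ x → x ≤ ∣ x ∣
  x≤∣x∣ x with ∣x∣-cases x
  ... | inj₁ (0≤x , eq) = ≈⇒≤ (sym (reflexive eq))
  ... | inj₂ (x≤0 , eq) = ≤.trans x≤0 (∣x∣-nonNeg x)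

  -x≤∣x∣ : ∀ x → - x ≤ ∣ x ∣
  -x≤∣x∣ x with ∣x∣-cases x
  ... | inj₁ (0≤x , eq) = ≤.trans (neg-nonPos 0≤x) (∣x∣-nonNeg x)
  ... | inj₂ (x≤0 , eq) = ≈⇒≤ (sym (reflexive eq))

  ∣x∣≤ : ∀ {x y} → x ≤ y → - x ≤ y → ∣ x ∣ ≤ y
  ∣x∣≤ {x} x≤y -x≤y with ∣x∣-cases x
  ... | inj₁ (_ , eq) = ≤.trans (≈⇒≤ (reflexive eq)) x≤y
  ... | inj₂ (_ , eq) = ≤.trans (≈⇒≤ (reflexive eq)) -x≤y

  ∣x∣-cong : ∀ {x y} → x ≈ y → ∣ x ∣ ≈ ∣ y ∣
  ∣x∣-cong x≈y = ≤.antisym (half x≈y) (half (sym x≈y))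
    where
    half : ∀ {x y} → x ≈ y → ∣ x ∣ ≤ ∣ y ∣
    half {x} {y} x≈y = ∣x∣≤ (≤.trans (≈⇒≤ x≈y) (x≤∣x∣ y)) (≤.trans (≈⇒≤ (-‿cong x≈y)) (-x≤∣x∣ y))

  0≤x⇒∣x∣≈x : ∀ {x} → 0# ≤ x → ∣ x ∣ ≈ x
  0≤x⇒∣x∣≈x {x} 0≤x = ≤.antisym (∣x∣≤ ≤.refl (≤.trans (neg-nonPos 0≤x) 0≤x)) (x≤∣x∣ x)

  ∣-x∣≈∣x∣ : ∀ x → ∣ - x ∣ ≈ ∣ x ∣
  ∣-x∣≈∣x∣ x = ≤.antisym
    (∣x∣≤ (-x≤∣x∣ x) (≤.trans (≈⇒≤ (-‿involutive x)) (x≤∣x∣ x)))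
    (∣x∣≤ (≤.trans (≈⇒≤ (sym (-‿involutive x))) (-x≤∣x∣ (- x))) (x≤∣x∣ (- x)))

  ∣x+y∣≤∣x∣+∣y∣ : ∀ x y → ∣ x + y ∣ ≤ ∣ x ∣ + ∣ y ∣
  ∣x+y∣≤∣x∣+∣y∣ x y = ∣x∣≤ (+-mono-≤ (x≤∣x∣ x) (x≤∣x∣ y))
    (≤.trans (≈⇒≤ (sym (-‿+-comm x y))) (+-mono-≤ (-x≤∣x∣ x) (-x≤∣x∣ y)))

  ∣xy∣≈∣x∣∣y∣ : ∀ x y → ∣ x * y ∣ ≈ ∣ x ∣ * ∣ y ∣
  ∣xy∣≈∣x∣∣y∣ x y with ∣x∣-cases x | ∣x∣-cases y
  ... | inj₁ (0≤x , p) | inj₁ (0≤y , q) =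
    trans (0≤x⇒∣x∣≈x (*-nonNeg 0≤x 0≤y)) (sym (*-cong (reflexive p) (reflexive q)))
  ... | inj₁ (0≤x , p) | inj₂ (y≤0 , q) = begin-equality
    ∣ x * y ∣     ≈⟨ ∣-x∣≈∣x∣ (x * y) ⟨
    ∣ - (x * y) ∣ ≈⟨ ∣x∣-cong (-‿distribʳ-* x y) ⟩
    ∣ x * - y ∣   ≈⟨ 0≤x⇒∣x∣≈x (*-nonNeg 0≤x (neg-nonNeg y≤0)) ⟩
    x * - y       ≈⟨ *-cong (reflexive p) (reflexive q) ⟨
    ∣ x ∣ * ∣ y ∣ ∎
  ... | inj₂ (x≤0 , p) | inj₁ (0≤y , q) = begin-equality
    ∣ x * y ∣     ≈⟨ ∣-x∣≈∣x∣ (x * y) ⟨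
    ∣ - (x * y) ∣ ≈⟨ ∣x∣-cong (-‿distribˡ-* x y) ⟩
    ∣ - x * y ∣   ≈⟨ 0≤x⇒∣x∣≈x (*-nonNeg (neg-nonNeg x≤0) 0≤y) ⟩
    - x * y       ≈⟨ *-cong (reflexive p) (reflexive q) ⟨
    ∣ x ∣ * ∣ y ∣ ∎
  ... | inj₂ (x≤0 , p) | inj₂ (y≤0 , q) = begin-equality
    ∣ x * y ∣     ≈⟨ ∣x∣-cong (solve 2 (λ x y → x :* y := :- x :* (:- y)) refl x y) ⟩
    ∣ - x * - y ∣ ≈⟨ 0≤x⇒∣x∣≈x (*-nonNeg (neg-nonNeg x≤0) (neg-nonNeg y≤0)) ⟩
    - x * - y     ≈⟨ *-cong (reflexive p) (reflexive q) ⟨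
    ∣ x ∣ * ∣ y ∣ ∎

  ∣x^n∣≈∣x∣^n : ∀ x n → ∣ x ^ n ∣ ≈ ∣ x ∣ ^ n
  ∣x^n∣≈∣x∣^n x zero    = 0≤x⇒∣x∣≈x 0≤1
  ∣x^n∣≈∣x∣^n x (suc n) = trans (∣xy∣≈∣x∣∣y∣ x (x ^ n)) (*-congˡ (∣x^n∣≈∣x∣^n x n))

  -- If x exceeded every natural number, the naturals would have a supremum s; since n + 1 ≤ s for
  -- every n, also s - 1 would be an upper bound.
  archimedean : ∀ x → ∃[ n ] x ≤ fromℕ n
  archimedean x with em {∃[ n ] x ≤ fromℕ n}
  ... | yes p = p
  ... | no ¬p = contradiction s≤s-1 (<⇒≱ s-1<s)
    where
    S : Pred ℝ 0ℓ
    S y = ∃[ n ] y ≡ fromℕ n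

    sup : ∃ (IsSupremum S)
    sup = supremum S (0# , 0 , ≡.refl)
      (x , λ { _ (n , ≡.refl) → <⇒≤ (≰⇒> (λ x≤n → ¬p (n , x≤n))) })

    s : ℝ
    s = proj₁ sup

    s≤s-1 : s ≤ s - 1#
    s≤s-1 = proj₂ (proj₂ sup) (s - 1#) λ { _ (n , ≡.refl) →
      ≤-of-diff (0≤diff (proj₁ (proj₂ sup) (fromℕ (suc n)) (suc n , ≡.refl)))
        (solve 2 (λ s n → s :- con (ℤ.+ 1) :- n := s :- (con (ℤ.+ 1) :+ n)) refl s (fromℕ n)) }

    s-1<s : s - 1# < s
    s-1<s = ≤-of-diff 0≤1 eq , λ eq′ → 0≉1 (trans (sym (-‿inverseʳ s)) (trans (+-congˡ (-‿cong (sym eq′))) eq))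
      where
      eq : s - (s - 1#) ≈ 1#
      eq = solve 1 (λ s → s :- (s :- con (ℤ.+ 1)) := con (ℤ.+ 1)) refl s

  -- Limits of sequences.

  ∣x-y∣<ε⇒x<y+ε : ∀ {x y ε} → ∣ x - y ∣ < ε → x < y + ε
  ∣x-y∣<ε⇒x<y+ε {x} {y} {ε} lt = ≰⇒> λ y+ε≤x → <⇒≱ lt (begin
    ε     ≤⟨ ≤-of-diff (0≤diff y+ε≤x) (solve 3 (λ x y e → x :- y :- e := x :- (y :+ e)) refl x y ε) ⟩
    x - y     ≤⟨ x≤∣x∣ (x - y) ⟩
    ∣ x - y ∣ ∎)

  ∣x-y∣<ε⇒y<x+ε : ∀ {x y ε} → ∣ x - y ∣ < ε → y < x + ε
  ∣x-y∣<ε⇒y<x+ε {x} {y} {ε} lt = ≰⇒> λ x+ε≤y → <⇒≱ lt (begin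
    ε         ≤⟨ ≤-of-diff (0≤diff x+ε≤y) (solve 3 (λ x y e → :- (x :- y) :- e := y :- (x :+ e)) refl x y ε) ⟩
    - (x - y) ≤⟨ -x≤∣x∣ (x - y) ⟩
    ∣ x - y ∣ ∎)

  x+[y-x]≈y : ∀ x y → x + (y - x) ≈ y
  x+[y-x]≈y x y = solve 2 (λ x y → x :+ (y :- x) := y) refl x y

  ⟶-upper : ∀ {u l y} → u ⟶ l → (∀ n → u n ≤ y) → l ≤ y
  ⟶-upper {u} {l} {y} u⟶l u≤y with ≤-or-> l y
  ... | inj₁ l≤y = l≤y
  ... | inj₂ y<l with u⟶l (l - y) (0<diff y<l)
  ... | N , close = contradiction (u≤y N) (<⇒≱ (begin-strict
    y                ≈⟨ solve 2 (λ y l → y := l :- (l :- y)) refl y l ⟩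
    l - (l - y)      <⟨ ≰⇒> (λ le → <⇒≱ (∣x-y∣<ε⇒y<x+ε (close N ℕ.≤-refl)) (begin
      u N + (l - y)          ≤⟨ +-monoˡ-≤ (l - y) le ⟩
      l - (l - y) + (l - y)  ≈⟨ solve 2 (λ l e → l :- e :+ e := l) refl l (l - y) ⟩
      l                      ∎)) ⟩
    u N              ∎))

  ⟶-lower : ∀ {u l y} → u ⟶ l → (∀ n → y ≤ u n) → y ≤ l
  ⟶-lower {u} {l} {y} u⟶l y≤u with ≤-or-> y l
  ... | inj₁ y≤l = y≤l
  ... | inj₂ l<y with u⟶l (y - l) (0<diff l<y)
  ... | N , close = contradiction (y≤u N) (<⇒≱ (begin-strict
    u N          <⟨ ∣x-y∣<ε⇒x<y+ε (close N ℕ.≤-refl) ⟩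
    l + (y - l)  ≈⟨ x+[y-x]≈y l y ⟩
    y            ∎))

  -- Lets later ε-arguments lose a constant factor and strictness. Dividing ε by 1 + C instead of C
  -- restores the strict inequality and covers C = 0.
  ⟶-of-≤ : ∀ {u l} C → 0# ≤ C →
           (∀ ε → 0# < ε → ∃[ N ] ∀ n → N ℕ.≤ n → ∣ u n - l ∣ ≤ C * ε) → u ⟶ l
  ⟶-of-≤ {u} {l} C 0≤C close ε 0<ε = proj₁ (close ε′ 0<ε′) , λ n N≤n → begin-strict
    ∣ u n - l ∣                ≤⟨ proj₂ (close ε′ 0<ε′) n N≤n ⟩
    C * ε′                     ≈⟨ +-identityˡ _ ⟨
    0# + C * ε′                <⟨ ≰⇒> (λ le → <⇒≱ 0<ε′ (≤-of-diff (0≤diff le) (solve 2 (λ c e → con (ℤ.+ 0) :- e := con (ℤ.+ 0) :+ c :- (e :+ c)) refl (C * ε′) ε′))) ⟩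
    ε′ + C * ε′                ≈⟨ +-congʳ (*-identityˡ ε′) ⟨
    1# * ε′ + C * ε′           ≈⟨ distribʳ ε′ 1# C ⟨
    (1# + C) * ε′              ≈⟨ *-assoc _ _ _ ⟨
    (1# + C) * (1# + C) ⁻¹ * ε ≈⟨ *-congʳ (inverseʳ (+-pos 0<1 0≤C)) ⟩
    1# * ε                     ≈⟨ *-identityˡ ε ⟩
    ε                          ∎
    where
    0<1+C : 0# < 1# + C
    0<1+C = +-pos 0<1 0≤C

    ε′ : ℝ
    ε′ = (1# + C) ⁻¹ * ε

    0<ε′ : 0# < ε′
    0<ε′ = *-pos (⁻¹-pos 0<1+C) 0<ε

  ⟶-cong : ∀ {u v l} → (∀ n → u n ≈ v n) → u ⟶ l → v ⟶ l
  ⟶-cong {u} {v} {l} u≈v u⟶l ε 0<ε with u⟶l ε 0<ε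
  ... | N , close = N , λ n N≤n → begin-strict
    ∣ v n - l ∣ ≈⟨ ∣x∣-cong (+-congʳ (u≈v n)) ⟨
    ∣ u n - l ∣ <⟨ close n N≤n ⟩
    ε           ∎

  ⟶-resp : ∀ {u l m} → l ≈ m → u ⟶ l → u ⟶ m
  ⟶-resp {u} {l} {m} l≈m u⟶l ε 0<ε with u⟶l ε 0<ε
  ... | N , close = N , λ n N≤n → begin-strict
    ∣ u n - m ∣ ≈⟨ ∣x∣-cong (+-congˡ (-‿cong l≈m)) ⟨
    ∣ u n - l ∣ <⟨ close n N≤n ⟩
    ε           ∎

  ⟶-const : ∀ x → (λ _ → x) ⟶ x
  ⟶-const x ε 0<ε = 0 , λ n _ → begin-strict
    ∣ x - x ∣ ≈⟨ ∣x∣-cong (-‿inverseʳ x) ⟩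
    ∣ 0# ∣    ≈⟨ 0≤x⇒∣x∣≈x ≤.refl ⟩
    0#        <⟨ 0<ε ⟩
    ε         ∎

  ⟶-+ : ∀ {u v l m} → u ⟶ l → v ⟶ m → (λ n → u n + v n) ⟶ l + m
  ⟶-+ {u} {v} {l} {m} u⟶l v⟶m = ⟶-of-≤ (1# + 1#) (+-nonNeg 0≤1 0≤1) λ ε 0<ε →
    let M , close  = u⟶l ε 0<ε
        N , close′ = v⟶m ε 0<ε
    in M ℕ.+ N , λ n M+N≤n → begin
      ∣ u n + v n - (l + m) ∣    ≈⟨ ∣x∣-cong (solve 4 (λ a b c d → a :+ b :- (c :+ d) := a :- c :+ (b :- d)) refl (u n) (v n) l m) ⟩
      ∣ u n - l + (v n - m) ∣    ≤⟨ ∣x+y∣≤∣x∣+∣y∣ _ _ ⟩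
      ∣ u n - l ∣ + ∣ v n - m ∣  ≤⟨ +-mono-≤ (<⇒≤ (close n (ℕ.m+n≤o⇒m≤o M M+N≤n))) (<⇒≤ (close′ n (ℕ.m+n≤o⇒n≤o M M+N≤n))) ⟩
      ε + ε                      ≈⟨ solve 1 (λ e → e :+ e := (con (ℤ.+ 1) :+ con (ℤ.+ 1)) :* e) refl ε ⟩
      (1# + 1#) * ε              ∎

  ⟶-*ˡ : ∀ {u l} x → u ⟶ l → (λ n → x * u n) ⟶ x * l
  ⟶-*ˡ {u} {l} x u⟶l = ⟶-of-≤ ∣ x ∣ (∣x∣-nonNeg x) λ ε 0<ε →
    let N , close = u⟶l ε 0<ε
    in N , λ n N≤n → begin
      ∣ x * u n - x * l ∣  ≈⟨ ∣x∣-cong (x[y-z]≈xy-xz x (u n) l) ⟨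
      ∣ x * (u n - l) ∣    ≈⟨ ∣xy∣≈∣x∣∣y∣ x (u n - l) ⟩
      ∣ x ∣ * ∣ u n - l ∣  ≤⟨ *-monoˡ-≤ (∣x∣-nonNeg x) (<⇒≤ (close n N≤n)) ⟩
      ∣ x ∣ * ε            ∎

  x-0≈x : ∀ x → x - 0# ≈ x
  x-0≈x x = trans (+-congˡ -0#≈0#) (+-identityʳ x)

  ⟶-*-zero : ∀ {u v : ℕ → ℝ} {C} → (∀ n → ∣ u n ∣ ≤ C) → v ⟶ 0# → (λ n → u n * v n) ⟶ 0#
  ⟶-*-zero {u} {v} {C} u≤C v⟶0 = ⟶-of-≤ C (≤.trans (∣x∣-nonNeg (u 0)) (u≤C 0)) λ ε 0<ε →
    let N , close = v⟶0 ε 0<ε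
    in N , λ n N≤n → begin
      ∣ u n * v n - 0# ∣      ≈⟨ ∣x∣-cong (x-0≈x _) ⟩
      ∣ u n * v n ∣           ≈⟨ ∣xy∣≈∣x∣∣y∣ (u n) (v n) ⟩
      ∣ u n ∣ * ∣ v n ∣       ≤⟨ *-mono-≤ (∣x∣-nonNeg _) (∣x∣-nonNeg _) (u≤C n)
                                   (≤.trans (≈⇒≤ (∣x∣-cong (sym (x-0≈x (v n))))) (<⇒≤ (close n N≤n))) ⟩
      C * ε                   ∎

  ⟶-bounded : ∀ {u : ℕ → ℝ} {l} → u ⟶ l → ∃[ C ] ∀ n → ∣ u n ∣ ≤ C
  ⟶-bounded {u} {l} u⟶l with u⟶l 1# 0<1
  ... | N , close = C N + (∣ l ∣ + 1#) , bound
    where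
    -- The sum of the first k absolute values serves as a bound for each of them, in place of their
    -- maximum.
    C : ℕ → ℝ
    C zero    = 0#
    C (suc k) = C k + ∣ u k ∣

    C-nonNeg : ∀ k → 0# ≤ C k
    C-nonNeg zero    = ≤.refl
    C-nonNeg (suc k) = +-nonNeg (C-nonNeg k) (∣x∣-nonNeg (u k))

    ∣u∣≤C : ∀ {n} k → n ℕ.< k → ∣ u n ∣ ≤ C k
    ∣u∣≤C (suc k) n<1+k with ℕ.m≤n⇒m<n∨m≡n (ℕ.s≤s⁻¹ n<1+k)
    ... | inj₁ n<k    = ≤.trans (∣u∣≤C k n<k) (x≤x+y (∣x∣-nonNeg (u k)))
    ... | inj₂ ≡.refl = x≤y+x (C-nonNeg k)

    bound : ∀ n → ∣ u n ∣ ≤ C N + (∣ l ∣ + 1#)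
    bound n with n ℕ.<? N
    ... | yes n<N = ≤.trans (∣u∣≤C N n<N) (x≤x+y (+-nonNeg (∣x∣-nonNeg l) 0≤1))
    ... | no  n≮N = ≤.trans (begin
      ∣ u n ∣           ≈⟨ ∣x∣-cong (x+[y-x]≈y l (u n)) ⟨
      ∣ l + (u n - l) ∣ ≤⟨ ∣x+y∣≤∣x∣+∣y∣ _ _ ⟩
      ∣ l ∣ + ∣ u n - l ∣ ≤⟨ +-monoʳ-≤ _ (<⇒≤ (close n (ℕ.≮⇒≥ n≮N))) ⟩
      ∣ l ∣ + 1# ∎) (x≤y+x (C-nonNeg N))

  -- The product is split as u (v - m) + m u, whose first summand is a bounded sequence times a null
  -- sequence.
  ⟶-* : ∀ {u v l m} → u ⟶ l → v ⟶ m → (λ n → u n * v n) ⟶ l * m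
  ⟶-* {u} {v} {l} {m} u⟶l v⟶m =
    ⟶-cong (λ n → solve 4 (λ u v l m → u :* (v :+ :- con (ℤ.+ 1) :* m) :+ m :* u := u :* v) refl (u n) (v n) l m)
      (⟶-resp (trans (+-identityˡ _) (*-comm m l))
        (⟶-+ (⟶-*-zero {u} (proj₂ (⟶-bounded u⟶l)) v-m⟶0) (⟶-*ˡ m u⟶l)))
    where
    v-m⟶0 : (λ n → v n + - 1# * m) ⟶ 0#
    v-m⟶0 = ⟶-resp (solve 1 (λ m → m :+ :- con (ℤ.+ 1) :* m := con (ℤ.+ 0)) refl m)
      (⟶-+ v⟶m (⟶-const (- 1# * m)))

  ⟶-mono : ∀ {u v l m} → (∀ n → u n ≤ v n) → u ⟶ l → v ⟶ m → l ≤ m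
  ⟶-mono {u} {v} {l} {m} u≤v u⟶l v⟶m = ≤-of-diff
    (⟶-lower (⟶-+ v⟶m (⟶-*ˡ (- 1#) u⟶l)) λ n → ≤.trans (0≤diff (u≤v n)) (≈⇒≤ (+-congˡ (sym (-1*x≈-x (u n))))))
    (+-congˡ (sym (-1*x≈-x l)))

  ⟶-unique : ∀ {u l m} → u ⟶ l → u ⟶ m → l ≈ m
  ⟶-unique u⟶l u⟶m = ≤.antisym (⟶-mono (λ _ → ≤.refl) u⟶l u⟶m) (⟶-mono (λ _ → ≤.refl) u⟶m u⟶l)

  ⟶-subsequence : ∀ {u l} (f : ℕ → ℕ) → (∀ n → n ℕ.≤ f n) → u ⟶ l → (u ∘ f) ⟶ l
  ⟶-subsequence f n≤f u⟶l ε 0<ε with u⟶l ε 0<ε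
  ... | N , close = N , λ n N≤n → close (f n) (ℕ.≤-trans N≤n (n≤f n))

  monotone-limit : ∀ {u y} → (∀ {m n} → m ℕ.≤ n → u m ≤ u n) → (∀ n → u n ≤ y) → ∃[ l ] u ⟶ l
  monotone-limit {u} {y} mono u≤y = s , λ ε 0<ε → converges ε 0<ε
    where
    sup : ∃ (IsSupremum (λ x → ∃[ n ] x ≡ u n))
    sup = supremum _ (u 0 , 0 , ≡.refl) (y , λ { _ (n , ≡.refl) → u≤y n })

    s : ℝ
    s = proj₁ sup

    converges : u ⟶ s
    converges ε 0<ε with em {∃[ N ] s - ε < u N}
    ... | yes (N , s-ε<uN) = N , λ n N≤n →
      let 0≤s-un = 0≤diff (proj₁ (proj₂ sup) (u n) (n , ≡.refl)) in begin-strict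
      ∣ u n - s ∣     ≈⟨ ∣-x∣≈∣x∣ _ ⟨
      ∣ - (u n - s) ∣ ≈⟨ ∣x∣-cong (solve 2 (λ u s → :- (u :- s) := s :- u) refl (u n) s) ⟩
      ∣ s - u n ∣     ≈⟨ 0≤x⇒∣x∣≈x 0≤s-un ⟩
      s - u n         ≤⟨ +-monoʳ-≤ s (neg-mono-≤ (mono N≤n)) ⟩
      s - u N         <⟨ ≰⇒> (λ le → <⇒≱ s-ε<uN (≤-of-diff (0≤diff le) (solve 3 (λ s e u → s :- e :- u := s :- u :- e) refl s ε (u N)))) ⟩
      ε               ∎
    ... | no ¬∃ = contradiction (proj₂ (proj₂ sup) (s - ε) λ { _ (n , ≡.refl) → [ (λ le → le) , (λ lt → contradiction (n , lt) ¬∃) ]′ (≤-or-> (u n) (s - ε)) })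
      (<⇒≱ (≰⇒> λ le → <⇒≱ 0<ε (≤-of-diff (0≤diff le) (solve 2 (λ s e → con (ℤ.+ 0) :- e := s :- e :- s) refl s ε))))

  -- Finite sums and series.

  choose-satisfies : ∀ {P : Pred ℝ 0ℓ} → ∃ P → P (choose P)
  choose-satisfies {P} ∃P with em {∃ P}
  ... | yes (_ , p) = p
  ... | no  ¬∃P     = contradiction ∃P ¬∃P

  ∑∞-converges : ∀ {f} → Summable f → (λ n → ∑< n f) ⟶ ∑∞ f
  ∑∞-converges = choose-satisfies

  -- `∑∞` is an unspecified choice among the limits, so its value can be identified only through
  -- uniqueness of limits, and only up to `≈`.
  ∑∞-unique : ∀ {f l} → (λ n → ∑< n f) ⟶ l → ∑∞ f ≈ l
  ∑∞-unique conv = ⟶-unique (∑∞-converges (_ , conv)) conv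

  ∑<-cong : ∀ n {f g} → (∀ k → k ℕ.< n → f k ≈ g k) → ∑< n f ≈ ∑< n g
  ∑<-cong zero    f≈g = refl
  ∑<-cong (suc n) f≈g = +-cong (∑<-cong n (λ k k<n → f≈g k (ℕ.m<n⇒m<1+n k<n))) (f≈g n ℕ.≤-refl)

  ∑<-mono : ∀ n {f g} → (∀ k → k ℕ.< n → f k ≤ g k) → ∑< n f ≤ ∑< n g
  ∑<-mono zero    f≤g = ≤.refl
  ∑<-mono (suc n) f≤g = +-mono-≤ (∑<-mono n (λ k k<n → f≤g k (ℕ.m<n⇒m<1+n k<n))) (f≤g n ℕ.≤-refl)

  ∑<-+ : ∀ n f g → ∑< n (λ k → f k + g k) ≈ ∑< n f + ∑< n g
  ∑<-+ zero    f g = sym (+-identityˡ 0#)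
  ∑<-+ (suc n) f g = trans (+-congʳ (∑<-+ n f g))
    (solve 4 (λ a b c d → a :+ b :+ (c :+ d) := a :+ c :+ (b :+ d)) refl _ _ _ _)

  ∑<-*ˡ : ∀ n x f → ∑< n (λ k → x * f k) ≈ x * ∑< n f
  ∑<-*ˡ zero    x f = sym (zeroʳ x)
  ∑<-*ˡ (suc n) x f = trans (+-congʳ (∑<-*ˡ n x f)) (sym (distribˡ x _ _))

  ∑<-*ʳ : ∀ n x f → ∑< n (λ k → f k * x) ≈ ∑< n f * x
  ∑<-*ʳ n x f = trans (∑<-cong n (λ k _ → *-comm (f k) x)) (trans (∑<-*ˡ n x f) (*-comm x _))

  ∑<-nonNeg : ∀ n {f} → (∀ k → 0# ≤ f k) → 0# ≤ ∑< n f
  ∑<-nonNeg zero    0≤f = ≤.refl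
  ∑<-nonNeg (suc n) 0≤f = +-nonNeg (∑<-nonNeg n 0≤f) (0≤f n)

  ∑<-extend : ∀ {f} → (∀ k → 0# ≤ f k) → ∀ {m n} → m ℕ.≤ n → ∑< m f ≤ ∑< n f
  ∑<-extend {f} 0≤f {m} {n} m≤n = go (ℕ.≤⇒≤′ m≤n)
    where
    go : ∀ {n} → m ℕ.≤′ n → ∑< m f ≤ ∑< n f
    go (ℕ.≤′-reflexive ≡.refl) = ≤.refl
    go (ℕ.≤′-step {n} m≤n)     = ≤.trans (go m≤n) (x≤x+y (0≤f n))

  term≤∑< : ∀ {f} → (∀ k → 0# ≤ f k) → ∀ {k n} → k ℕ.< n → f k ≤ ∑< n f
  term≤∑< 0≤f {k} k<n = ≤.trans (x≤y+x (∑<-nonNeg k 0≤f)) (∑<-extend 0≤f k<n)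

  ∣∑<∣≤∑<∣∣ : ∀ n f → ∣ ∑< n f ∣ ≤ ∑< n (λ k → ∣ f k ∣)
  ∣∑<∣≤∑<∣∣ zero    f = ≈⇒≤ (0≤x⇒∣x∣≈x ≤.refl)
  ∣∑<∣≤∑<∣∣ (suc n) f = ≤.trans (∣x+y∣≤∣x∣+∣y∣ _ _) (+-monoˡ-≤ _ (∣∑<∣≤∑<∣∣ n f))

  ∑<-head : ∀ n f → ∑< (suc n) f ≈ f 0 + ∑< n (f ∘ suc)
  ∑<-head zero    f = +-comm 0# (f 0)
  ∑<-head (suc n) f = trans (+-congʳ (∑<-head n f)) (+-assoc _ _ _)

  ⟶-∑< : ∀ n {f : ℕ → ℕ → ℝ} {l : ℕ → ℝ} → (∀ k → (λ D → f D k) ⟶ l k) → (λ D → ∑< n (f D)) ⟶ ∑< n l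
  ⟶-∑< zero    f⟶l = ⟶-const 0#
  ⟶-∑< (suc n) f⟶l = ⟶-+ (⟶-∑< n f⟶l) (f⟶l n)

  nonNeg-summable : ∀ {f C} → (∀ k → 0# ≤ f k) → (∀ n → ∑< n f ≤ C) → Summable f
  nonNeg-summable 0≤f ∑f≤C = monotone-limit (∑<-extend 0≤f) ∑f≤C

  -- Writing f as (f + g) - g, a difference of two nonnegative series with bounded partial sums,
  -- reduces absolute convergence to `monotone-limit`; no Cauchy criterion is involved.
  dominated-summable : ∀ {f g : ℕ → ℝ} {C} → (∀ k → ∣ f k ∣ ≤ g k) → (∀ n → ∑< n g ≤ C) → Summable f
  dominated-summable {f} {g} {C} ∣f∣≤g ∑g≤C = _ , ⟶-cong split
    (⟶-+ (proj₂ (nonNeg-summable 0≤f+g ∑f+g≤)) (⟶-*ˡ (- 1#) (proj₂ (nonNeg-summable 0≤g ∑g≤C))))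
    where
    0≤g : ∀ k → 0# ≤ g k
    0≤g k = ≤.trans (∣x∣-nonNeg (f k)) (∣f∣≤g k)

    0≤f+g : ∀ k → 0# ≤ f k + g k
    0≤f+g k = ≤-of-diff (0≤diff (≤.trans (-x≤∣x∣ (f k)) (∣f∣≤g k)))
      (solve 2 (λ f g → f :+ g :- con (ℤ.+ 0) := g :- (:- f)) refl (f k) (g k))

    ∑f+g≤ : ∀ n → ∑< n (λ k → f k + g k) ≤ C + C
    ∑f+g≤ n = begin
      ∑< n (λ k → f k + g k) ≈⟨ ∑<-+ n f g ⟩
      ∑< n f + ∑< n g        ≤⟨ +-monoˡ-≤ _ (∑<-mono n (λ k _ → ≤.trans (x≤∣x∣ (f k)) (∣f∣≤g k))) ⟩
      ∑< n g + ∑< n g        ≤⟨ +-mono-≤ (∑g≤C n) (∑g≤C n) ⟩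
      C + C                  ∎

    split : ∀ n → ∑< n (λ k → f k + g k) + - 1# * ∑< n g ≈ ∑< n f
    split n = trans (+-congʳ (∑<-+ n f g))
      (solve 2 (λ f g → f :+ g :+ :- con (ℤ.+ 1) :* g := f) refl (∑< n f) (∑< n g))

  dominated-∣∑∞∣≤ : ∀ {f g : ℕ → ℝ} {C} → (∀ k → ∣ f k ∣ ≤ g k) → (∀ n → ∑< n g ≤ C) → ∣ ∑∞ f ∣ ≤ C
  dominated-∣∑∞∣≤ {f} {g} {C} ∣f∣≤g ∑g≤C = ∣x∣≤
    (⟶-upper conv (λ n → ≤.trans (x≤∣x∣ _) (partial n)))
    (≤.trans (≈⇒≤ (sym (-1*x≈-x _)))
      (⟶-upper (⟶-*ˡ (- 1#) conv) (λ n → ≤.trans (≈⇒≤ (-1*x≈-x _)) (≤.trans (-x≤∣x∣ _) (partial n)))))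
    where
    conv : (λ n → ∑< n f) ⟶ ∑∞ f
    conv = ∑∞-converges (dominated-summable ∣f∣≤g ∑g≤C)

    partial : ∀ n → ∣ ∑< n f ∣ ≤ C
    partial n = ≤.trans (∣∑<∣≤∑<∣∣ n f) (≤.trans (∑<-mono n (λ k _ → ∣f∣≤g k)) (∑g≤C n))

  partial≤∑∞ : ∀ {f} → (∀ k → 0# ≤ f k) → Summable f → ∀ n → ∑< n f ≤ ∑∞ f
  partial≤∑∞ 0≤f sm n = ⟶-lower
    -- Along the subsequence that starts at n every partial sum is at least the one at n.
    (⟶-subsequence (n ℕ.+_) (λ k → ℕ.m≤n+m k n) (∑∞-converges sm))
    (λ k → ∑<-extend 0≤f (ℕ.m≤m+n n k))

  term≤∑∞ : ∀ {f} → (∀ k → 0# ≤ f k) → Summable f → ∀ k → f k ≤ ∑∞ f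
  term≤∑∞ 0≤f sm k = ≤.trans (term≤∑< 0≤f ℕ.≤-refl) (partial≤∑∞ 0≤f sm (suc k))

  geometric-≤ : ∀ {x} → 0# ≤ x → x < 1# → ∀ n → ∑< n (x ^_) ≤ (1# - x) ⁻¹
  geometric-≤ {x} 0≤x x<1 n = *-cancelˡ-≤ 0<1-x (begin
    (1# - x) * ∑< n (x ^_)  ≈⟨ telescope n ⟩
    1# - x ^ n              ≤⟨ ≤-of-diff (^-nonNeg n 0≤x) (solve 1 (λ p → con (ℤ.+ 1) :- (con (ℤ.+ 1) :- p) := p) refl (x ^ n)) ⟩
    1#                      ≈⟨ inverseʳ 0<1-x ⟨
    (1# - x) * (1# - x) ⁻¹  ∎)
    where
    0<1-x : 0# < 1# - x
    0<1-x = 0<diff x<1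
    telescope : ∀ n → (1# - x) * ∑< n (x ^_) ≈ 1# - x ^ n
    telescope zero    = trans (zeroʳ _) (sym (-‿inverseʳ 1#))
    telescope (suc n) = trans (distribˡ _ _ _) (trans (+-congʳ (telescope n))
      (solve 2 (λ x p → con (ℤ.+ 1) :- p :+ (con (ℤ.+ 1) :- x) :* p := con (ℤ.+ 1) :- x :* p) refl x (x ^ n)))

  scaled-geometric-≤ : ∀ {x C} → 0# ≤ C → 0# ≤ x → x < 1# → ∀ n → ∑< n (λ k → C * x ^ k) ≤ C * (1# - x) ⁻¹
  scaled-geometric-≤ {x} {C} 0≤C 0≤x x<1 n =
    ≤.trans (≈⇒≤ (∑<-*ˡ n C (x ^_))) (*-monoˡ-≤ 0≤C (geometric-≤ 0≤x x<1 n))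

  ⟶-squeeze : ∀ {u v : ℕ → ℝ} → (∀ n → ∣ u n ∣ ≤ v n) → v ⟶ 0# → u ⟶ 0#
  ⟶-squeeze {u} {v} ∣u∣≤v v⟶0 ε 0<ε with v⟶0 ε 0<ε
  ... | N , close = N , λ n N≤n → begin-strict
    ∣ u n - 0# ∣ ≈⟨ ∣x∣-cong (x-0≈x (u n)) ⟩
    ∣ u n ∣      ≤⟨ ∣u∣≤v n ⟩
    v n          ≈⟨ x-0≈x (v n) ⟨
    v n - 0#     ≤⟨ x≤∣x∣ _ ⟩
    ∣ v n - 0# ∣ <⟨ close n N≤n ⟩
    ε            ∎

  -- The Cauchy product

  -- Both sides run over the triangle i + j < n, by antidiagonals on the left and by rows on the
  -- right.
  ∑<-⊛ : ∀ n f g → ∑< n (f ⊛ g) ≈ ∑< n (λ i → f i * ∑< (n ∸ i) g)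
  ∑<-⊛ zero    f g = refl
  ∑<-⊛ (suc n) f g = begin-equality
    ∑< n (f ⊛ g) + (f ⊛ g) n
      ≈⟨ +-congʳ (∑<-⊛ n f g) ⟩
    ∑< n (λ i → f i * ∑< (n ∸ i) g) + (f ⊛ g) n
      -- The row i = n is still empty; adding it gives both sums n + 1 terms.
      ≈⟨ +-congʳ (trans (+-congˡ last≈0) (+-identityʳ _)) ⟨
    ∑< (suc n) (λ i → f i * ∑< (n ∸ i) g) + (f ⊛ g) n
      ≈⟨ ∑<-+ (suc n) _ _ ⟨
    ∑< (suc n) (λ i → f i * ∑< (n ∸ i) g + f i * g (n ∸ i))
      ≈⟨ ∑<-cong (suc n) (λ i i≤n → trans (sym (distribˡ _ _ _))
           (*-congˡ (reflexive (≡.cong (λ m → ∑< m g) (≡.sym (ℕ.+-∸-assoc 1 (ℕ.s≤s⁻¹ i≤n))))))) ⟩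
    ∑< (suc n) (λ i → f i * ∑< (suc n ∸ i) g)
      ∎
    where
    last≈0 : f n * ∑< (n ∸ n) g ≈ 0#
    last≈0 = trans (*-congˡ (reflexive (≡.cong (λ m → ∑< m g) (ℕ.n∸n≡0 n)))) (zeroʳ (f n))

  ⊛-nonNeg : ∀ {f g} → (∀ k → 0# ≤ f k) → (∀ k → 0# ≤ g k) → ∀ n → 0# ≤ (f ⊛ g) n
  ⊛-nonNeg 0≤f 0≤g n = ∑<-nonNeg (suc n) (λ k → *-nonNeg (0≤f k) (0≤g (n ∸ k)))

  -- The triangle i + j < n lies in the square of side n, which in turn lies in the triangle i + j <
  -- 2n. For nonnegative terms these inclusions squeeze the limit from both sides.
  nonNeg-cauchyProduct : ∀ {f g} → (∀ k → 0# ≤ f k) → (∀ k → 0# ≤ g k) → Summable f → Summable g →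
                         (λ n → ∑< n (f ⊛ g)) ⟶ ∑∞ f * ∑∞ g
  nonNeg-cauchyProduct {f} {g} 0≤f 0≤g sf sg = ⟶-resp L≈FG conv
    where
    ∑≤FG : ∀ n → ∑< n (f ⊛ g) ≤ ∑∞ f * ∑∞ g
    ∑≤FG n = begin
      ∑< n (f ⊛ g)                       ≈⟨ ∑<-⊛ n f g ⟩
      ∑< n (λ i → f i * ∑< (n ∸ i) g)    ≤⟨ ∑<-mono n (λ i _ → *-monoˡ-≤ (0≤f i) (partial≤∑∞ 0≤g sg (n ∸ i))) ⟩
      ∑< n (λ i → f i * ∑∞ g)            ≈⟨ ∑<-*ʳ n (∑∞ g) f ⟩
      ∑< n f * ∑∞ g                      ≤⟨ *-monoʳ-≤ (partial≤∑∞ 0≤g sg 0) (partial≤∑∞ 0≤f sf n) ⟩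
      ∑∞ f * ∑∞ g                        ∎

    sfg : Summable (f ⊛ g)
    sfg = nonNeg-summable (⊛-nonNeg 0≤f 0≤g) ∑≤FG

    conv : (λ n → ∑< n (f ⊛ g)) ⟶ ∑∞ (f ⊛ g)
    conv = ∑∞-converges sfg

    square≤triangle : ∀ n → ∑< n f * ∑< n g ≤ ∑< (n ℕ.+ n) (f ⊛ g)
    square≤triangle n = begin
      ∑< n f * ∑< n g                                 ≈⟨ ∑<-*ʳ n (∑< n g) f ⟨
      ∑< n (λ i → f i * ∑< n g)                       ≤⟨ ∑<-mono n (λ i i<n → *-monoˡ-≤ (0≤f i) (∑<-extend 0≤g (n≤ i i<n))) ⟩
      ∑< n (λ i → f i * ∑< (n ℕ.+ n ∸ i) g)           ≤⟨ ∑<-extend (λ i → *-nonNeg (0≤f i) (∑<-nonNeg (n ℕ.+ n ∸ i) 0≤g)) (ℕ.m≤m+n n n) ⟩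
      ∑< (n ℕ.+ n) (λ i → f i * ∑< (n ℕ.+ n ∸ i) g)   ≈⟨ ∑<-⊛ (n ℕ.+ n) f g ⟨
      ∑< (n ℕ.+ n) (f ⊛ g)                            ∎
      where
      n≤ : ∀ i → i ℕ.< n → n ℕ.≤ n ℕ.+ n ∸ i
      n≤ i i<n = ℕ.≤-trans (ℕ.m≤m+n n (n ∸ i)) (ℕ.≤-reflexive (≡.sym (ℕ.+-∸-assoc n (ℕ.<⇒≤ i<n))))

    L≈FG : ∑∞ (f ⊛ g) ≈ ∑∞ f * ∑∞ g
    L≈FG = ≤.antisym (⟶-upper conv ∑≤FG)
      (⟶-mono square≤triangle (⟶-* (∑∞-converges sf) (∑∞-converges sg))
        (⟶-subsequence (λ n → n ℕ.+ n) (λ n → ℕ.m≤m+n n n) conv))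

  ∣∑<-∑<∣≤ : ∀ f {m n} → m ℕ.≤ n → ∣ ∑< n f - ∑< m f ∣ ≤ ∑< n (λ k → ∣ f k ∣) - ∑< m (λ k → ∣ f k ∣)
  ∣∑<-∑<∣≤ f {m} m≤n = go (ℕ.≤⇒≤′ m≤n)
    where
    go : ∀ {n} → m ℕ.≤′ n → ∣ ∑< n f - ∑< m f ∣ ≤ ∑< n (λ k → ∣ f k ∣) - ∑< m (λ k → ∣ f k ∣)
    go (ℕ.≤′-reflexive ≡.refl) = ≈⇒≤ (trans (∣x∣-cong (-‿inverseʳ _)) (trans (0≤x⇒∣x∣≈x ≤.refl) (sym (-‿inverseʳ _))))
    go (ℕ.≤′-step {n} m≤n)     = begin
      ∣ ∑< n f + f n - ∑< m f ∣                                   ≈⟨ ∣x∣-cong (swap _ _ _) ⟩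
      ∣ ∑< n f - ∑< m f + f n ∣                                   ≤⟨ ∣x+y∣≤∣x∣+∣y∣ _ _ ⟩
      ∣ ∑< n f - ∑< m f ∣ + ∣ f n ∣                               ≤⟨ +-monoˡ-≤ _ (go m≤n) ⟩
      ∑< n (λ k → ∣ f k ∣) - ∑< m (λ k → ∣ f k ∣) + ∣ f n ∣       ≈⟨ swap _ _ _ ⟨
      ∑< n (λ k → ∣ f k ∣) + ∣ f n ∣ - ∑< m (λ k → ∣ f k ∣)       ∎
      where
      swap : ∀ x y z → x + y - z ≈ x - z + y
      swap = solve 3 (λ x y z → x :+ y :- z := x :- z :+ y) refl

  -- The defect, square minus triangle, is a sum of rows f i times a block of terms of g. Row by row
  -- it is dominated by the defect of the absolute values, which tends to zero by the nonnegative
  -- case.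
  cauchyProduct : ∀ {f g : ℕ → ℝ} {F G} → (∀ n → ∑< n (λ k → ∣ f k ∣) ≤ F) → (∀ n → ∑< n (λ k → ∣ g k ∣) ≤ G) →
                  (λ n → ∑< n (f ⊛ g)) ⟶ ∑∞ f * ∑∞ g
  cauchyProduct {f} {g} ∑∣f∣≤F ∑∣g∣≤G =
    ⟶-cong (λ n → solve 2 (λ p q → p :+ (:- con (ℤ.+ 1)) :* (p :- q) := q) refl _ _)
      (⟶-resp (trans (+-congˡ (zeroʳ _)) (+-identityʳ _))
        (⟶-+ (⟶-* (∑∞-converges (dominated-summable (λ _ → ≤.refl) ∑∣f∣≤F))
                  (∑∞-converges (dominated-summable (λ _ → ≤.refl) ∑∣g∣≤G)))
             (⟶-*ˡ (- 1#) (⟶-squeeze {v = defect ∣f∣ ∣g∣} defect-≤ defect⟶0))))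
    where
    ∣f∣ ∣g∣ : ℕ → ℝ
    ∣f∣ k = ∣ f k ∣
    ∣g∣ k = ∣ g k ∣

    0≤∣f∣ : ∀ k → 0# ≤ ∣f∣ k
    0≤∣f∣ k = ∣x∣-nonNeg (f k)

    0≤∣g∣ : ∀ k → 0# ≤ ∣g∣ k
    0≤∣g∣ k = ∣x∣-nonNeg (g k)

    defect : (ℕ → ℝ) → (ℕ → ℝ) → ℕ → ℝ
    defect f g n = ∑< n f * ∑< n g - ∑< n (f ⊛ g)

    defect-sum : ∀ f g n → defect f g n ≈ ∑< n (λ i → f i * (∑< n g - ∑< (n ∸ i) g))
    defect-sum f g n = begin-equality
      ∑< n f * ∑< n g - ∑< n (f ⊛ g)
        ≈⟨ +-cong (sym (∑<-*ʳ n _ f)) (trans (-‿cong (∑<-⊛ n f g)) (trans (sym (-1*x≈-x _)) (sym (∑<-*ˡ n (- 1#) _)))) ⟩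
      ∑< n (λ i → f i * ∑< n g) + ∑< n (λ i → - 1# * (f i * ∑< (n ∸ i) g))
        ≈⟨ ∑<-+ n _ _ ⟨
      ∑< n (λ i → f i * ∑< n g + - 1# * (f i * ∑< (n ∸ i) g))
        ≈⟨ ∑<-cong n (λ i _ → solve 3 (λ f x y → f :* x :+ (:- con (ℤ.+ 1)) :* (f :* y) := f :* (x :- y)) refl (f i) _ _) ⟩
      ∑< n (λ i → f i * (∑< n g - ∑< (n ∸ i) g))
        ∎

    defect-≤ : ∀ n → ∣ defect f g n ∣ ≤ defect ∣f∣ ∣g∣ n
    defect-≤ n = begin
      ∣ defect f g n ∣                                     ≈⟨ ∣x∣-cong (defect-sum f g n) ⟩
      ∣ ∑< n (λ i → f i * (∑< n g - ∑< (n ∸ i) g)) ∣       ≤⟨ ∣∑<∣≤∑<∣∣ n _ ⟩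
      ∑< n (λ i → ∣ f i * (∑< n g - ∑< (n ∸ i) g) ∣)       ≤⟨ ∑<-mono n (λ i _ → ≤.trans (≈⇒≤ (∣xy∣≈∣x∣∣y∣ (f i) _))
                                                                (*-monoˡ-≤ (0≤∣f∣ i) (∣∑<-∑<∣≤ g (ℕ.m∸n≤m n i)))) ⟩
      ∑< n (λ i → ∣f∣ i * (∑< n ∣g∣ - ∑< (n ∸ i) ∣g∣))     ≈⟨ defect-sum ∣f∣ ∣g∣ n ⟨
      defect ∣f∣ ∣g∣ n                                     ∎

    defect⟶0 : defect ∣f∣ ∣g∣ ⟶ 0#
    defect⟶0 = ⟶-cong (λ n → +-congˡ (-1*x≈-x _))
      (⟶-resp (trans (+-congˡ (-1*x≈-x _)) (-‿inverseʳ _))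
        (⟶-+ (⟶-* (∑∞-converges s∣f∣) (∑∞-converges s∣g∣))
             (⟶-*ˡ (- 1#) (nonNeg-cauchyProduct 0≤∣f∣ 0≤∣g∣ s∣f∣ s∣g∣))))
      where
      s∣f∣ : Summable ∣f∣
      s∣f∣ = nonNeg-summable 0≤∣f∣ ∑∣f∣≤F

      s∣g∣ : Summable ∣g∣
      s∣g∣ = nonNeg-summable 0≤∣g∣ ∑∣g∣≤G

  -- The exponential series

  exp[x]-suc : ∀ c n → fromℕ (suc n) * exp[ c x] (suc n) ≈ c * exp[ c x] n
  exp[x]-suc c n = begin-equality
    fromℕ (suc n) * (c * c ^ n * fromℕ (suc n !) ⁻¹)
      ≈⟨ solve 4 (λ N c p i → N :* (c :* p :* i) := c :* (p :* (N :* i))) refl _ c (c ^ n) _ ⟩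
    c * (c ^ n * (fromℕ (suc n) * fromℕ (suc n !) ⁻¹))
      ≈⟨ *-congˡ (*-congˡ (*-cancelˡ-≈ (0<n! n) eq)) ⟩
    c * (c ^ n * fromℕ (n !) ⁻¹)
      ∎
    where
    eq : fromℕ (n !) * (fromℕ (suc n) * fromℕ (suc n !) ⁻¹) ≈ fromℕ (n !) * fromℕ (n !) ⁻¹
    eq = begin-equality
      fromℕ (n !) * (fromℕ (suc n) * fromℕ (suc n !) ⁻¹) ≈⟨ solve 3 (λ f N i → f :* (N :* i) := N :* f :* i) refl _ _ _ ⟩
      fromℕ (suc n) * fromℕ (n !) * fromℕ (suc n !) ⁻¹   ≈⟨ *-congʳ (fromℕ-* (suc n) (n !)) ⟨
      fromℕ (suc n !) * fromℕ (suc n !) ⁻¹               ≈⟨ inverseʳ (0<n! (suc n)) ⟩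
      1#                                                 ≈⟨ inverseʳ (0<n! n) ⟨
      fromℕ (n !) * fromℕ (n !) ⁻¹                       ∎

  exp[x]-0 : ∀ c → exp[ c x] 0 ≈ 1#
  exp[x]-0 c = begin-equality
    1# * fromℕ 1 ⁻¹      ≈⟨ *-congʳ fromℕ-1 ⟨
    fromℕ 1 * fromℕ 1 ⁻¹ ≈⟨ inverseʳ (0<n! 0) ⟩
    1#                   ∎

  exp[x]-cong : ∀ {a b} n → a ≈ b → exp[ a x] n ≈ exp[ b x] n
  exp[x]-cong n a≈b = *-congʳ (^-congˡ n a≈b)

  exp[x]-nonNeg : ∀ {c} n → 0# ≤ c → 0# ≤ exp[ c x] n
  exp[x]-nonNeg n 0≤c = *-nonNeg (^-nonNeg n 0≤c) (<⇒≤ (⁻¹-pos (0<n! n)))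

  ∣exp[x]∣≈ : ∀ c n → ∣ exp[ c x] n ∣ ≈ exp[ ∣ c ∣ x] n
  ∣exp[x]∣≈ c n = trans (∣xy∣≈∣x∣∣y∣ _ _) (*-cong (∣x^n∣≈∣x∣^n c n) (0≤x⇒∣x∣≈x (<⇒≤ (⁻¹-pos (0<n! n)))))

  exp[x]-mono : ∀ {a b} n → 0# ≤ a → a ≤ b → exp[ a x] n ≤ exp[ b x] n
  exp[x]-mono n 0≤a a≤b = *-monoʳ-≤ (<⇒≤ (⁻¹-pos (0<n! n))) (^-monoˡ-≤ n 0≤a a≤b)

  exp[x]-* : ∀ a b n → exp[ a * b x] n ≈ a ^ n * exp[ b x] n
  exp[x]-* a b n = trans (*-congʳ (^-distrib-* a b n)) (*-assoc _ _ _)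

  -- The coefficientwise form of (e^(ax) e^(bx))′ = (a + b) e^(ax) e^(bx). The factor n + 1 is split
  -- as k + (n + 1 - k), and `exp[x]-suc` absorbs each part, so binomial coefficients do not occur.
  exp[x]-⊛ : ∀ a b n → (exp[ a x] ⊛ exp[ b x]) n ≈ exp[ a + b x] n
  exp[x]-⊛ a b zero    = begin-equality
    0# + exp[ a x] 0 * exp[ b x] 0 ≈⟨ +-identityˡ _ ⟩
    exp[ a x] 0 * exp[ b x] 0      ≈⟨ *-cong (exp[x]-0 a) (exp[x]-0 b) ⟩
    1# * 1#                        ≈⟨ *-identityˡ 1# ⟩
    1#                             ≈⟨ exp[x]-0 (a + b) ⟨
    exp[ a + b x] 0                ∎
  exp[x]-⊛ a b (suc n) = *-cancelˡ-≈ (fromℕ-pos {suc n} (ℕ.s≤s ℕ.z≤n)) (begin-equality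
    fromℕ (suc n) * ∑< (2 ℕ.+ n) (λ k → e k * f (suc n ∸ k))
      ≈⟨ ∑<-*ˡ (2 ℕ.+ n) _ _ ⟨
    ∑< (2 ℕ.+ n) (λ k → fromℕ (suc n) * (e k * f (suc n ∸ k)))
      ≈⟨ ∑<-cong (2 ℕ.+ n) split ⟩
    ∑< (2 ℕ.+ n) (λ k → fromℕ k * e k * f (suc n ∸ k) + e k * (fromℕ (suc n ∸ k) * f (suc n ∸ k)))
      ≈⟨ ∑<-+ (2 ℕ.+ n) _ _ ⟩
    ∑< (2 ℕ.+ n) (λ k → fromℕ k * e k * f (suc n ∸ k)) + ∑< (2 ℕ.+ n) (λ k → e k * (fromℕ (suc n ∸ k) * f (suc n ∸ k)))
      ≈⟨ +-cong left right ⟩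
    a * (exp[ a x] ⊛ exp[ b x]) n + b * (exp[ a x] ⊛ exp[ b x]) n
      ≈⟨ distribʳ _ a b ⟨
    (a + b) * (exp[ a x] ⊛ exp[ b x]) n
      ≈⟨ *-congˡ (exp[x]-⊛ a b n) ⟩
    (a + b) * exp[ a + b x] n
      ≈⟨ exp[x]-suc (a + b) n ⟨
    fromℕ (suc n) * exp[ a + b x] (suc n)
      ∎)
    where
    e f : ℕ → ℝ
    e = exp[ a x]
    f = exp[ b x]

    split : ∀ k → k ℕ.< 2 ℕ.+ n →
            fromℕ (suc n) * (e k * f (suc n ∸ k)) ≈ fromℕ k * e k * f (suc n ∸ k) + e k * (fromℕ (suc n ∸ k) * f (suc n ∸ k))
    split k k<2+n = begin-equality
      fromℕ (suc n) * (e k * f (suc n ∸ k))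
        ≡⟨ ≡.cong (λ m → fromℕ m * (e k * f (suc n ∸ k))) (ℕ.m+[n∸m]≡n (ℕ.s≤s⁻¹ k<2+n)) ⟨
      fromℕ (k ℕ.+ (suc n ∸ k)) * (e k * f (suc n ∸ k))
        ≈⟨ *-congʳ (fromℕ-+ k (suc n ∸ k)) ⟩
      (fromℕ k + fromℕ (suc n ∸ k)) * (e k * f (suc n ∸ k))
        ≈⟨ solve 4 (λ x y e f → (x :+ y) :* (e :* f) := x :* e :* f :+ e :* (y :* f)) refl _ _ _ _ ⟩
      fromℕ k * e k * f (suc n ∸ k) + e k * (fromℕ (suc n ∸ k) * f (suc n ∸ k))
        ∎

    left : ∑< (2 ℕ.+ n) (λ k → fromℕ k * e k * f (suc n ∸ k)) ≈ a * (exp[ a x] ⊛ exp[ b x]) n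
    left = begin-equality
      ∑< (2 ℕ.+ n) (λ k → fromℕ k * e k * f (suc n ∸ k))
        ≈⟨ ∑<-head (suc n) _ ⟩
      0# * e 0 * f (suc n) + ∑< (suc n) (λ k → fromℕ (suc k) * e (suc k) * f (n ∸ k))
        ≈⟨ +-cong (trans (*-congʳ (zeroˡ (e 0))) (zeroˡ _))
                  (∑<-cong (suc n) (λ k _ → trans (*-congʳ (exp[x]-suc a k)) (*-assoc a (e k) _))) ⟩
      0# + ∑< (suc n) (λ k → a * (e k * f (n ∸ k)))
        ≈⟨ +-identityˡ _ ⟩
      ∑< (suc n) (λ k → a * (e k * f (n ∸ k)))
        ≈⟨ ∑<-*ˡ (suc n) a _ ⟩
      a * (exp[ a x] ⊛ exp[ b x]) n
        ∎

    right : ∑< (2 ℕ.+ n) (λ k → e k * (fromℕ (suc n ∸ k) * f (suc n ∸ k))) ≈ b * (exp[ a x] ⊛ exp[ b x]) n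
    right = begin-equality
      ∑< (suc n) (λ k → e k * (fromℕ (suc n ∸ k) * f (suc n ∸ k))) + e (suc n) * (fromℕ (n ∸ n) * f (n ∸ n))
        ≈⟨ +-congˡ (trans (*-congˡ (trans (*-congʳ (reflexive (≡.cong fromℕ (ℕ.n∸n≡0 n)))) (zeroˡ _))) (zeroʳ _)) ⟩
      ∑< (suc n) (λ k → e k * (fromℕ (suc n ∸ k) * f (suc n ∸ k))) + 0#
        ≈⟨ +-identityʳ _ ⟩
      ∑< (suc n) (λ k → e k * (fromℕ (suc n ∸ k) * f (suc n ∸ k)))
        ≈⟨ ∑<-cong (suc n) step ⟩
      ∑< (suc n) (λ k → b * (e k * f (n ∸ k)))
        ≈⟨ ∑<-*ˡ (suc n) b _ ⟩
      b * (exp[ a x] ⊛ exp[ b x]) n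
        ∎
      where
      step : ∀ k → k ℕ.< suc n → e k * (fromℕ (suc n ∸ k) * f (suc n ∸ k)) ≈ b * (e k * f (n ∸ k))
      step k k≤n = begin-equality
        e k * (fromℕ (suc n ∸ k) * f (suc n ∸ k))
          ≡⟨ ≡.cong (λ m → e k * (fromℕ m * f m)) (ℕ.+-∸-assoc 1 (ℕ.s≤s⁻¹ k≤n)) ⟩
        e k * (fromℕ (suc (n ∸ k)) * f (suc (n ∸ k)))
          ≈⟨ *-congˡ (exp[x]-suc b (n ∸ k)) ⟩
        e k * (b * f (n ∸ k))
          ≈⟨ solve 3 (λ e b f → e :* (b :* f) := b :* (e :* f)) refl _ b _ ⟩
        b * (e k * f (n ∸ k))
          ∎

  -- Beyond an integer N ≥ c the recurrence multiplies each term by at most 1, so the largest term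
  -- is among the first N + 1, and their sum bounds it.
  exp[x]-bounded : ∀ {c} → 0# ≤ c → ∃[ M ] 0# ≤ M × (∀ n → exp[ c x] n ≤ M)
  exp[x]-bounded {c} 0≤c with archimedean c
  ... | N , c≤N = M , ∑<-nonNeg (suc N) nonNeg , bound
    where
    M : ℝ
    M = ∑< (suc N) exp[ c x]

    nonNeg : ∀ k → 0# ≤ exp[ c x] k
    nonNeg k = exp[x]-nonNeg k 0≤c

    bound : ∀ n → exp[ c x] n ≤ M
    bound zero    = term≤∑< nonNeg {0} {suc N} (ℕ.s≤s ℕ.z≤n)
    bound (suc n) with suc n ℕ.≤? N
    ... | yes n<N = term≤∑< nonNeg {suc n} {suc N} (ℕ.s≤s n<N)
    ... | no  n≮N = ≤.trans (*-cancelˡ-≤ (fromℕ-pos {suc n} (ℕ.s≤s ℕ.z≤n)) (begin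
      fromℕ (suc n) * exp[ c x] (suc n) ≈⟨ exp[x]-suc c n ⟩
      c * exp[ c x] n                   ≤⟨ *-monoʳ-≤ (nonNeg n) (≤.trans c≤N (fromℕ-mono-≤ (ℕ.<⇒≤ (ℕ.≰⇒> n≮N)))) ⟩
      fromℕ (suc n) * exp[ c x] n       ∎)) (bound n)

  ½<1 : ½ < 1#
  ½<1 = begin-strict
    ½       ≈⟨ +-identityʳ ½ ⟨
    ½ + 0#  <⟨ ≰⇒> (λ le → <⇒≱ 0<½ (≤-of-diff (0≤diff le) (solve 1 (λ h → con (ℤ.+ 0) :- h := h :+ con (ℤ.+ 0) :- (h :+ h)) refl ½))) ⟩
    ½ + ½   ≈⟨ ½+½ ⟩
    1#      ∎

  -- The terms for 2|c| are bounded by some M, and halving the argument divides the k-th term by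
  -- 2^k, which leaves a geometric series.
  ∑∣exp[x]∣-bounded : ∀ c → ∃[ C ] ∀ n → ∑< n (λ k → ∣ exp[ c x] k ∣) ≤ C
  ∑∣exp[x]∣-bounded c = M * (1# - ½) ⁻¹ , λ n → begin
    ∑< n (λ k → ∣ exp[ c x] k ∣) ≤⟨ ∑<-mono n (λ k _ → term k) ⟩
    ∑< n (λ k → M * ½ ^ k)       ≤⟨ scaled-geometric-≤ 0≤M (<⇒≤ 0<½) ½<1 n ⟩
    M * (1# - ½) ⁻¹              ∎
    where
    0≤2∣c∣ : 0# ≤ fromℕ 2 * ∣ c ∣
    0≤2∣c∣ = *-nonNeg (<⇒≤ 0<2) (∣x∣-nonNeg c)

    M : ℝ
    M = proj₁ (exp[x]-bounded 0≤2∣c∣)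

    0≤M : 0# ≤ M
    0≤M = proj₁ (proj₂ (exp[x]-bounded 0≤2∣c∣))

    term : ∀ k → ∣ exp[ c x] k ∣ ≤ M * ½ ^ k
    term k = begin
      ∣ exp[ c x] k ∣                      ≈⟨ ∣exp[x]∣≈ c k ⟩
      exp[ ∣ c ∣ x] k                      ≈⟨ exp[x]-cong k (trans (sym (*-assoc _ _ _)) (trans (*-congʳ (inverseˡ 0<2)) (*-identityˡ _))) ⟨
      exp[ ½ * (fromℕ 2 * ∣ c ∣) x] k      ≈⟨ exp[x]-* ½ _ k ⟩
      ½ ^ k * exp[ fromℕ 2 * ∣ c ∣ x] k    ≤⟨ *-monoˡ-≤ (^-nonNeg k (<⇒≤ 0<½)) (proj₂ (proj₂ (exp[x]-bounded 0≤2∣c∣)) k) ⟩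
      ½ ^ k * M                            ≈⟨ *-comm _ M ⟩
      M * ½ ^ k                            ∎

  exp-summable : ∀ c → Summable exp[ c x]
  exp-summable c = dominated-summable (λ _ → ≤.refl) (proj₂ (∑∣exp[x]∣-bounded c))

  exp-+ : ∀ x y → exp (x + y) ≈ exp x * exp y
  exp-+ x y = ∑∞-unique (⟶-cong (λ n → ∑<-cong n (λ k _ → exp[x]-⊛ x y k))
    (cauchyProduct (proj₂ (∑∣exp[x]∣-bounded x)) (proj₂ (∑∣exp[x]∣-bounded y))))

  exp-cong : ∀ {x y} → x ≈ y → exp x ≈ exp y
  exp-cong {x} {y} x≈y = ∑∞-unique (⟶-cong (λ n → ∑<-cong n (λ k _ → exp[x]-cong k (sym x≈y))) (∑∞-converges (exp-summable y)))

  exp-term-≤ : ∀ {x} → 0# ≤ x → ∀ k → exp[ x x] k ≤ exp x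
  exp-term-≤ {x} 0≤x = term≤∑∞ (λ k → exp[x]-nonNeg k 0≤x) (exp-summable x)

  1+x≤exp : ∀ {x} → 0# ≤ x → 1# + x ≤ exp x
  1+x≤exp {x} 0≤x = begin
    1# + x                          ≈⟨ +-cong (exp[x]-0 x) exp[x]-1 ⟨
    exp[ x x] 0 + exp[ x x] 1       ≈⟨ +-congʳ (+-identityˡ _) ⟨
    ∑< 2 exp[ x x]                  ≤⟨ partial≤∑∞ (λ k → exp[x]-nonNeg k 0≤x) (exp-summable x) 2 ⟩
    exp x                           ∎
    where
    exp[x]-1 : exp[ x x] 1 ≈ x
    exp[x]-1 = begin-equality
      exp[ x x] 1                 ≈⟨ *-identityˡ _ ⟨
      1# * exp[ x x] 1            ≈⟨ *-congʳ fromℕ-1 ⟨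
      fromℕ 1 * exp[ x x] 1       ≈⟨ exp[x]-suc x 0 ⟩
      x * exp[ x x] 0             ≈⟨ *-congˡ (exp[x]-0 x) ⟩
      x * 1#                      ≈⟨ *-identityʳ x ⟩
      x                           ∎

  1≤exp : ∀ {x} → 0# ≤ x → 1# ≤ exp x
  1≤exp 0≤x = ≤.trans (x≤x+y 0≤x) (1+x≤exp 0≤x)

  exp-0 : exp 0# ≈ 1#
  exp-0 = *-cancelˡ-≈ (begin-strict
      0#     <⟨ 0<1 ⟩
      1#     ≤⟨ 1≤exp ≤.refl ⟩
      exp 0# ∎)
    (begin-equality
      exp 0# * exp 0#  ≈⟨ exp-+ 0# 0# ⟨
      exp (0# + 0#)    ≈⟨ exp-cong (+-identityˡ 0#) ⟩
      exp 0#           ≈⟨ *-identityʳ _ ⟨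
      exp 0# * 1#      ∎)

  exp-inverseʳ : ∀ x → exp x * exp (- x) ≈ 1#
  exp-inverseʳ x = trans (sym (exp-+ x (- x))) (trans (exp-cong (-‿inverseʳ x)) exp-0)

  exp-pos : ∀ x → 0# < exp x
  exp-pos x with ≤.total 0# x
  ... | inj₁ 0≤x = begin-strict
    0#    <⟨ 0<1 ⟩
    1#    ≤⟨ 1≤exp 0≤x ⟩
    exp x ∎
  ... | inj₂ x≤0 with ≤-or-> (exp x) 0#
  ... | inj₂ 0<eˣ = 0<eˣ
  ... | inj₁ eˣ≤0 = contradiction (begin
    1#                ≈⟨ exp-inverseʳ x ⟨
    exp x * exp (- x) ≤⟨ *-monoʳ-≤ (≤.trans 0≤1 (1≤exp (neg-nonNeg x≤0))) eˣ≤0 ⟩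
    0# * exp (- x)    ≈⟨ zeroˡ _ ⟩
    0#                ∎) (<⇒≱ 0<1)

  exp-split : ∀ x y → exp y ≈ exp x * exp (y - x)
  exp-split x y = trans (exp-cong (sym (x+[y-x]≈y x y))) (exp-+ x (y - x))

  exp-mono : ∀ {x y} → x ≤ y → exp x ≤ exp y
  exp-mono {x} {y} x≤y = begin
    exp x               ≈⟨ *-identityʳ _ ⟨
    exp x * 1#          ≤⟨ *-monoˡ-≤ (<⇒≤ (exp-pos x)) (1≤exp (0≤diff x≤y)) ⟩
    exp x * exp (y - x) ≈⟨ exp-split x y ⟨
    exp y               ∎

  x<x+y : ∀ {x y} → 0# < y → x < x + y
  x<x+y {x} {y} 0<y = ≰⇒> λ le → <⇒≱ 0<y (≤-of-diff (0≤diff le) (solve 2 (λ x y → con (ℤ.+ 0) :- y := x :- (x :+ y)) refl x y))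

  exp-strictMono : ∀ {x y} → x < y → exp x < exp y
  exp-strictMono {x} {y} x<y = begin-strict
    exp x               ≈⟨ *-identityʳ _ ⟨
    exp x * 1#          <⟨ *-monoˡ-< (exp-pos x) (begin-strict
      1#             <⟨ x<x+y (0<diff x<y) ⟩
      1# + (y - x)   ≤⟨ 1+x≤exp (0≤diff (<⇒≤ x<y)) ⟩
      exp (y - x)    ∎) ⟩
    exp x * exp (y - x) ≈⟨ exp-split x y ⟨
    exp y               ∎

  exp-cancel-≤ : ∀ {x y} → exp x ≤ exp y → x ≤ y
  exp-cancel-≤ {x} {y} le with ≤-or-> x y
  ... | inj₁ x≤y = x≤y
  ... | inj₂ y<x = contradiction le (<⇒≱ (exp-strictMono y<x))

  exp-fromℕ* : ∀ n x → exp (fromℕ n * x) ≈ exp x ^ n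
  exp-fromℕ* zero    x = trans (exp-cong (zeroˡ x)) exp-0
  exp-fromℕ* (suc n) x = begin-equality
    exp ((1# + fromℕ n) * x)      ≈⟨ exp-cong (trans (distribʳ x 1# (fromℕ n)) (+-congʳ (*-identityˡ x))) ⟩
    exp (x + fromℕ n * x)         ≈⟨ exp-+ x (fromℕ n * x) ⟩
    exp x * exp (fromℕ n * x)     ≈⟨ *-congˡ (exp-fromℕ* n x) ⟩
    exp x * exp x ^ n             ∎

  -- The logarithm at arguments at least 1.

  ⁻¹≤1 : ∀ {x} → 1# ≤ x → x ⁻¹ ≤ 1#
  ⁻¹≤1 {x} 1≤x = *-cancelˡ-≤ 0<x (begin
    x * x ⁻¹ ≈⟨ inverseʳ 0<x ⟩
    1#       ≤⟨ 1≤x ⟩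
    x        ≈⟨ *-identityʳ x ⟨
    x * 1#   ∎)
    where
    0<x : 0# < x
    0<x = begin-strict
      0# <⟨ 0<1 ⟩
      1# ≤⟨ 1≤x ⟩
      x  ∎

  -- As 1/k! ≤ 1, the exponential series is dominated by the geometric series 1/(1 - x).
  [1-x]*exp≤1 : ∀ {x} → 0# ≤ x → x < 1# → (1# - x) * exp x ≤ 1#
  [1-x]*exp≤1 {x} 0≤x x<1 = begin
    (1# - x) * exp x        ≤⟨ *-monoˡ-≤ (0≤diff (<⇒≤ x<1)) (⟶-upper (∑∞-converges (exp-summable x)) (λ n → ≤.trans
                                 (∑<-mono n (λ k _ → ≤.trans (*-monoˡ-≤ (^-nonNeg k 0≤x) (⁻¹≤1 (1≤fromℕ (ℕ.1≤n! k)))) (≈⇒≤ (*-identityʳ _))))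
                                 (geometric-≤ 0≤x x<1 n))) ⟩
    (1# - x) * (1# - x) ⁻¹  ≈⟨ inverseʳ (0<diff x<1) ⟩
    1#                      ∎

  1≤x⇒0<x : ∀ {x} → 1# ≤ x → 0# < x
  1≤x⇒0<x {x} 1≤x = begin-strict
    0# <⟨ 0<1 ⟩
    1# ≤⟨ 1≤x ⟩
    x  ∎

  ratio-gap : ∀ {a b} → 0# < a → a < b → ∃[ δ ] 0# < δ × δ < 1# × b * (1# - δ) ≈ a
  ratio-gap {a} {b} 0<a a<b = 1# - b ⁻¹ * a , 0<diff b⁻¹a<1 , lt , eq
    where
    0<b : 0# < b
    0<b = begin-strict
      0# <⟨ 0<a ⟩
      a  <⟨ a<b ⟩
      b  ∎

    b⁻¹a<1 : b ⁻¹ * a < 1#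
    b⁻¹a<1 = begin-strict
      b ⁻¹ * a <⟨ *-monoˡ-< (⁻¹-pos 0<b) a<b ⟩
      b ⁻¹ * b ≈⟨ inverseˡ 0<b ⟩
      1#       ∎

    lt : 1# - b ⁻¹ * a < 1#
    lt = begin-strict
      1# - b ⁻¹ * a            <⟨ x<x+y (*-pos (⁻¹-pos 0<b) 0<a) ⟩
      1# - b ⁻¹ * a + b ⁻¹ * a ≈⟨ solve 1 (λ z → con (ℤ.+ 1) :- z :+ z := con (ℤ.+ 1)) refl (b ⁻¹ * a) ⟩
      1#                       ∎

    eq : b * (1# - (1# - b ⁻¹ * a)) ≈ a
    eq = begin-equality
      b * (1# - (1# - b ⁻¹ * a)) ≈⟨ solve 3 (λ b i a → b :* (con (ℤ.+ 1) :- (con (ℤ.+ 1) :- i :* a)) := b :* i :* a) refl b (b ⁻¹) a ⟩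
      b * b ⁻¹ * a               ≈⟨ *-congʳ (inverseʳ 0<b) ⟩
      1# * a                     ≈⟨ *-identityˡ a ⟩
      a                          ∎

  ≤-by-contradiction : ∀ {x y} → (y < x → x ≤ y) → x ≤ y
  ≤-by-contradiction {x} {y} h = [ (λ x≤y → x≤y) , h ]′ (≤-or-> x y)

  -- Relative gaps and (1 - δ) e^δ ≤ 1 do the work of continuity. If e^s < x, take x (1 - δ) = e^s:
  -- then e^(s + δ) ≤ x, so s is no upper bound. If e^s > x, take e^s (1 - δ) = x: then e^(s - δ) ≥
  -- x, so s - δ is a smaller upper bound.
  exp-supremum : ∀ {x s} → 0# < x → IsSupremum (λ y → exp y ≤ x) s → exp s ≈ x
  exp-supremum {x} {s} 0<x (upper , least) = ≤.antisym
    (≤-by-contradiction λ x<eˢ → too-large x<eˢ (ratio-gap 0<x x<eˢ))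
    (≤-by-contradiction λ eˢ<x → too-small eˢ<x (ratio-gap (exp-pos s) eˢ<x))
    where
    too-small : exp s < x → ∃[ δ ] 0# < δ × δ < 1# × x * (1# - δ) ≈ exp s → x ≤ exp s
    too-small eˢ<x (δ , 0<δ , δ<1 , eq) = contradiction (upper (s + δ) (*-cancelˡ-≤ (0<diff δ<1) (begin
      (1# - δ) * exp (s + δ)       ≈⟨ *-congˡ (exp-+ s δ) ⟩
      (1# - δ) * (exp s * exp δ)   ≈⟨ solve 3 (λ d s e → d :* (s :* e) := s :* (d :* e)) refl (1# - δ) (exp s) (exp δ) ⟩
      exp s * ((1# - δ) * exp δ)   ≤⟨ *-monoˡ-≤ (<⇒≤ (exp-pos s)) ([1-x]*exp≤1 (<⇒≤ 0<δ) δ<1) ⟩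
      exp s * 1#                   ≈⟨ *-identityʳ (exp s) ⟩
      exp s                        ≈⟨ eq ⟨
      x * (1# - δ)                 ≈⟨ *-comm x (1# - δ) ⟩
      (1# - δ) * x                 ∎))) (<⇒≱ (x<x+y 0<δ))

    too-large : x < exp s → ∃[ δ ] 0# < δ × δ < 1# × exp s * (1# - δ) ≈ x → exp s ≤ x
    too-large x<eˢ (δ , 0<δ , δ<1 , eq) = contradiction
      (least (s - δ) (λ y eʸ≤x → exp-cancel-≤ (≤.trans eʸ≤x x≤exp)))
      (<⇒≱ (begin-strict
        s - δ       <⟨ x<x+y 0<δ ⟩
        s - δ + δ   ≈⟨ solve 2 (λ s d → s :- d :+ d := s) refl s δ ⟩
        s           ∎))
      where
      x≤exp : x ≤ exp (s - δ)
      x≤exp = begin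
        x                                        ≈⟨ eq ⟨
        exp s * (1# - δ)                         ≈⟨ *-congˡ (*-identityʳ (1# - δ)) ⟨
        exp s * ((1# - δ) * 1#)                  ≈⟨ *-congˡ (*-congˡ (exp-inverseʳ δ)) ⟨
        exp s * ((1# - δ) * (exp δ * exp (- δ))) ≈⟨ *-congˡ (*-assoc (1# - δ) (exp δ) (exp (- δ))) ⟨
        exp s * ((1# - δ) * exp δ * exp (- δ))   ≤⟨ *-monoˡ-≤ (<⇒≤ (exp-pos s)) (*-monoʳ-≤ (<⇒≤ (exp-pos (- δ))) ([1-x]*exp≤1 (<⇒≤ 0<δ) δ<1)) ⟩
        exp s * (1# * exp (- δ))                 ≈⟨ *-congˡ (*-identityˡ (exp (- δ))) ⟩
        exp s * exp (- δ)                        ≈⟨ exp-+ s (- δ) ⟨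
        exp (s - δ)                              ∎

  -- The hypothesis 1 ≤ x puts 0 into the set, and y ≤ 1 + y ≤ e^y ≤ x bounds it for y ≥ 0. This
  -- range suffices, as logarithms are taken only of factorials and of constants M ≥ 1.
  log-exists : ∀ {x} → 1# ≤ x → ∃[ y ] exp y ≈ x
  log-exists {x} 1≤x = proj₁ sup , exp-supremum (1≤x⇒0<x 1≤x) (proj₂ sup)
    where
    bounded : IsUpperBound (λ y → exp y ≤ x) x
    bounded y eʸ≤x with ≤.total 0# y
    ... | inj₁ 0≤y = ≤.trans (≤.trans (x≤y+x 0≤1) (1+x≤exp 0≤y)) eʸ≤x
    ... | inj₂ y≤0 = ≤.trans y≤0 (≤.trans 0≤1 1≤x)

    sup : ∃ (IsSupremum (λ y → exp y ≤ x))
    sup = supremum _ (0# , ≤.trans (≈⇒≤ exp-0) 1≤x) (x , bounded)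

  exp-log : ∀ {x} → 1# ≤ x → exp (log x) ≈ x
  exp-log {x} 1≤x = choose-satisfies {λ y → exp y ≈ x} (log-exists 1≤x)

  fromℕ!^1≈ : ∀ m → fromℕ (m !) ^ᴿ 1# ≈ fromℕ (m !)
  fromℕ!^1≈ m = trans (exp-cong (*-identityˡ _)) (exp-log (1≤fromℕ (ℕ.1≤n! m)))

  -- Consequences of factorial growth

  fromℕ≤2^ : ∀ n → fromℕ n ≤ fromℕ 2 ^ n
  fromℕ≤2^ zero    = 0≤1
  fromℕ≤2^ (suc n) = begin
    1# + fromℕ n                  ≤⟨ +-mono-≤ (1≤x^n n (1≤fromℕ {2} (ℕ.s≤s ℕ.z≤n))) (fromℕ≤2^ n) ⟩
    fromℕ 2 ^ n + fromℕ 2 ^ n     ≈⟨ solve 1 (λ p → p :+ p := con (ℤ.+ 2) :* p) refl (fromℕ 2 ^ n) ⟩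
    fromℕ 2 * fromℕ 2 ^ n         ∎

  -- The common end of both negative results below: in each a free parameter is chosen so that the
  -- factor 2^n is left over at the even indices n = 2r.
  2^2n-unbounded : ∀ C r₀ → ¬ (∀ r → r₀ ℕ.≤ r → fromℕ 2 ^ (2 ℕ.* r) ≤ C)
  2^2n-unbounded C r₀ bound = impossible (archimedean C)
    where
    impossible : ¬ (∃[ N ] C ≤ fromℕ N)
    impossible (N , C≤N) = <⇒≱ C<2^2r (bound r (ℕ.m≤m+n r₀ (suc N)))
      where
      r : ℕ
      r = r₀ ℕ.+ suc N

      C<2^2r : C < fromℕ 2 ^ (2 ℕ.* r)
      C<2^2r = begin-strict
        C                       ≤⟨ C≤N ⟩
        fromℕ N                 <⟨ x<x+y 0<1 ⟩
        fromℕ N + 1#            ≈⟨ +-comm (fromℕ N) 1# ⟩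
        fromℕ (suc N)           ≤⟨ fromℕ-mono-≤ (ℕ.≤-trans (ℕ.m≤n+m (suc N) r₀) (ℕ.m≤m+n r _)) ⟩
        fromℕ (2 ℕ.* r)         ≤⟨ fromℕ≤2^ (2 ℕ.* r) ⟩
        fromℕ 2 ^ (2 ℕ.* r)     ∎

  -- The bound for x^n / n! is raised to 1 + M so that `exp-log` applies to the constant.
  power≤factorial : ∀ {x} → 0# ≤ x → ∃[ M ] 1# ≤ M × (∀ n → x ^ n ≤ M * fromℕ (n !))
  power≤factorial {x} 0≤x = enlarge (exp[x]-bounded 0≤x)
    where
    enlarge : ∃[ M ] 0# ≤ M × (∀ n → exp[ x x] n ≤ M) → ∃[ M ] 1# ≤ M × (∀ n → x ^ n ≤ M * fromℕ (n !))
    enlarge (M , 0≤M , bound) = 1# + M , x≤x+y 0≤M , λ n → begin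
      x ^ n                                     ≈⟨ *-identityʳ (x ^ n) ⟨
      x ^ n * 1#                                ≈⟨ *-congˡ (inverseˡ (0<n! n)) ⟨
      x ^ n * (fromℕ (n !) ⁻¹ * fromℕ (n !))    ≈⟨ *-assoc (x ^ n) (fromℕ (n !) ⁻¹) (fromℕ (n !)) ⟨
      exp[ x x] n * fromℕ (n !)                 ≤⟨ *-monoʳ-≤ (<⇒≤ (0<n! n)) (≤.trans (bound n) (x≤y+x 0≤1)) ⟩
      (1# + M) * fromℕ (n !)                    ∎

  module _ {a : PowerSeries} {c r₀} (0<c : 0# < c)
           (lower : ∀ r → r₀ ℕ.≤ r → c ^ (2 ℕ.* r) * fromℕ ((2 ℕ.* r) !) ≤ a (2 ℕ.* r)) where

    -- The terms of a convergent series are differences of partial sums, hence at most 2C in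
    -- absolute value. But at even n ≥ 2 r₀ they are at least y^n n! ≥ (X y)^n / M, and X = 2/y
    -- makes this 2^n / M.
    not-summable : ∀ {x} → 0# < ∣ x ∣ → ¬ Summable (λ n → a n * x ^ n)
    not-summable {x} 0<∣x∣ sm = contradict (power≤factorial (<⇒≤ (*-pos 0<2 (⁻¹-pos 0<y)))) (⟶-bounded (∑∞-converges sm))
      where
      y : ℝ
      y = c * ∣ x ∣

      0<y : 0# < y
      0<y = *-pos 0<c 0<∣x∣

      X : ℝ
      X = fromℕ 2 * y ⁻¹

      contradict : ∃[ M ] 1# ≤ M × (∀ n → X ^ n ≤ M * fromℕ (n !)) →
                   ¬ (∃[ C ] ∀ n → ∣ ∑< n (λ n → a n * x ^ n) ∣ ≤ C)
      contradict (M , 1≤M , powers) (C , partial) = 2^2n-unbounded (M * (C + C)) r₀ λ r r₀≤r →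
        let n = 2 ℕ.* r in begin
        fromℕ 2 ^ n                                ≈⟨ ^-congˡ n (trans (*-assoc (fromℕ 2) (y ⁻¹) y) (trans (*-congˡ (inverseˡ 0<y)) (*-identityʳ (fromℕ 2)))) ⟨
        (X * y) ^ n                                ≈⟨ ^-distrib-* X y n ⟩
        X ^ n * y ^ n                              ≤⟨ *-monoʳ-≤ (^-nonNeg n (<⇒≤ 0<y)) (powers n) ⟩
        M * fromℕ (n !) * y ^ n                    ≈⟨ *-congˡ (^-distrib-* c ∣ x ∣ n) ⟩
        M * fromℕ (n !) * (c ^ n * ∣ x ∣ ^ n)      ≈⟨ solve 4 (λ m f c x → m :* f :* (c :* x) := m :* (c :* f :* x)) refl M (fromℕ (n !)) (c ^ n) (∣ x ∣ ^ n) ⟩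
        M * (c ^ n * fromℕ (n !) * ∣ x ∣ ^ n)      ≤⟨ *-monoˡ-≤ (≤.trans 0≤1 1≤M) (begin
          c ^ n * fromℕ (n !) * ∣ x ∣ ^ n              ≤⟨ *-monoʳ-≤ (^-nonNeg n (<⇒≤ 0<∣x∣)) (≤.trans (lower r r₀≤r) (x≤∣x∣ (a n))) ⟩
          ∣ a n ∣ * ∣ x ∣ ^ n                          ≈⟨ *-congˡ (∣x^n∣≈∣x∣^n x n) ⟨
          ∣ a n ∣ * ∣ x ^ n ∣                          ≈⟨ ∣xy∣≈∣x∣∣y∣ (a n) (x ^ n) ⟨
          ∣ a n * x ^ n ∣                              ≤⟨ term-bound n ⟩
          C + C                                        ∎) ⟩
        M * (C + C)                                ∎
        where
        S : ℕ → ℝ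
        S n = ∑< n (λ n → a n * x ^ n)

        term-bound : ∀ n → ∣ a n * x ^ n ∣ ≤ C + C
        term-bound n = begin
          ∣ a n * x ^ n ∣               ≈⟨ ∣x∣-cong (solve 2 (λ s t → t := s :+ t :+ (:- s)) refl (S n) (a n * x ^ n)) ⟩
          ∣ S (suc n) + - S n ∣         ≤⟨ ∣x+y∣≤∣x∣+∣y∣ (S (suc n)) (- S n) ⟩
          ∣ S (suc n) ∣ + ∣ - S n ∣     ≤⟨ +-mono-≤ (partial (suc n)) (≤.trans (≈⇒≤ (∣-x∣≈∣x∣ (S n))) (partial n)) ⟩
          C + C                         ∎

    radius-zero : HasRadiusOfConvergence a 0#
    radius-zero = upper , λ u u-upper → u-upper 0# (0# , sym (0≤x⇒∣x∣≈x ≤.refl) , summable-at-0)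
      where
      upper : ∀ r → ∃[ x ] r ≈ ∣ x ∣ × Summable (λ n → a n * x ^ n) → r ≤ 0#
      upper r (x , r≈∣x∣ , sm) = ≤-by-contradiction λ 0<r → contradiction sm (not-summable (begin-strict
        0#    <⟨ 0<r ⟩
        r     ≈⟨ r≈∣x∣ ⟩
        ∣ x ∣ ∎))

      summable-at-0 : Summable (λ n → a n * 0# ^ n)
      -- As `0# ^ 0` is `1#`, the constant term survives, and the dominating series is geometric
      -- with ratio 0.
      summable-at-0 = dominated-summable {g = λ n → ∣ a 0 ∣ * 0# ^ n}
        (λ { zero    → ≈⇒≤ (trans (∣x∣-cong (*-identityʳ (a 0))) (sym (*-identityʳ ∣ a 0 ∣)))
           ; (suc n) → ≈⇒≤ (begin-equality
               ∣ a (suc n) * (0# * 0# ^ n) ∣  ≈⟨ ∣x∣-cong (trans (*-congˡ (zeroˡ (0# ^ n))) (zeroʳ (a (suc n)))) ⟩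
               ∣ 0# ∣                         ≈⟨ 0≤x⇒∣x∣≈x ≤.refl ⟩
               0#                             ≈⟨ trans (*-congˡ (zeroˡ (0# ^ n))) (zeroʳ ∣ a 0 ∣) ⟨
               ∣ a 0 ∣ * (0# * 0# ^ n)        ∎) })
        (scaled-geometric-≤ (∣x∣-nonNeg (a 0)) ≤.refl 0<1)

    -- Let δ = 1 - s > 0. At even n the two bounds on a_n force c^n (n!)^δ ≤ A B^n. Conversely z^n ≤
    -- e^(nz) = (e^(nR))^δ with R = z/δ, and e^(nR) ≤ M n!, so z^n ≤ M^δ (n!)^δ. The choice z = 2B/c
    -- combines these to 2^n ≤ A M^δ.
    not-gevrey : ∀ s → s < 1# → ¬ GevreyBound a s
    not-gevrey s s<1 (A , B , 0<A , 0<B , bound) =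
      contradict (power≤factorial (<⇒≤ (exp-pos R)))
      where
      δ z R : ℝ
      δ = 1# - s
      z = fromℕ 2 * B * c ⁻¹
      R = δ ⁻¹ * z

      0<δ : 0# < δ
      0<δ = 0<diff s<1

      0<z : 0# < z
      0<z = *-pos (*-pos 0<2 0<B) (⁻¹-pos 0<c)

      contradict : ¬ (∃[ M ] 1# ≤ M × (∀ n → exp R ^ n ≤ M * fromℕ (n !)))
      contradict (M , 1≤M , powers) = 2^2n-unbounded (A * exp (δ * log M)) r₀ λ r r₀≤r → growth (2 ℕ.* r) (lower r r₀≤r)
        where
        growth : ∀ n → c ^ n * fromℕ (n !) ≤ a n → fromℕ 2 ^ n ≤ A * exp (δ * log M)
        growth n low = *-cancelˡ-≤ (^-pos n 0<B) (begin
          B ^ n * fromℕ 2 ^ n                      ≈⟨ *-comm (B ^ n) (fromℕ 2 ^ n) ⟩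
          fromℕ 2 ^ n * B ^ n                      ≈⟨ ^-distrib-* (fromℕ 2) B n ⟨
          (fromℕ 2 * B) ^ n                        ≈⟨ ^-congˡ n cz≈2B ⟨
          (c * z) ^ n                              ≈⟨ ^-distrib-* c z n ⟩
          c ^ n * z ^ n                            ≤⟨ *-monoˡ-≤ (^-nonNeg n (<⇒≤ 0<c)) z^n≤ ⟩
          c ^ n * (exp (δ * L) * E)                ≈⟨ *-assoc (c ^ n) (exp (δ * L)) E ⟨
          c ^ n * exp (δ * L) * E                  ≤⟨ *-monoʳ-≤ (<⇒≤ (exp-pos (δ * log M))) c^n*≤ ⟩
          A * B ^ n * E                            ≈⟨ solve 3 (λ a b e → a :* b :* e := b :* (a :* e)) refl A (B ^ n) E ⟩
          B ^ n * (A * E)                          ∎)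
          where
          L E : ℝ
          L = log (fromℕ (n !))
          E = exp (δ * log M)

          exp-L : exp L ≈ fromℕ (n !)
          exp-L = exp-log (1≤fromℕ (ℕ.1≤n! n))

          cz≈2B : c * z ≈ fromℕ 2 * B
          cz≈2B = begin-equality
            c * (fromℕ 2 * B * c ⁻¹) ≈⟨ solve 3 (λ c b i → c :* (b :* i) := b :* (c :* i)) refl c (fromℕ 2 * B) (c ⁻¹) ⟩
            fromℕ 2 * B * (c * c ⁻¹) ≈⟨ *-congˡ (inverseʳ 0<c) ⟩
            fromℕ 2 * B * 1#         ≈⟨ *-identityʳ (fromℕ 2 * B) ⟩
            fromℕ 2 * B              ∎

          nR≤ : fromℕ n * R ≤ log M + L
          nR≤ = exp-cancel-≤ (begin
            exp (fromℕ n * R)      ≈⟨ exp-fromℕ* n R ⟩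
            exp R ^ n              ≤⟨ powers n ⟩
            M * fromℕ (n !)        ≈⟨ *-cong (exp-log 1≤M) exp-L ⟨
            exp (log M) * exp L    ≈⟨ exp-+ (log M) L ⟨
            exp (log M + L)        ∎)

          z^n≤ : z ^ n ≤ exp (δ * L) * E
          z^n≤ = begin
            -- Replacing z by e^z avoids log z, since z may lie below 1.
            z ^ n                          ≤⟨ ^-monoˡ-≤ n (<⇒≤ 0<z) (≤.trans (x≤y+x 0≤1) (1+x≤exp (<⇒≤ 0<z))) ⟩
            exp z ^ n                      ≈⟨ exp-fromℕ* n z ⟨
            exp (fromℕ n * z)              ≈⟨ exp-cong nz≈ ⟩
            exp (δ * (fromℕ n * R))        ≤⟨ exp-mono (*-monoˡ-≤ (<⇒≤ 0<δ) nR≤) ⟩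
            exp (δ * (log M + L))          ≈⟨ exp-cong (solve 3 (λ d m l → d :* (m :+ l) := d :* l :+ d :* m) refl δ (log M) L) ⟩
            exp (δ * L + δ * log M)        ≈⟨ exp-+ (δ * L) (δ * log M) ⟩
            exp (δ * L) * E                ∎
            where
            nz≈ : fromℕ n * z ≈ δ * (fromℕ n * R)
            nz≈ = begin-equality
              fromℕ n * z                     ≈⟨ *-congˡ (*-identityˡ z) ⟨
              fromℕ n * (1# * z)              ≈⟨ *-congˡ (*-congʳ (inverseʳ 0<δ)) ⟨
              fromℕ n * (δ * δ ⁻¹ * z)        ≈⟨ solve 4 (λ n d i z → n :* (d :* i :* z) := d :* (n :* (i :* z))) refl (fromℕ n) δ (δ ⁻¹) z ⟩
              δ * (fromℕ n * R)               ∎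

          c^n*≤ : c ^ n * exp (δ * L) ≤ A * B ^ n
          -- Here L is log n!, and cancelling (n!)^s leaves (n!)^δ beside c^n.
          c^n*≤ = *-cancelˡ-≤ (exp-pos (s * L)) (begin
            exp (s * L) * (c ^ n * exp (δ * L))  ≈⟨ solve 3 (λ x y z → x :* (y :* z) := y :* (x :* z)) refl (exp (s * L)) (c ^ n) (exp (δ * L)) ⟩
            c ^ n * (exp (s * L) * exp (δ * L))  ≈⟨ *-congˡ (exp-+ (s * L) (δ * L)) ⟨
            c ^ n * exp (s * L + δ * L)          ≈⟨ *-congˡ (exp-cong (solve 2 (λ s l → s :* l :+ (con (ℤ.+ 1) :- s) :* l := l) refl s L)) ⟩
            c ^ n * exp L                        ≈⟨ *-congˡ exp-L ⟩
            c ^ n * fromℕ (n !)                  ≤⟨ low ⟩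
            a n                                  ≤⟨ x≤∣x∣ (a n) ⟩
            ∣ a n ∣                              ≤⟨ bound n ⟩
            A * B ^ n * exp (s * L)              ≈⟨ *-comm (A * B ^ n) (exp (s * L)) ⟩
            exp (s * L) * (A * B ^ n)            ∎)

  -- Sums over lists and partitions

  ∑∈ : {X : Set} → List X → (X → ℝ) → ℝ
  ∑∈ xs f = foldr _+_ 0# (List.map f xs)

  module _ {X : Set} where

    ∑∈-mono : ∀ (xs : List X) {f g} → (∀ {x} → x ∈ xs → f x ≤ g x) → ∑∈ xs f ≤ ∑∈ xs g
    ∑∈-mono []       f≤g = ≤.refl
    ∑∈-mono (x ∷ xs) f≤g = +-mono-≤ (f≤g (here ≡.refl)) (∑∈-mono xs (f≤g ∘ there))

    ∑∈-cong : ∀ (xs : List X) {f g} → (∀ {x} → x ∈ xs → f x ≈ g x) → ∑∈ xs f ≈ ∑∈ xs g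
    ∑∈-cong []       f≈g = refl
    ∑∈-cong (x ∷ xs) f≈g = +-cong (f≈g (here ≡.refl)) (∑∈-cong xs (f≈g ∘ there))

    ∑∈-nonNeg : ∀ (xs : List X) {f} → (∀ {x} → x ∈ xs → 0# ≤ f x) → 0# ≤ ∑∈ xs f
    ∑∈-nonNeg []       0≤f = ≤.refl
    ∑∈-nonNeg (x ∷ xs) 0≤f = +-nonNeg (0≤f (here ≡.refl)) (∑∈-nonNeg xs (0≤f ∘ there))

    term≤∑∈ : ∀ {xs : List X} {f} → (∀ {x} → x ∈ xs → 0# ≤ f x) → ∀ {x} → x ∈ xs → f x ≤ ∑∈ xs f
    term≤∑∈ {_ ∷ xs} 0≤f (here ≡.refl) = x≤x+y (∑∈-nonNeg xs (0≤f ∘ there))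
    term≤∑∈ {_ ∷ xs} 0≤f (there x∈xs)  = ≤.trans (term≤∑∈ (0≤f ∘ there) x∈xs) (x≤y+x (0≤f (here ≡.refl)))

    ∑∈-+ : ∀ (xs : List X) f g → ∑∈ xs (λ x → f x + g x) ≈ ∑∈ xs f + ∑∈ xs g
    ∑∈-+ []       f g = sym (+-identityˡ 0#)
    ∑∈-+ (x ∷ xs) f g = trans (+-congˡ (∑∈-+ xs f g))
      (solve 4 (λ a b c d → a :+ b :+ (c :+ d) := a :+ c :+ (b :+ d)) refl (f x) (g x) (∑∈ xs f) (∑∈ xs g))

    ∑∈-*ˡ : ∀ (xs : List X) y f → ∑∈ xs (λ x → y * f x) ≈ y * ∑∈ xs f
    ∑∈-*ˡ []       y f = sym (zeroʳ y)
    ∑∈-*ˡ (x ∷ xs) y f = trans (+-congˡ (∑∈-*ˡ xs y f)) (sym (distribˡ y (f x) (∑∈ xs f)))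

    ∑∈-*ʳ : ∀ (xs : List X) y f → ∑∈ xs (λ x → f x * y) ≈ ∑∈ xs f * y
    ∑∈-*ʳ xs y f = trans (∑∈-cong xs (λ {x} _ → *-comm (f x) y)) (trans (∑∈-*ˡ xs y f) (*-comm y (∑∈ xs f)))

    ∣∑∈∣≤∑∈∣∣ : ∀ (xs : List X) f → ∣ ∑∈ xs f ∣ ≤ ∑∈ xs (λ x → ∣ f x ∣)
    ∣∑∈∣≤∑∈∣∣ []       f = ≈⇒≤ (0≤x⇒∣x∣≈x ≤.refl)
    ∣∑∈∣≤∑∈∣∣ (x ∷ xs) f = ≤.trans (∣x+y∣≤∣x∣+∣y∣ (f x) (∑∈ xs f)) (+-monoʳ-≤ ∣ f x ∣ (∣∑∈∣≤∑∈∣∣ xs f))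

    ∑∈-++ : ∀ (xs ys : List X) f → ∑∈ (xs ++ ys) f ≈ ∑∈ xs f + ∑∈ ys f
    ∑∈-++ []       ys f = sym (+-identityˡ (∑∈ ys f))
    ∑∈-++ (x ∷ xs) ys f = trans (+-congˡ (∑∈-++ xs ys f)) (sym (+-assoc (f x) (∑∈ xs f) (∑∈ ys f)))

    ∑∈-map : ∀ {Y : Set} (h : Y → X) ys f → ∑∈ (List.map h ys) f ≡ ∑∈ ys (f ∘ h)
    ∑∈-map h ys f = ≡.cong (foldr _+_ 0#) (≡.sym (List.map-∘ ys))

    ∑∈-concatMap : ∀ {Y : Set} (h : Y → List X) ys f → ∑∈ (concatMap h ys) f ≈ ∑∈ ys (λ y → ∑∈ (h y) f)
    ∑∈-concatMap h []       f = refl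
    ∑∈-concatMap h (y ∷ ys) f = trans (∑∈-++ (h y) (concatMap h ys) f) (+-congˡ (∑∈-concatMap h ys f))

    ∑∈-filter-≤ : ∀ {P : Pred X 0ℓ} (P? : Decidable P) xs {f g} → (∀ {x} → P x → f x ≤ g x) → (∀ x → 0# ≤ g x) →
                  ∑∈ (filter P? xs) f ≤ ∑∈ xs g
    ∑∈-filter-≤ P? []       f≤g 0≤g = ≤.refl
    ∑∈-filter-≤ P? (x ∷ xs) f≤g 0≤g with P? x
    ... | yes Px = +-mono-≤ (f≤g Px) (∑∈-filter-≤ P? xs f≤g 0≤g)
    ... | no  _  = ≤.trans (∑∈-filter-≤ P? xs f≤g 0≤g) (x≤y+x (0≤g x))

    ∑<-∑∈-swap : ∀ n (xs : List X) (f : ℕ → X → ℝ) → ∑< n (λ k → ∑∈ xs (f k)) ≈ ∑∈ xs (λ x → ∑< n (λ k → f k x))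
    ∑<-∑∈-swap zero    xs f = sym (trans (∑∈-cong xs (λ _ → sym (zeroˡ 0#))) (trans (∑∈-*ˡ xs 0# (λ _ → 0#)) (zeroˡ (∑∈ xs (λ _ → 0#)))))
    ∑<-∑∈-swap (suc n) xs f = trans (+-congʳ (∑<-∑∈-swap n xs f)) (sym (∑∈-+ xs (λ x → ∑< n (λ k → f k x)) (f n)))

  ∑∈-upTo : ∀ n f → ∑∈ (upTo n) f ≈ ∑< n f
  ∑∈-upTo zero    f = refl
  ∑∈-upTo (suc n) f = begin-equality
    ∑∈ (upTo (suc n)) f      ≡⟨ ≡.cong (λ xs → ∑∈ xs f) (List.upTo-∷ʳ n) ⟨
    ∑∈ (upTo n ++ n ∷ []) f  ≈⟨ ∑∈-++ (upTo n) (n ∷ []) f ⟩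
    ∑∈ (upTo n) f + (f n + 0#) ≈⟨ +-cong (∑∈-upTo n f) (+-identityʳ (f n)) ⟩
    ∑< n f + f n             ∎

  ∑<-const : ∀ n x → ∑< n (λ _ → x) ≈ fromℕ n * x
  ∑<-const zero    x = sym (zeroˡ x)
  ∑<-const (suc n) x = trans (+-congʳ (∑<-const n x))
    (solve 2 (λ n x → n :* x :+ x := (con (ℤ.+ 1) :+ n) :* x) refl (fromℕ n) x)

  -- The generating function of the partitions with parts at most k is the
  -- product of the geometric series ∑ⱼ x^(i j) over 1 ≤ i ≤ k, and
  -- 1 / (1 - x^i) ≤ 1 + x^i / (1 - x) ≤ exp (x^i / (1 - x)).
  module _ {x : ℝ} (0≤x : 0# ≤ x) (x<1 : x < 1#) where

    private
      Q : ℝ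
      Q = (1# - x) ⁻¹

      0<Q : 0# < Q
      0<Q = ⁻¹-pos (0<diff x<1)

      exponent : ℕ → ℝ
      exponent k = Q * ∑< k (λ j → x ^ suc j)

    [1-y]⁻¹≤exp : ∀ {y} → 0# ≤ y → y ≤ x → (1# - y) ⁻¹ ≤ exp (Q * y)
    [1-y]⁻¹≤exp {y} 0≤y y≤x = ≤.trans (*-cancelˡ-≤ 0<1-y (begin
      (1# - y) * (1# - y) ⁻¹     ≈⟨ inverseʳ 0<1-y ⟩
      1#                         ≤⟨ ≤-of-diff (*-nonNeg (*-nonNeg (<⇒≤ 0<Q) 0≤y) (0≤diff y≤x)) eq ⟩
      (1# - y) * (1# + Q * y)    ∎)) (1+x≤exp (*-nonNeg (<⇒≤ 0<Q) 0≤y))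
      where
      0<1-y : 0# < 1# - y
      0<1-y = begin-strict
        0#     <⟨ 0<diff x<1 ⟩
        1# - x ≤⟨ +-monoʳ-≤ 1# (neg-mono-≤ y≤x) ⟩
        1# - y ∎

      eq : (1# - y) * (1# + Q * y) - 1# ≈ Q * y * (x - y)
      eq = begin-equality
        (1# - y) * (1# + Q * y) - 1#
          ≈⟨ solve 3 (λ x y q → (con (ℤ.+ 1) :- y) :* (con (ℤ.+ 1) :+ q :* y) :- con (ℤ.+ 1)
                                := q :* y :* (x :- y) :+ y :* ((con (ℤ.+ 1) :- x) :* q :- con (ℤ.+ 1))) refl x y Q ⟩
        Q * y * (x - y) + y * ((1# - x) * Q - 1#)
          ≈⟨ +-congˡ (trans (*-congˡ (trans (+-congʳ (inverseʳ (0<diff x<1))) (-‿inverseʳ 1#))) (zeroʳ y)) ⟩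
        Q * y * (x - y) + 0#
          ≈⟨ +-identityʳ (Q * y * (x - y)) ⟩
        Q * y * (x - y)
          ∎

    x^[1+n]≤x : ∀ n → x ^ suc n ≤ x
    x^[1+n]≤x n = ≤.trans (*-monoˡ-≤ 0≤x (x^n≤1 n 0≤x (<⇒≤ x<1))) (≈⇒≤ (*-identityʳ x))

    -- Induction on k for one coefficient at a time. If the part k + 1 has multiplicity j, then x^n
    -- is y^j times the power of x for the remaining parts, where y = x^(k+1). The induction
    -- hypothesis bounds the remaining sum uniformly in its size, and the sum over j is geometric.
    boundedPartitions-≤ : ∀ k n → ∑∈ (boundedPartitions k n) (λ _ → x ^ n) ≤ exp (exponent k)
    boundedPartitions-≤ zero    zero    = begin
      1# + 0#           ≈⟨ +-identityʳ 1# ⟩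
      1#                ≈⟨ exp-0 ⟨
      exp 0#            ≈⟨ exp-cong (zeroʳ Q) ⟨
      exp (exponent 0)  ∎
    boundedPartitions-≤ zero    (suc n) = <⇒≤ (exp-pos (exponent 0))
    boundedPartitions-≤ (suc k) n       = begin
      ∑∈ (boundedPartitions (suc k) n) (λ _ → x ^ n)
        ≈⟨ ∑∈-concatMap block (filter fits? (upTo (suc n))) (λ _ → x ^ n) ⟩
      ∑∈ (filter fits? (upTo (suc n))) (λ j → ∑∈ (block j) (λ _ → x ^ n))
        ≤⟨ ∑∈-filter-≤ fits? (upTo (suc n)) (λ {j} → block-≤ j) (λ j → *-nonNeg (<⇒≤ 0<E) (^-nonNeg j 0≤y)) ⟩
      ∑∈ (upTo (suc n)) (λ j → E * y ^ j)
        ≈⟨ ∑∈-upTo (suc n) (λ j → E * y ^ j) ⟩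
      ∑< (suc n) (λ j → E * y ^ j)
        ≤⟨ scaled-geometric-≤ (<⇒≤ 0<E) 0≤y y<1 (suc n) ⟩
      E * (1# - y) ⁻¹
        ≤⟨ *-monoˡ-≤ (<⇒≤ 0<E) ([1-y]⁻¹≤exp 0≤y (x^[1+n]≤x k)) ⟩
      E * exp (Q * y)
        ≈⟨ exp-+ (exponent k) (Q * y) ⟨
      exp (exponent k + Q * y)
        ≈⟨ exp-cong (distribˡ Q (∑< k (λ j → x ^ suc j)) y) ⟨
      exp (exponent (suc k))
        ∎
      where
      y E : ℝ
      y = x ^ suc k
      E = exp (exponent k)

      0<E : 0# < E
      0<E = exp-pos (exponent k)

      0≤y : 0# ≤ y
      0≤y = ^-nonNeg (suc k) 0≤x

      y<1 : y < 1#
      y<1 = begin-strict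
        y  ≤⟨ x^[1+n]≤x k ⟩
        x  <⟨ x<1 ⟩
        1# ∎

      fits? : Decidable (λ j → j ℕ.* suc k ℕ.≤ n)
      fits? j = j ℕ.* suc k ℕ.≤? n

      block : ℕ → List (List ℕ)
      block j = List.map (replicate j (suc k) ++_) (boundedPartitions k (n ∸ j ℕ.* suc k))

      block-≤ : ∀ j → j ℕ.* suc k ℕ.≤ n → ∑∈ (block j) (λ _ → x ^ n) ≤ E * y ^ j
      block-≤ j j≤ = begin
        ∑∈ (block j) (λ _ → x ^ n)                  ≡⟨ ∑∈-map (replicate j (suc k) ++_) (boundedPartitions k m) (λ _ → x ^ n) ⟩
        ∑∈ (boundedPartitions k m) (λ _ → x ^ n)    ≈⟨ ∑∈-cong (boundedPartitions k m) (λ _ → x^n≈) ⟩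
        ∑∈ (boundedPartitions k m) (λ _ → y ^ j * x ^ m) ≈⟨ ∑∈-*ˡ (boundedPartitions k m) (y ^ j) (λ _ → x ^ m) ⟩
        y ^ j * ∑∈ (boundedPartitions k m) (λ _ → x ^ m) ≤⟨ *-monoˡ-≤ (^-nonNeg j 0≤y) (boundedPartitions-≤ k m) ⟩
        y ^ j * E                                   ≈⟨ *-comm (y ^ j) E ⟩
        E * y ^ j                                   ∎
        where
        m : ℕ
        m = n ∸ j ℕ.* suc k

        x^n≈ : x ^ n ≈ y ^ j * x ^ m
        x^n≈ = begin-equality
          x ^ n                       ≡⟨ ≡.cong (x ^_) (ℕ.m+[n∸m]≡n j≤) ⟨
          x ^ (j ℕ.* suc k ℕ.+ m)     ≈⟨ ^-homo-* x (j ℕ.* suc k) m ⟩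
          x ^ (j ℕ.* suc k) * x ^ m   ≡⟨ ≡.cong (λ i → x ^ i * x ^ m) (ℕ.*-comm j (suc k)) ⟩
          x ^ (suc k ℕ.* j) * x ^ m   ≈⟨ *-congʳ (^-assocʳ x (suc k) j) ⟨
          y ^ j * x ^ m               ∎

    -- The exponent is Q times a partial geometric sum, hence at most Q² for every d. Having such a
    -- bound for each x < 1 is the subexponential growth of the number of partitions.
    partitions-≤ : ∀ d → ∑∈ (partitions d) (λ _ → x ^ d) ≤ exp (Q * Q)
    partitions-≤ d = ≤.trans (boundedPartitions-≤ d d) (exp-mono (*-monoˡ-≤ (<⇒≤ 0<Q)
      (≤.trans (∑<-mono d (λ j _ → ≤.trans (*-monoʳ-≤ (^-nonNeg j 0≤x) (<⇒≤ x<1)) (≈⇒≤ (*-identityˡ (x ^ j)))))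
               (geometric-≤ 0≤x x<1 d))))

  -- Bounds for contents.

  module _ {α : ℝ} (1≤α : 1# ≤ α) where

    private
      0≤α : 0# ≤ α
      0≤α = ≤.trans 0≤1 1≤α

    -- The invariant i + |parts| ≤ M survives the removal of a row because that row has at least one
    -- box. It bounds both coordinates of every box by M, and α ≥ 1 covers the negative contents as
    -- well.
    ∣contentFrom∣≤ : ∀ {i M} parts → All (0 ℕ.<_) parts → i ℕ.+ sum parts ℕ.≤ M →
                     ∣ contentFrom i α parts ∣ ≤ fromℕ (sum parts) * (α * fromℕ M)
    ∣contentFrom∣≤ {i} {M} []       []           _  = ≈⇒≤ (trans (0≤x⇒∣x∣≈x ≤.refl) (sym (zeroˡ (α * fromℕ M))))
    ∣contentFrom∣≤ {i} {M} (p ∷ ps) (0<p ∷ 0<ps) le = begin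
      ∣ ∑< p content + contentFrom (suc i) α ps ∣            ≤⟨ ∣x+y∣≤∣x∣+∣y∣ (∑< p content) (contentFrom (suc i) α ps) ⟩
      ∣ ∑< p content ∣ + ∣ contentFrom (suc i) α ps ∣        ≤⟨ +-mono-≤ row (∣contentFrom∣≤ ps 0<ps rest) ⟩
      fromℕ p * (α * fromℕ M) + fromℕ (sum ps) * (α * fromℕ M) ≈⟨ distribʳ (α * fromℕ M) (fromℕ p) (fromℕ (sum ps)) ⟨
      (fromℕ p + fromℕ (sum ps)) * (α * fromℕ M)             ≈⟨ *-congʳ (fromℕ-+ p (sum ps)) ⟨
      fromℕ (p ℕ.+ sum ps) * (α * fromℕ M)                   ∎
      where
      content : ℕ → ℝ
      content j = α * fromℕ j - fromℕ i

      rest : suc i ℕ.+ sum ps ℕ.≤ M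
      rest = ℕ.≤-trans (ℕ.≤-reflexive (≡.sym (ℕ.+-suc i (sum ps))))
        (ℕ.≤-trans (ℕ.+-monoʳ-≤ i (ℕ.+-monoˡ-≤ (sum ps) 0<p)) le)

      box : ∀ j → j ℕ.< p → ∣ content j ∣ ≤ α * fromℕ M
      box j j<p = ∣x∣≤
        (begin
          α * fromℕ j - fromℕ i   ≤⟨ +-monoʳ-≤ (α * fromℕ j) (neg-nonPos (fromℕ-nonNeg i)) ⟩
          α * fromℕ j + 0#        ≈⟨ +-identityʳ (α * fromℕ j) ⟩
          α * fromℕ j             ≤⟨ *-monoˡ-≤ 0≤α (fromℕ-mono-≤ (ℕ.≤-trans (ℕ.<⇒≤ j<p) (ℕ.≤-trans (ℕ.m≤m+n p (sum ps)) (ℕ.m+n≤o⇒n≤o i le)))) ⟩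
          α * fromℕ M             ∎)
        (begin
          - (α * fromℕ j - fromℕ i) ≈⟨ solve 2 (λ a i → :- (a :- i) := i :- a) refl (α * fromℕ j) (fromℕ i) ⟩
          fromℕ i - α * fromℕ j   ≤⟨ +-monoʳ-≤ (fromℕ i) (neg-nonPos (*-nonNeg 0≤α (fromℕ-nonNeg j))) ⟩
          fromℕ i + 0#            ≈⟨ trans (+-identityʳ (fromℕ i)) (sym (*-identityˡ (fromℕ i))) ⟩
          1# * fromℕ i            ≤⟨ *-mono-≤ 0≤1 (fromℕ-nonNeg i) 1≤α (fromℕ-mono-≤ (ℕ.m+n≤o⇒m≤o i le)) ⟩
          α * fromℕ M             ∎)

      row : ∣ ∑< p content ∣ ≤ fromℕ p * (α * fromℕ M)
      row = begin
        ∣ ∑< p content ∣             ≤⟨ ∣∑<∣≤∑<∣∣ p content ⟩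
        ∑< p (λ j → ∣ content j ∣)   ≤⟨ ∑<-mono p box ⟩
        ∑< p (λ _ → α * fromℕ M)     ≈⟨ ∑<-const p (α * fromℕ M) ⟩
        fromℕ p * (α * fromℕ M)      ∎

    ∣𝖢∣≤ : ∀ {d parts} → IsPartition d parts → ∣ 𝖢 α parts ∣ ≤ α * (fromℕ d * fromℕ d)
    ∣𝖢∣≤ {d} {parts} (isPartition _ positive ≡.refl) = ≤.trans (∣contentFrom∣≤ parts positive ℕ.≤-refl)
      (≈⇒≤ (solve 2 (λ a d → d :* (a :* d) := a :* (d :* d)) refl α (fromℕ d)))

    -- A row of m + 1 boxes has content α m (m + 1) / 2. Doubling it keeps the induction free of
    -- division.
    𝖢-row : ∀ m → fromℕ m * fromℕ m ≤ fromℕ 2 * 𝖢 α (suc m ∷ [])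
    𝖢-row m = ≤.trans (go m) (*-monoˡ-≤ (<⇒≤ 0<2) (≈⇒≤ (sym (+-identityʳ (∑< (suc m) content)))))
      where
      content : ℕ → ℝ
      content j = α * fromℕ j - 0#

      go : ∀ m → fromℕ m * fromℕ m ≤ fromℕ 2 * ∑< (suc m) content
      go zero    = ≈⇒≤ (solve 1 (λ a → con (ℤ.+ 0) :* con (ℤ.+ 0) := con (ℤ.+ 2) :* (con (ℤ.+ 0) :+ (a :* con (ℤ.+ 0) :- con (ℤ.+ 0)))) refl α)
      go (suc m) = ≤-of-diff
        (+-nonNeg (+-nonNeg (0≤diff (go m)) (*-nonNeg (*-nonNeg (<⇒≤ 0<2) (0≤diff 1≤α)) (fromℕ-nonNeg (suc m)))) 0≤1)
        (solve 3 (λ a m s → con (ℤ.+ 2) :* (s :+ (a :* (con (ℤ.+ 1) :+ m) :- con (ℤ.+ 0))) :- (con (ℤ.+ 1) :+ m) :* (con (ℤ.+ 1) :+ m)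
           := con (ℤ.+ 2) :* s :- m :* m :+ con (ℤ.+ 2) :* (a :- con (ℤ.+ 1)) :* (con (ℤ.+ 1) :+ m) :+ con (ℤ.+ 1))
          refl α (fromℕ m) (∑< (suc m) content))

  -- Truncations of the shifted series

  ⊛-cong : ∀ {f f′ g g′} n → (∀ k → f k ≈ f′ k) → (∀ k → g k ≈ g′ k) → (f ⊛ g) n ≈ (f′ ⊛ g′) n
  ⊛-cong n f≈f′ g≈g′ = ∑<-cong (suc n) (λ k _ → *-cong (f≈f′ k) (g≈g′ (n ∸ k)))

  ⟶-⊛ : ∀ {f g : ℕ → PowerSeries} {F G : PowerSeries} n →
        (∀ k → (λ D → f D k) ⟶ F k) → (∀ k → (λ D → g D k) ⟶ G k) → (λ D → (f D ⊛ g D) n) ⟶ (F ⊛ G) n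
  ⟶-⊛ n f⟶F g⟶G = ⟶-∑< (suc n) (λ k → ⟶-* (f⟶F k) (g⟶G (n ∸ k)))

  exp[x]-even-nonNeg : ∀ a r → 0# ≤ exp[ a x] (2 ℕ.* r)
  exp[x]-even-nonNeg a r = *-nonNeg (^2n-nonNeg a r) (<⇒≤ (⁻¹-pos (0<n! (2 ℕ.* r))))

  module _ {X : Set} (xs : List X) (w : X → ℝ) where

    ⊛-∑∈ʳ : ∀ (f : PowerSeries) (g : X → PowerSeries) n →
            (f ⊛ (λ k → ∑∈ xs (λ x → w x * g x k))) n ≈ ∑∈ xs (λ x → w x * (f ⊛ g x) n)
    ⊛-∑∈ʳ f g n = begin-equality
      ∑< (suc n) (λ k → f k * ∑∈ xs (λ x → w x * g x (n ∸ k)))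
        ≈⟨ ∑<-cong (suc n) (λ k _ → trans (sym (∑∈-*ˡ xs (f k) (λ x → w x * g x (n ∸ k))))
             (∑∈-cong xs (λ {x} _ → solve 3 (λ f w g → f :* (w :* g) := w :* (f :* g)) refl (f k) (w x) (g x (n ∸ k))))) ⟩
      ∑< (suc n) (λ k → ∑∈ xs (λ x → w x * (f k * g x (n ∸ k))))
        ≈⟨ ∑<-∑∈-swap (suc n) xs (λ k x → w x * (f k * g x (n ∸ k))) ⟩
      ∑∈ xs (λ x → ∑< (suc n) (λ k → w x * (f k * g x (n ∸ k))))
        ≈⟨ ∑∈-cong xs (λ {x} _ → ∑<-*ˡ (suc n) (w x) (λ k → f k * g x (n ∸ k))) ⟩
      ∑∈ xs (λ x → w x * (f ⊛ g x) n)
        ∎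

    ⊛-∑∈ˡ : ∀ (f : X → PowerSeries) (g : PowerSeries) n →
            ((λ k → ∑∈ xs (λ x → w x * f x k)) ⊛ g) n ≈ ∑∈ xs (λ x → w x * (f x ⊛ g) n)
    ⊛-∑∈ˡ f g n = begin-equality
      ∑< (suc n) (λ k → ∑∈ xs (λ x → w x * f x k) * g (n ∸ k))
        ≈⟨ ∑<-cong (suc n) (λ k _ → trans (sym (∑∈-*ʳ xs (g (n ∸ k)) (λ x → w x * f x k)))
             (∑∈-cong xs (λ {x} _ → *-assoc (w x) (f x k) (g (n ∸ k))))) ⟩
      ∑< (suc n) (λ k → ∑∈ xs (λ x → w x * (f x k * g (n ∸ k))))
        ≈⟨ ∑<-∑∈-swap (suc n) xs (λ k x → w x * (f x k * g (n ∸ k))) ⟩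
      ∑∈ xs (λ x → ∑< (suc n) (λ k → w x * (f x k * g (n ∸ k))))
        ≈⟨ ∑∈-cong xs (λ {x} _ → ∑<-*ˡ (suc n) (w x) (λ k → f x k * g (n ∸ k))) ⟩
      ∑∈ xs (λ x → w x * (f x ⊛ g) n)
        ∎

  partitionsBelow : ℕ → List (List ℕ)
  partitionsBelow D = concatMap partitions (upTo D)

  ∑∈-partitionsBelow : ∀ D f → ∑∈ (partitionsBelow D) f ≈ ∑< D (λ d → ∑∈ (partitions d) f)
  ∑∈-partitionsBelow D f = trans (∑∈-concatMap partitions (upTo D) f) (∑∈-upTo D (λ d → ∑∈ (partitions d) f))

  partition∈partitionsBelow : ∀ {d D parts} → d ℕ.< D → IsPartition d parts → parts ∈ partitionsBelow D
  partition∈partitionsBelow d<D ip = ∈-concat⁺′ (∈-partitions⁺ ip) (∈-map⁺ partitions (∈-upTo⁺ d<D))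

  partitionsBelow-∈ : ∀ D {parts} → parts ∈ partitionsBelow D → ∃[ d ] parts ∈ partitions d
  partitionsBelow-∈ D p∈ with ∈-concat⁻′ (List.map partitions (upTo D)) p∈
  ... | _ , p∈ps , ps∈ with ∈-map⁻ partitions ps∈
  ... | d , _ , ≡.refl = d , p∈ps

  sum-partition : ∀ {d parts} → parts ∈ partitions d → sum parts ≡ d
  sum-partition = IsPartition.size ∘ ∈-partitions⁻

  -- A partition p contributes q^|p| exp(E x) to `𝓗-shifted b q u c`, where E is this number: |p| u
  -- comes from the shifted argument and the content from the rescaled ħ.
  shiftedExponent : (b u c : ℝ) → List ℕ → ℝ
  shiftedExponent b u c parts = fromℕ (sum parts) * u + c * 𝖢 (1# + b) parts

  module _ (b q u c : ℝ) where

    𝓗-term : ℕ → ℕ → ℝ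
    𝓗-term n d = q ^ d * (exp[ fromℕ d * u x] ⊛ rescale c (𝓗-coeff b d)) n

    -- Power sums divided by factorials are coefficients of a sum of exponentials. The weight `1#`
    -- is there to match the shape of `⊛-∑∈ʳ`.
    rescaled-𝓗-coeff≈ : ∀ d k → rescale c (𝓗-coeff b d) k ≈ ∑∈ (partitions d) (λ p → 1# * exp[ c * 𝖢 (1# + b) p x] k)
    rescaled-𝓗-coeff≈ d k = begin-equality
      c ^ k * (∑∈ (partitions d) (λ p → C p ^ k) * fromℕ (k !) ⁻¹)
        ≈⟨ *-congˡ (∑∈-*ʳ (partitions d) (fromℕ (k !) ⁻¹) (λ p → C p ^ k)) ⟨
      c ^ k * ∑∈ (partitions d) (λ p → C p ^ k * fromℕ (k !) ⁻¹)
        ≈⟨ ∑∈-*ˡ (partitions d) (c ^ k) (λ p → C p ^ k * fromℕ (k !) ⁻¹) ⟨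
      ∑∈ (partitions d) (λ p → c ^ k * (C p ^ k * fromℕ (k !) ⁻¹))
        ≈⟨ ∑∈-cong (partitions d) (λ {p} _ → trans (sym (exp[x]-* c (C p) k)) (sym (*-identityˡ (exp[ c * C p x] k)))) ⟩
      ∑∈ (partitions d) (λ p → 1# * exp[ c * C p x] k)
        ∎
      where
      C : List ℕ → ℝ
      C = 𝖢 (1# + b)

    𝓗-term≈ : ∀ n d → 𝓗-term n d ≈ ∑∈ (partitions d) (λ p → q ^ sum p * exp[ shiftedExponent b u c p x] n)
    𝓗-term≈ n d = begin-equality
      q ^ d * (exp[ fromℕ d * u x] ⊛ rescale c (𝓗-coeff b d)) n
        ≈⟨ *-congˡ (⊛-cong {f = exp[ fromℕ d * u x]} n (λ _ → refl) (rescaled-𝓗-coeff≈ d)) ⟩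
      q ^ d * (exp[ fromℕ d * u x] ⊛ (λ k → ∑∈ (partitions d) (λ p → 1# * exp[ c * 𝖢 (1# + b) p x] k))) n
        ≈⟨ *-congˡ (⊛-∑∈ʳ (partitions d) (λ _ → 1#) exp[ fromℕ d * u x] (λ p → exp[ c * 𝖢 (1# + b) p x]) n) ⟩
      q ^ d * ∑∈ (partitions d) (λ p → 1# * (exp[ fromℕ d * u x] ⊛ exp[ c * 𝖢 (1# + b) p x]) n)
        ≈⟨ ∑∈-*ˡ (partitions d) (q ^ d) (λ p → 1# * (exp[ fromℕ d * u x] ⊛ exp[ c * 𝖢 (1# + b) p x]) n) ⟨
      ∑∈ (partitions d) (λ p → q ^ d * (1# * (exp[ fromℕ d * u x] ⊛ exp[ c * 𝖢 (1# + b) p x]) n))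
        ≈⟨ ∑∈-cong (partitions d) (λ {p} p∈ → trans
             (*-congˡ (trans (*-identityˡ ((exp[ fromℕ d * u x] ⊛ exp[ c * 𝖢 (1# + b) p x]) n))
                             (exp[x]-⊛ (fromℕ d * u) (c * 𝖢 (1# + b) p) n)))
             -- With the degree written as `sum p` the summand no longer mentions d, so all degrees
             -- can be merged into one list.
             (reflexive (≡.cong (λ e → q ^ e * exp[ fromℕ e * u + c * 𝖢 (1# + b) p x] n) (≡.sym (sum-partition {d} p∈))))) ⟩
      ∑∈ (partitions d) (λ p → q ^ sum p * exp[ shiftedExponent b u c p x] n)
        ∎

    𝓗-partial : ℕ → PowerSeries
    𝓗-partial D n = ∑< D (𝓗-term n)

    𝓗-partial≈ : ∀ D n → 𝓗-partial D n ≈ ∑∈ (partitionsBelow D) (λ p → q ^ sum p * exp[ shiftedExponent b u c p x] n)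
    𝓗-partial≈ D n = trans (∑<-cong D (λ d _ → 𝓗-term≈ n d))
      (sym (∑∈-partitionsBelow D (λ p → q ^ sum p * exp[ shiftedExponent b u c p x] n)))

  module _ (b q e u v c : ℝ) where

    -- At the parameters occurring in 𝓩 this is -t F_b(μ,ν,m).
    pairExponent : List ℕ → List ℕ → ℝ
    pairExponent μ ν = e + shiftedExponent b u c μ + shiftedExponent b v c ν

    -- Truncating both series makes the expansion over pairs pure finite algebra; convergence in D
    -- is established separately, in `productPartial⟶`.
    productPartial : ℕ → PowerSeries
    productPartial D = exp[ e x] ⊛ 𝓗-partial b q u c D ⊛ 𝓗-partial b q v c D

    productPartial≈ : ∀ D n → productPartial D n ≈
      ∑∈ (partitionsBelow D) (λ μ → q ^ sum μ * ∑∈ (partitionsBelow D) (λ ν → q ^ sum ν * exp[ pairExponent μ ν x] n))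
    productPartial≈ D n = begin-equality
      (exp[ e x] ⊛ 𝓗-partial b q u c D ⊛ 𝓗-partial b q v c D) n
        ≈⟨ ⊛-cong {f = exp[ e x] ⊛ 𝓗-partial b q u c D} {g = 𝓗-partial b q v c D} n left (λ _ → refl) ⟩
      ((λ k → ∑∈ Λ (λ μ → w μ * exp[ e + U μ x] k)) ⊛ 𝓗-partial b q v c D) n
        ≈⟨ ⊛-∑∈ˡ Λ w (λ μ → exp[ e + U μ x]) (𝓗-partial b q v c D) n ⟩
      ∑∈ Λ (λ μ → w μ * (exp[ e + U μ x] ⊛ 𝓗-partial b q v c D) n)
        ≈⟨ ∑∈-cong Λ (λ {μ} _ → *-congˡ (exp⊛ (e + U μ) v n)) ⟩
      ∑∈ Λ (λ μ → w μ * ∑∈ Λ (λ ν → w ν * exp[ e + U μ + V ν x] n))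
        ∎
      where
      Λ : List (List ℕ)
      Λ = partitionsBelow D

      w U V : List ℕ → ℝ
      w p = q ^ sum p
      U = shiftedExponent b u c
      V = shiftedExponent b v c

      exp⊛ : ∀ a v k → (exp[ a x] ⊛ 𝓗-partial b q v c D) k ≈ ∑∈ Λ (λ p → w p * exp[ a + shiftedExponent b v c p x] k)
      exp⊛ a v k = begin-equality
        (exp[ a x] ⊛ 𝓗-partial b q v c D) k
          ≈⟨ ⊛-cong {f = exp[ a x]} k (λ _ → refl) (𝓗-partial≈ b q v c D) ⟩
        (exp[ a x] ⊛ (λ j → ∑∈ Λ (λ p → w p * exp[ shiftedExponent b v c p x] j))) k
          ≈⟨ ⊛-∑∈ʳ Λ w exp[ a x] (λ p → exp[ shiftedExponent b v c p x]) k ⟩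
        ∑∈ Λ (λ p → w p * (exp[ a x] ⊛ exp[ shiftedExponent b v c p x]) k)
          ≈⟨ ∑∈-cong Λ (λ {p} _ → *-congˡ (exp[x]-⊛ a (shiftedExponent b v c p) k)) ⟩
        ∑∈ Λ (λ p → w p * exp[ a + shiftedExponent b v c p x] k)
          ∎

      left : ∀ k → (exp[ e x] ⊛ 𝓗-partial b q u c D) k ≈ ∑∈ Λ (λ μ → w μ * exp[ e + U μ x] k)
      left = exp⊛ e u

    module _ (0≤q : 0# ≤ q) where

      productPartial-even-nonNeg : ∀ D r → 0# ≤ productPartial D (2 ℕ.* r)
      productPartial-even-nonNeg D r = ≤.trans
        (∑∈-nonNeg (partitionsBelow D) (λ {μ} _ → *-nonNeg (^-nonNeg (sum μ) 0≤q)
          (∑∈-nonNeg (partitionsBelow D) (λ {ν} _ → *-nonNeg (^-nonNeg (sum ν) 0≤q) (exp[x]-even-nonNeg (pairExponent μ ν) r)))))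
        (≈⇒≤ (sym (productPartial≈ D (2 ℕ.* r))))

      term≤productPartial : ∀ {D μ ν} r → μ ∈ partitionsBelow D → ν ∈ partitionsBelow D →
                            q ^ sum μ * (q ^ sum ν * exp[ pairExponent μ ν x] (2 ℕ.* r)) ≤ productPartial D (2 ℕ.* r)
      term≤productPartial {D} {μ} {ν} r μ∈ ν∈ = begin
        q ^ sum μ * (q ^ sum ν * exp[ pairExponent μ ν x] (2 ℕ.* r))
          ≤⟨ *-monoˡ-≤ (^-nonNeg (sum μ) 0≤q) (term≤∑∈ {f = inner μ} (λ {ν} _ → inner-nonNeg μ ν) ν∈) ⟩
        q ^ sum μ * ∑∈ (partitionsBelow D) (inner μ)
          ≤⟨ term≤∑∈ {f = λ μ → q ^ sum μ * ∑∈ (partitionsBelow D) (inner μ)}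
               (λ {μ} _ → *-nonNeg (^-nonNeg (sum μ) 0≤q) (∑∈-nonNeg (partitionsBelow D) (λ {ν} _ → inner-nonNeg μ ν))) μ∈ ⟩
        ∑∈ (partitionsBelow D) (λ μ → q ^ sum μ * ∑∈ (partitionsBelow D) (inner μ))
          ≈⟨ productPartial≈ D (2 ℕ.* r) ⟨
        productPartial D (2 ℕ.* r)
          ∎
        where
        inner : List ℕ → List ℕ → ℝ
        inner μ ν = q ^ sum ν * exp[ pairExponent μ ν x] (2 ℕ.* r)

        inner-nonNeg : ∀ μ ν → 0# ≤ inner μ ν
        inner-nonNeg μ ν = *-nonNeg (^-nonNeg (sum ν) 0≤q) (exp[x]-even-nonNeg (pairExponent μ ν) r)

  -- Uniform bounds

  -- In the induction step (2n + 2)(2n + 1) ≤ (2n + 2)² = 4 (n + 1)².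
  [2n]!≤4^n*n!² : ∀ n → fromℕ ((2 ℕ.* n) !) ≤ fromℕ 4 ^ n * (fromℕ (n !) * fromℕ (n !))
  [2n]!≤4^n*n!² zero    = ≈⇒≤ (solve 0 (con (ℤ.+ 1) :+ con (ℤ.+ 0) := con (ℤ.+ 1) :* ((con (ℤ.+ 1) :+ con (ℤ.+ 0)) :* (con (ℤ.+ 1) :+ con (ℤ.+ 0)))) refl)
  [2n]!≤4^n*n!² (suc n) = begin
    fromℕ ((2 ℕ.* suc n) !)
      ≡⟨ ≡.cong (λ k → fromℕ (k !)) (ℕ.*-suc 2 n) ⟩
    fromℕ ((2 ℕ.+ 2 ℕ.* n) !)
      ≈⟨ trans (fromℕ-* (2 ℕ.+ m) ((1 ℕ.+ m) !)) (*-congˡ (fromℕ-* (1 ℕ.+ m) (m !))) ⟩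
    fromℕ (2 ℕ.+ m) * (fromℕ (1 ℕ.+ m) * fromℕ (m !))
      ≤⟨ *-monoˡ-≤ (fromℕ-nonNeg (2 ℕ.+ m)) (*-mono-≤ (fromℕ-nonNeg (1 ℕ.+ m)) (fromℕ-nonNeg (m !)) (fromℕ-mono-≤ (ℕ.n≤1+n (1 ℕ.+ m))) ([2n]!≤4^n*n!² n)) ⟩
    fromℕ (2 ℕ.+ m) * (fromℕ (2 ℕ.+ m) * (fromℕ 4 ^ n * (fromℕ (n !) * fromℕ (n !))))
      ≈⟨ *-cong double (*-congʳ double) ⟩
    fromℕ 2 * N * (fromℕ 2 * N * (fromℕ 4 ^ n * (fromℕ (n !) * fromℕ (n !))))
      ≈⟨ solve 3 (λ N p f → con (ℤ.+ 2) :* N :* (con (ℤ.+ 2) :* N :* (p :* (f :* f))) := con (ℤ.+ 4) :* p :* (N :* f :* (N :* f))) refl N (fromℕ 4 ^ n) (fromℕ (n !)) ⟩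
    fromℕ 4 ^ suc n * (N * fromℕ (n !) * (N * fromℕ (n !)))
      ≈⟨ *-congˡ (*-cong (fromℕ-* (suc n) (n !)) (fromℕ-* (suc n) (n !))) ⟨
    fromℕ 4 ^ suc n * (fromℕ (suc n !) * fromℕ (suc n !))
      ∎
    where
    m : ℕ
    m = 2 ℕ.* n

    N : ℝ
    N = fromℕ (suc n)

    double : fromℕ (2 ℕ.+ m) ≈ fromℕ 2 * N
    double = trans (reflexive (≡.cong fromℕ (≡.sym (ℕ.*-suc 2 n)))) (fromℕ-* 2 (suc n))

  ⟶-∣∣-upper : ∀ {u : ℕ → ℝ} {l C} → u ⟶ l → (∀ n → ∣ u n ∣ ≤ C) → ∣ l ∣ ≤ C
  ⟶-∣∣-upper {u} {l} {C} u⟶l ∣u∣≤C = ∣x∣≤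
    (⟶-upper u⟶l (λ n → ≤.trans (x≤∣x∣ (u n)) (∣u∣≤C n)))
    (≤.trans (≈⇒≤ (sym (-1*x≈-x l))) (⟶-upper (⟶-*ˡ (- 1#) u⟶l)
      (λ n → ≤.trans (≈⇒≤ (-1*x≈-x (u n))) (≤.trans (-x≤∣x∣ (u n)) (∣u∣≤C n)))))

  ∣fromℤ∣ : ∀ m → ∣ fromℤ m ∣ ≈ fromℕ ℤ.∣ m ∣
  ∣fromℤ∣ (ℤ.+ n)  = 0≤x⇒∣x∣≈x (fromℕ-nonNeg n)
  ∣fromℤ∣ -[1+ n ] = trans (∣-x∣≈∣x∣ (fromℕ (suc n))) (0≤x⇒∣x∣≈x (fromℕ-nonNeg (suc n)))

  fromℤ^2≈ : ∀ m → fromℤ m ^ 2 ≈ fromℕ ℤ.∣ m ∣ * fromℕ ℤ.∣ m ∣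
  fromℤ^2≈ (ℤ.+ n)  = *-congˡ (*-identityʳ (fromℕ n))
  fromℤ^2≈ -[1+ n ] = solve 1 (λ n → (:- n) :* ((:- n) :* con (ℤ.+ 1)) := n :* n) refl (fromℕ (suc n))

  n≤n² : ∀ n → fromℕ n ≤ fromℕ n * fromℕ n
  n≤n² zero    = ≈⇒≤ (sym (zeroˡ 0#))
  n≤n² (suc n) = ≤.trans (≈⇒≤ (sym (*-identityʳ (fromℕ (suc n))))) (*-monoˡ-≤ (fromℕ-nonNeg (suc n)) (1≤fromℕ {suc n} (ℕ.s≤s ℕ.z≤n)))

  module Bounds {s K : ℝ} (0<s : 0# < s) (0≤K : 0# ≤ K) where

    -- Roles of the constants: Q bounds the geometric series in x, P bounds x^d times the number of
    -- partitions of d, V bounds the sums of q^|p| y^|p| over partitions, and B = 4K/s² is the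
    -- growth rate in the upper bound.
    x y Q P V B κ : ℝ
    x = exp (- s)
    y = exp s
    Q = (1# - x) ⁻¹
    P = exp (Q * Q)
    V = P * Q
    κ = K * (s * s) ⁻¹
    B = fromℕ 4 * κ

    0≤x : 0# ≤ x
    0≤x = <⇒≤ (exp-pos (- s))

    0≤y : 0# ≤ y
    0≤y = <⇒≤ (exp-pos s)

    x<1 : x < 1#
    x<1 = begin-strict
      exp (- s)  <⟨ exp-strictMono -s<0 ⟩
      exp 0#     ≈⟨ exp-0 ⟩
      1#         ∎
      where
      -s<0 : - s < 0#
      -s<0 = begin-strict
        - s      <⟨ x<x+y 0<s ⟩
        - s + s  ≈⟨ -‿inverseˡ s ⟩
        0#       ∎

    0<P : 0# < P
    0<P = exp-pos (Q * Q)

    0<Q : 0# < Q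
    0<Q = ⁻¹-pos (0<diff x<1)

    0<V : 0# < V
    0<V = *-pos 0<P 0<Q

    0<s² : 0# < s * s
    0<s² = *-pos 0<s 0<s

    0≤κ : 0# ≤ κ
    0≤κ = *-nonNeg 0≤K (<⇒≤ (⁻¹-pos 0<s²))

    0≤B : 0# ≤ B
    0≤B = *-nonNeg (fromℕ-nonNeg 4) 0≤κ

    -- (s z)^(2n) / (2n)! ≤ e^(s z), being one term of the exponential series.
    ∣exp[x]∣≤ : ∀ {a} z n → ∣ a ∣ ≤ K * (fromℕ z * fromℕ z) → ∣ exp[ a x] n ∣ ≤ B ^ n * fromℕ (n !) * y ^ z
    ∣exp[x]∣≤ {a} z n ∣a∣≤ = begin
      ∣ exp[ a x] n ∣                                        ≈⟨ ∣exp[x]∣≈ a n ⟩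
      exp[ ∣ a ∣ x] n                                        ≤⟨ exp[x]-mono n (∣x∣-nonNeg a) ∣a∣≤ ⟩
      exp[ K * (Z * Z) x] n                                  ≈⟨ exp[x]-cong n K*Z²≈ ⟩
      exp[ κ * (s * Z * (s * Z)) x] n                        ≈⟨ exp[x]-* κ (s * Z * (s * Z)) n ⟩
      κ ^ n * ((s * Z * (s * Z)) ^ n * n!⁻¹)                 ≈⟨ *-congˡ (*-congʳ (^2n≈[x*x]^n (s * Z) n)) ⟨
      κ ^ n * ((s * Z) ^ (2 ℕ.* n) * n!⁻¹)                   ≤⟨ *-monoˡ-≤ (^-nonNeg n 0≤κ) (*-monoʳ-≤ (<⇒≤ (⁻¹-pos (0<n! n))) power≤) ⟩
      κ ^ n * (y ^ z * (fromℕ 4 ^ n * (n!ᴿ * n!ᴿ)) * n!⁻¹)   ≈⟨ solve 5 (λ k y f n i → k :* (y :* (f :* (n :* n)) :* i) := f :* k :* n :* y :* (n :* i)) refl (κ ^ n) (y ^ z) (fromℕ 4 ^ n) n!ᴿ n!⁻¹ ⟩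
      fromℕ 4 ^ n * κ ^ n * n!ᴿ * y ^ z * (n!ᴿ * n!⁻¹)       ≈⟨ *-cong (*-congʳ (*-congʳ (sym (^-distrib-* (fromℕ 4) κ n)))) (inverseʳ (0<n! n)) ⟩
      B ^ n * n!ᴿ * y ^ z * 1#                               ≈⟨ *-identityʳ (B ^ n * n!ᴿ * y ^ z) ⟩
      B ^ n * n!ᴿ * y ^ z                                    ∎
      where
      Z n!ᴿ n!⁻¹ : ℝ
      Z = fromℕ z
      n!ᴿ = fromℕ (n !)
      n!⁻¹ = fromℕ (n !) ⁻¹

      K*Z²≈ : K * (Z * Z) ≈ κ * (s * Z * (s * Z))
      K*Z²≈ = begin-equality
        K * (Z * Z)                            ≈⟨ *-identityʳ (K * (Z * Z)) ⟨
        K * (Z * Z) * 1#                       ≈⟨ *-congˡ (inverseˡ 0<s²) ⟨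
        K * (Z * Z) * ((s * s) ⁻¹ * (s * s))   ≈⟨ solve 4 (λ k z i s → k :* (z :* z) :* (i :* (s :* s)) := k :* i :* (s :* z :* (s :* z))) refl K Z ((s * s) ⁻¹) s ⟩
        κ * (s * Z * (s * Z))                  ∎

      power≤ : (s * Z) ^ (2 ℕ.* n) ≤ y ^ z * (fromℕ 4 ^ n * (n!ᴿ * n!ᴿ))
      power≤ = begin
        (s * Z) ^ (2 ℕ.* n)                                  ≈⟨ *-identityʳ ((s * Z) ^ (2 ℕ.* n)) ⟨
        (s * Z) ^ (2 ℕ.* n) * 1#                             ≈⟨ *-congˡ (inverseˡ (0<n! (2 ℕ.* n))) ⟨
        (s * Z) ^ (2 ℕ.* n) * (fromℕ ((2 ℕ.* n) !) ⁻¹ * fromℕ ((2 ℕ.* n) !)) ≈⟨ *-assoc ((s * Z) ^ (2 ℕ.* n)) (fromℕ ((2 ℕ.* n) !) ⁻¹) (fromℕ ((2 ℕ.* n) !)) ⟨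
        exp[ s * Z x] (2 ℕ.* n) * fromℕ ((2 ℕ.* n) !)        ≤⟨ *-mono-≤ (exp[x]-nonNeg (2 ℕ.* n) 0≤sZ) (fromℕ-nonNeg ((2 ℕ.* n) !)) (exp-term-≤ 0≤sZ (2 ℕ.* n)) ([2n]!≤4^n*n!² n) ⟩
        exp (s * Z) * (fromℕ 4 ^ n * (n!ᴿ * n!ᴿ))            ≈⟨ *-congʳ (trans (exp-cong (*-comm s Z)) (exp-fromℕ* z s)) ⟩
        y ^ z * (fromℕ 4 ^ n * (n!ᴿ * n!ᴿ))                  ∎
        where
        0≤sZ : 0# ≤ s * Z
        0≤sZ = *-nonNeg (<⇒≤ 0<s) (fromℕ-nonNeg z)

    -- As α ≥ 1, the single K dominates every quadratic coefficient of t F_b: α t for the contents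
    -- and the shifts, and b α t / 2 for m².
    module _ {b t : ℝ} (0≤b : 0# ≤ b) (0<t : 0# < t) (8s≤t : fromℕ 8 * s ≤ t)
             (tα²≤K : t * ((1# + b) * (1# + b)) ≤ K) where

      private
        α q : ℝ
        α = 1# + b
        q = qₜ b t

      1≤α : 1# ≤ α
      1≤α = x≤x+y 0≤b

      0≤α : 0# ≤ α
      0≤α = ≤.trans 0≤1 1≤α

      0≤q : 0# ≤ q
      0≤q = <⇒≤ (exp-pos (- (t * ½)))

      αt≤K : α * t ≤ K
      αt≤K = ≤.trans (≤-of-diff (*-nonNeg (*-nonNeg (<⇒≤ 0<t) 0≤α) (0≤diff 1≤α))
        (solve 2 (λ a t → t :* (a :* a) :- a :* t := t :* a :* (a :- con (ℤ.+ 1))) refl α t)) tα²≤K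

      4s≤½t : fromℕ 4 * s ≤ t * ½
      4s≤½t = begin
        fromℕ 4 * s                  ≈⟨ *-identityʳ (fromℕ 4 * s) ⟨
        fromℕ 4 * s * 1#             ≈⟨ *-congˡ (inverseʳ 0<2) ⟨
        fromℕ 4 * s * (fromℕ 2 * ½)  ≈⟨ solve 2 (λ s h → con (ℤ.+ 4) :* s :* (con (ℤ.+ 2) :* h) := con (ℤ.+ 8) :* s :* h) refl s ½ ⟩
        fromℕ 8 * s * ½              ≤⟨ *-monoʳ-≤ (<⇒≤ 0<½) 8s≤t ⟩
        t * ½                        ∎

      -- Here q ≤ x⁴. One factor x cancels y and one is given away; of the two kept, `∑-weights-≤`
      -- spends one on the number of partitions and leaves the other for the geometric series.
      q*y≤x² : q * y ≤ x * x
      q*y≤x² = begin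
        exp (- (t * ½)) * exp s  ≈⟨ exp-+ (- (t * ½)) s ⟨
        exp (- (t * ½) + s)      ≤⟨ exp-mono (≤-of-diff (+-nonNeg (0≤diff 4s≤½t) (<⇒≤ 0<s))
                                      (solve 2 (λ s h → (:- s) :+ (:- s) :- (:- h :+ s) := h :- con (ℤ.+ 4) :* s :+ s) refl s (t * ½))) ⟩
        exp (- s + - s)          ≈⟨ exp-+ (- s) (- s) ⟩
        x * x                    ∎

      -- Since m² ≥ |m| and α ≥ 1, the weight is at most x^(4|m|), which pays for y^|m| and still
      -- leaves geometric decay.
      weight*y^∣m∣≤x^∣m∣ : ∀ m → weight b t m * y ^ ℤ.∣ m ∣ ≤ x ^ ℤ.∣ m ∣
      weight*y^∣m∣≤x^∣m∣ m = begin
        exp (- E) * y ^ ℤ.∣ m ∣        ≈⟨ *-congˡ (exp-fromℕ* ℤ.∣ m ∣ s) ⟨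
        exp (- E) * exp (N * s)        ≈⟨ exp-+ (- E) (N * s) ⟨
        exp (- E + N * s)              ≤⟨ exp-mono (≤-of-diff (+-nonNeg (0≤diff 4sN≤E) (*-nonNeg (*-nonNeg (fromℕ-nonNeg 2) (<⇒≤ 0<s)) (fromℕ-nonNeg ℤ.∣ m ∣)))
                                            (solve 3 (λ e n s → n :* (:- s) :- (:- e :+ n :* s) := e :- con (ℤ.+ 4) :* s :* n :+ con (ℤ.+ 2) :* s :* n) refl E N s)) ⟩
        exp (N * - s)                  ≈⟨ exp-fromℕ* ℤ.∣ m ∣ (- s) ⟩
        x ^ ℤ.∣ m ∣                    ∎
        where
        N E : ℝ
        N = fromℕ ℤ.∣ m ∣
        E = t * ½ * α * fromℤ m ^ 2

        4sN≤E : fromℕ 4 * s * N ≤ E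
        4sN≤E = begin
          fromℕ 4 * s * N        ≤⟨ *-mono-≤ (*-nonNeg (fromℕ-nonNeg 4) (<⇒≤ 0<s)) (fromℕ-nonNeg ℤ.∣ m ∣) 4s≤½t (n≤n² ℤ.∣ m ∣) ⟩
          t * ½ * (N * N)        ≤⟨ *-monoʳ-≤ (square-nonNeg N) (≤.trans (≈⇒≤ (sym (*-identityʳ (t * ½)))) (*-monoˡ-≤ (*-nonNeg (<⇒≤ 0<t) (<⇒≤ 0<½)) 1≤α)) ⟩
          t * ½ * α * (N * N)    ≈⟨ *-congˡ (fromℤ^2≈ m) ⟨
          E                      ∎

      ∑-weights-≤ : ∀ d → ∑∈ (partitions d) (λ p → q ^ sum p * y ^ sum p) ≤ P * x ^ d
      ∑-weights-≤ d = begin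
        ∑∈ (partitions d) (λ p → q ^ sum p * y ^ sum p)  ≤⟨ ∑∈-mono (partitions d) (λ {p} p∈ → ≤.trans
                                                              (≈⇒≤ (reflexive (≡.cong (λ e → q ^ e * y ^ e) (sum-partition {d} p∈)))) q^d*y^d≤) ⟩
        ∑∈ (partitions d) (λ _ → x ^ d * x ^ d)          ≈⟨ ∑∈-*ʳ (partitions d) (x ^ d) (λ _ → x ^ d) ⟩
        ∑∈ (partitions d) (λ _ → x ^ d) * x ^ d          ≤⟨ *-monoʳ-≤ (^-nonNeg d 0≤x) (partitions-≤ 0≤x x<1 d) ⟩
        P * x ^ d                                        ∎
        where
        q^d*y^d≤ : q ^ d * y ^ d ≤ x ^ d * x ^ d
        q^d*y^d≤ = begin
          q ^ d * y ^ d  ≈⟨ ^-distrib-* q y d ⟨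
          (q * y) ^ d    ≤⟨ ^-monoˡ-≤ d (*-nonNeg 0≤q 0≤y) q*y≤x² ⟩
          (x * x) ^ d    ≈⟨ ^-distrib-* x x d ⟩
          x ^ d * x ^ d  ∎

      ∑-weights-below-≤ : ∀ D → ∑∈ (partitionsBelow D) (λ p → q ^ sum p * y ^ sum p) ≤ V
      ∑-weights-below-≤ D = begin
        ∑∈ (partitionsBelow D) (λ p → q ^ sum p * y ^ sum p)            ≈⟨ ∑∈-partitionsBelow D (λ p → q ^ sum p * y ^ sum p) ⟩
        ∑< D (λ d → ∑∈ (partitions d) (λ p → q ^ sum p * y ^ sum p))    ≤⟨ ∑<-mono D (λ d _ → ∑-weights-≤ d) ⟩
        ∑< D (λ d → P * x ^ d)                                          ≤⟨ scaled-geometric-≤ (<⇒≤ 0<P) 0≤x x<1 D ⟩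
        V                                                               ∎

      module _ {N : ℕ} {u : ℝ} (∣u∣≤ : ∣ u ∣ ≤ α * t * fromℕ N) where

        -- The shift gives N |p| and the content |p|². They are not rounded up to (N + |p|)²,
        -- because in `∣pairExponent∣≤` two such bounds together with N² have to fit under one
        -- square.
        ∣shiftedExponent∣≤ : ∀ {d p} → p ∈ partitions d →
          ∣ shiftedExponent b u (- t) p ∣ ≤ K * (fromℕ N * fromℕ (sum p) + fromℕ (sum p) * fromℕ (sum p))
        ∣shiftedExponent∣≤ {d} {p} p∈ = begin
          ∣ S * u + - t * 𝖢 α p ∣            ≤⟨ ∣x+y∣≤∣x∣+∣y∣ (S * u) (- t * 𝖢 α p) ⟩
          ∣ S * u ∣ + ∣ - t * 𝖢 α p ∣        ≈⟨ +-cong (trans (∣xy∣≈∣x∣∣y∣ S u) (*-congʳ (0≤x⇒∣x∣≈x 0≤S)))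
                                                       (trans (∣xy∣≈∣x∣∣y∣ (- t) (𝖢 α p)) (*-congʳ (trans (∣-x∣≈∣x∣ t) (0≤x⇒∣x∣≈x (<⇒≤ 0<t))))) ⟩
          S * ∣ u ∣ + t * ∣ 𝖢 α p ∣          ≤⟨ +-mono-≤ (*-monoˡ-≤ 0≤S ∣u∣≤) (*-monoˡ-≤ (<⇒≤ 0<t) (∣𝖢∣≤ 1≤α partition)) ⟩
          S * (α * t * fromℕ N) + t * (α * (S * S)) ≈⟨ solve 4 (λ s a t n → s :* (a :* t :* n) :+ t :* (a :* (s :* s)) := a :* t :* (n :* s :+ s :* s)) refl S α t (fromℕ N) ⟩
          α * t * (fromℕ N * S + S * S)      ≤⟨ *-monoʳ-≤ (+-nonNeg (*-nonNeg (fromℕ-nonNeg N) 0≤S) (square-nonNeg S)) αt≤K ⟩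
          K * (fromℕ N * S + S * S)          ∎
          where
          S : ℝ
          S = fromℕ (sum p)

          0≤S : 0# ≤ S
          0≤S = fromℕ-nonNeg (sum p)

          partition : IsPartition (sum p) p
          partition = ≡.subst (λ e → IsPartition e p) (≡.sym (sum-partition {d} p∈)) (∈-partitions⁻ p∈)

        -- Serves to prove summability: `𝓗-shifted` is a `∑∞`, whose value says nothing about the
        -- truncations until convergence is known.
        ∣𝓗-term∣≤ : ∀ n d → ∣ 𝓗-term b q u (- t) n d ∣ ≤ B ^ n * fromℕ (n !) * y ^ N * P * x ^ d
        ∣𝓗-term∣≤ n d = begin
          ∣ 𝓗-term b q u (- t) n d ∣
            ≈⟨ ∣x∣-cong (𝓗-term≈ b q u (- t) n d) ⟩
          ∣ ∑∈ (partitions d) (λ p → q ^ sum p * exp[ A p x] n) ∣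
            ≤⟨ ∣∑∈∣≤∑∈∣∣ (partitions d) (λ p → q ^ sum p * exp[ A p x] n) ⟩
          ∑∈ (partitions d) (λ p → ∣ q ^ sum p * exp[ A p x] n ∣)
            ≤⟨ ∑∈-mono (partitions d) (λ {p} → bound p) ⟩
          ∑∈ (partitions d) (λ p → F * (q ^ sum p * y ^ sum p))
            ≈⟨ ∑∈-*ˡ (partitions d) F (λ p → q ^ sum p * y ^ sum p) ⟩
          F * ∑∈ (partitions d) (λ p → q ^ sum p * y ^ sum p)
            ≤⟨ *-monoˡ-≤ 0≤F (∑-weights-≤ d) ⟩
          F * (P * x ^ d)
            ≈⟨ *-assoc F P (x ^ d) ⟨
          F * P * x ^ d
            ∎
          where
          A : List ℕ → ℝ
          A = shiftedExponent b u (- t)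

          F : ℝ
          F = B ^ n * fromℕ (n !) * y ^ N

          0≤F : 0# ≤ F
          0≤F = *-nonNeg (*-nonNeg (^-nonNeg n 0≤B) (fromℕ-nonNeg (n !))) (^-nonNeg N 0≤y)

          bound : ∀ p → p ∈ partitions d → ∣ q ^ sum p * exp[ A p x] n ∣ ≤ F * (q ^ sum p * y ^ sum p)
          bound p p∈ = begin
            ∣ q ^ k * exp[ A p x] n ∣                            ≈⟨ trans (∣xy∣≈∣x∣∣y∣ (q ^ k) (exp[ A p x] n)) (*-congʳ (0≤x⇒∣x∣≈x (^-nonNeg k 0≤q))) ⟩
            q ^ k * ∣ exp[ A p x] n ∣                            ≤⟨ *-monoˡ-≤ (^-nonNeg k 0≤q) (∣exp[x]∣≤ (N ℕ.+ k) n (≤.trans (∣shiftedExponent∣≤ {d} {p} p∈) square)) ⟩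
            q ^ k * (B ^ n * fromℕ (n !) * y ^ (N ℕ.+ k))        ≈⟨ *-congˡ (*-congˡ (^-homo-* y N k)) ⟩
            q ^ k * (B ^ n * fromℕ (n !) * (y ^ N * y ^ k))      ≈⟨ solve 4 (λ q g m k → q :* (g :* (m :* k)) := g :* m :* (q :* k)) refl (q ^ k) (B ^ n * fromℕ (n !)) (y ^ N) (y ^ k) ⟩
            F * (q ^ k * y ^ k)                                  ∎
            where
            k : ℕ
            k = sum p

            square : K * (fromℕ N * fromℕ k + fromℕ k * fromℕ k) ≤ K * (fromℕ (N ℕ.+ k) * fromℕ (N ℕ.+ k))
            square = *-monoˡ-≤ 0≤K (≤.trans
              (≤-of-diff (+-nonNeg (square-nonNeg (fromℕ N)) (*-nonNeg (fromℕ-nonNeg N) (fromℕ-nonNeg k)))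
                (solve 2 (λ n k → (n :+ k) :* (n :+ k) :- (n :* k :+ k :* k) := n :* n :+ n :* k) refl (fromℕ N) (fromℕ k)))
              (≈⇒≤ (sym (*-cong (fromℕ-+ N k) (fromℕ-+ N k)))))

        𝓗-partial⟶ : ∀ n → (λ D → 𝓗-partial b q u (- t) D n) ⟶ 𝓗-shifted b q u (- t) n
        𝓗-partial⟶ n = ∑∞-converges (dominated-summable (∣𝓗-term∣≤ n) (scaled-geometric-≤ 0≤C 0≤x x<1))
          where
          0≤C : 0# ≤ B ^ n * fromℕ (n !) * y ^ N * P
          0≤C = *-nonNeg (*-nonNeg (*-nonNeg (^-nonNeg n 0≤B) (fromℕ-nonNeg (n !))) (^-nonNeg N 0≤y)) (<⇒≤ 0<P)

      module _ {N : ℕ} {e u v : ℝ} (∣e∣≤ : ∣ e ∣ ≤ K * (fromℕ N * fromℕ N))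
               (∣u∣≤ : ∣ u ∣ ≤ α * t * fromℕ N) (∣v∣≤ : ∣ v ∣ ≤ α * t * fromℕ N) where

        private
          product : PowerSeries
          product = exp[ e x] ⊛ 𝓗-shifted b q u (- t) ⊛ 𝓗-shifted b q v (- t)

        -- A coefficient of a product involves only finitely many coefficients of the factors, so
        -- the limit in D can be taken in each of them.
        productPartial⟶ : ∀ n → (λ D → productPartial b q e u v (- t) D n) ⟶ product n
        productPartial⟶ n = ⟶-⊛ n
          (λ k → ⟶-⊛ k (λ j → ⟶-const (exp[ e x] j)) (𝓗-partial⟶ {N} {u} ∣u∣≤))
          (𝓗-partial⟶ {N} {v} ∣v∣≤)

        ∣pairExponent∣≤ : ∀ {d d′ μ ν} → μ ∈ partitions d → ν ∈ partitions d′ →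
          ∣ pairExponent b q e u v (- t) μ ν ∣ ≤ K * (fromℕ (N ℕ.+ (sum μ ℕ.+ sum ν)) * fromℕ (N ℕ.+ (sum μ ℕ.+ sum ν)))
        ∣pairExponent∣≤ {d} {d′} {μ} {ν} μ∈ ν∈ = begin
          ∣ e + U + W ∣                ≤⟨ ∣x+y∣≤∣x∣+∣y∣ (e + U) W ⟩
          ∣ e + U ∣ + ∣ W ∣            ≤⟨ +-monoˡ-≤ ∣ W ∣ (∣x+y∣≤∣x∣+∣y∣ e U) ⟩
          ∣ e ∣ + ∣ U ∣ + ∣ W ∣        ≤⟨ +-mono-≤ (+-mono-≤ ∣e∣≤ (∣shiftedExponent∣≤ {N} {u} ∣u∣≤ {d} {μ} μ∈)) (∣shiftedExponent∣≤ {N} {v} ∣v∣≤ {d′} {ν} ν∈) ⟩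
          K * (n * n) + K * (n * i + i * i) + K * (n * j + j * j)
            ≤⟨ ≤-of-diff (*-nonNeg 0≤K (+-nonNeg (+-nonNeg (*-nonNeg 0≤n 0≤i) (*-nonNeg 0≤n 0≤j)) (*-nonNeg (fromℕ-nonNeg 2) (*-nonNeg 0≤i 0≤j))))
                 (solve 4 (λ k n i j → k :* ((n :+ (i :+ j)) :* (n :+ (i :+ j))) :- (k :* (n :* n) :+ k :* (n :* i :+ i :* i) :+ k :* (n :* j :+ j :* j))
                                       := k :* (n :* i :+ n :* j :+ con (ℤ.+ 2) :* (i :* j))) refl K n i j) ⟩
          K * ((n + (i + j)) * (n + (i + j))) ≈⟨ *-congˡ (*-cong total total) ⟨
          K * (fromℕ (N ℕ.+ (sum μ ℕ.+ sum ν)) * fromℕ (N ℕ.+ (sum μ ℕ.+ sum ν))) ∎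
          where
          U W n i j : ℝ
          U = shiftedExponent b u (- t) μ
          W = shiftedExponent b v (- t) ν
          n = fromℕ N
          i = fromℕ (sum μ)
          j = fromℕ (sum ν)

          0≤n : 0# ≤ n
          0≤n = fromℕ-nonNeg N

          0≤i : 0# ≤ i
          0≤i = fromℕ-nonNeg (sum μ)

          0≤j : 0# ≤ j
          0≤j = fromℕ-nonNeg (sum ν)

          total : fromℕ (N ℕ.+ (sum μ ℕ.+ sum ν)) ≈ n + (i + j)
          total = trans (fromℕ-+ N (sum μ ℕ.+ sum ν)) (+-congˡ (fromℕ-+ (sum μ) (sum ν)))

        -- With z = N + |μ| + |ν| in `∣exp[x]∣≤`, the factor y^z splits as y^N y^|μ| y^|ν|, so the
        -- double sum becomes two sums of q^|p| y^|p|, each at most V whatever D is.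
        ∣productPartial∣≤ : ∀ D n → ∣ productPartial b q e u v (- t) D n ∣ ≤ B ^ n * fromℕ (n !) * (V * V) * y ^ N
        ∣productPartial∣≤ D n = begin
          ∣ productPartial b q e u v (- t) D n ∣
            ≈⟨ ∣x∣-cong (productPartial≈ b q e u v (- t) D n) ⟩
          ∣ ∑∈ Λ (λ μ → w μ * inner μ) ∣
            ≤⟨ ∣∑∈∣≤∑∈∣∣ Λ (λ μ → w μ * inner μ) ⟩
          ∑∈ Λ (λ μ → ∣ w μ * inner μ ∣)
            ≤⟨ ∑∈-mono Λ (λ {μ} → outer-≤ μ) ⟩
          ∑∈ Λ (λ μ → w μ * Y μ * (F * V))
            ≈⟨ ∑∈-*ʳ Λ (F * V) (λ μ → w μ * Y μ) ⟩
          ∑∈ Λ (λ μ → w μ * Y μ) * (F * V)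
            ≤⟨ *-monoʳ-≤ (*-nonNeg 0≤F (<⇒≤ 0<V)) (∑-weights-below-≤ D) ⟩
          V * (F * V)
            ≈⟨ solve 3 (λ v g m → v :* (g :* m :* v) := g :* (v :* v) :* m) refl V (B ^ n * fromℕ (n !)) (y ^ N) ⟩
          B ^ n * fromℕ (n !) * (V * V) * y ^ N
            ∎
          where
          Λ : List (List ℕ)
          Λ = partitionsBelow D

          w Y inner : List ℕ → ℝ
          w p = q ^ sum p
          Y p = y ^ sum p
          inner μ = ∑∈ Λ (λ ν → w ν * exp[ pairExponent b q e u v (- t) μ ν x] n)

          F : ℝ
          F = B ^ n * fromℕ (n !) * y ^ N

          0≤F : 0# ≤ F
          0≤F = *-nonNeg (*-nonNeg (^-nonNeg n 0≤B) (fromℕ-nonNeg (n !))) (^-nonNeg N 0≤y)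

          0≤w : ∀ p → 0# ≤ w p
          0≤w p = ^-nonNeg (sum p) 0≤q

          ∣w*∣≈ : ∀ p z → ∣ w p * z ∣ ≈ w p * ∣ z ∣
          ∣w*∣≈ p z = trans (∣xy∣≈∣x∣∣y∣ (w p) z) (*-congʳ (0≤x⇒∣x∣≈x (0≤w p)))

          term-≤ : ∀ μ ν → μ ∈ Λ → ν ∈ Λ → ∣ w ν * exp[ pairExponent b q e u v (- t) μ ν x] n ∣ ≤ F * Y μ * (w ν * Y ν)
          term-≤ μ ν μ∈ ν∈ = begin
            ∣ w ν * exp[ a x] n ∣                                      ≈⟨ ∣w*∣≈ ν (exp[ a x] n) ⟩
            w ν * ∣ exp[ a x] n ∣                                      ≤⟨ *-monoˡ-≤ (0≤w ν) (∣exp[x]∣≤ (N ℕ.+ (sum μ ℕ.+ sum ν)) n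
                                                                            (∣pairExponent∣≤ {proj₁ (below μ∈)} {proj₁ (below ν∈)} (proj₂ (below μ∈)) (proj₂ (below ν∈)))) ⟩
            w ν * (B ^ n * fromℕ (n !) * y ^ (N ℕ.+ (sum μ ℕ.+ sum ν))) ≈⟨ *-congˡ (*-congˡ (trans (^-homo-* y N (sum μ ℕ.+ sum ν)) (*-congˡ (^-homo-* y (sum μ) (sum ν))))) ⟩
            w ν * (B ^ n * fromℕ (n !) * (y ^ N * (Y μ * Y ν)))        ≈⟨ solve 5 (λ w g m i j → w :* (g :* (m :* (i :* j))) := g :* m :* i :* (w :* j)) refl (w ν) (B ^ n * fromℕ (n !)) (y ^ N) (Y μ) (Y ν) ⟩
            F * Y μ * (w ν * Y ν)                                      ∎
            where
            a : ℝ
            a = pairExponent b q e u v (- t) μ ν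

            below : ∀ {p} → p ∈ Λ → ∃[ d ] p ∈ partitions d
            below = partitionsBelow-∈ D

          outer-≤ : ∀ μ → μ ∈ Λ → ∣ w μ * inner μ ∣ ≤ w μ * Y μ * (F * V)
          outer-≤ μ μ∈ = begin
            ∣ w μ * inner μ ∣                        ≈⟨ ∣w*∣≈ μ (inner μ) ⟩
            w μ * ∣ inner μ ∣                        ≤⟨ *-monoˡ-≤ (0≤w μ) (begin
              ∣ inner μ ∣                                   ≤⟨ ∣∑∈∣≤∑∈∣∣ Λ (λ ν → w ν * exp[ pairExponent b q e u v (- t) μ ν x] n) ⟩
              ∑∈ Λ (λ ν → ∣ w ν * exp[ pairExponent b q e u v (- t) μ ν x] n ∣) ≤⟨ ∑∈-mono Λ (λ {ν} → term-≤ μ ν μ∈) ⟩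
              ∑∈ Λ (λ ν → F * Y μ * (w ν * Y ν))            ≈⟨ ∑∈-*ˡ Λ (F * Y μ) (λ ν → w ν * Y ν) ⟩
              F * Y μ * ∑∈ Λ (λ ν → w ν * Y ν)              ≤⟨ *-monoˡ-≤ (*-nonNeg 0≤F (^-nonNeg (sum μ) 0≤y)) (∑-weights-below-≤ D) ⟩
              F * Y μ * V                                   ∎) ⟩
            w μ * (F * Y μ * V)                      ≈⟨ solve 4 (λ w f i v → w :* (f :* i :* v) := w :* i :* (f :* v)) refl (w μ) F (Y μ) V ⟩
            w μ * Y μ * (F * V)                      ∎

        ∣product∣≤ : ∀ n → ∣ product n ∣ ≤ B ^ n * fromℕ (n !) * (V * V) * y ^ N
        ∣product∣≤ n = ⟶-∣∣-upper (productPartial⟶ n) (λ D → ∣productPartial∣≤ D n)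

        product-even-nonNeg : ∀ r → 0# ≤ product (2 ℕ.* r)
        product-even-nonNeg r = ⟶-lower (productPartial⟶ (2 ℕ.* r)) (λ D → productPartial-even-nonNeg b q e u v (- t) 0≤q D r)

        term≤product : ∀ {d d′ μ ν} r → IsPartition d μ → IsPartition d′ ν →
                       q ^ sum μ * (q ^ sum ν * exp[ pairExponent b q e u v (- t) μ ν x] (2 ℕ.* r)) ≤ product (2 ℕ.* r)
        term≤product {d} {d′} r μ⊢d ν⊢d′ = ⟶-lower
          -- From the truncation d + d′ + 1 on, both partitions are always present.
          (⟶-subsequence (λ D → D ℕ.+ suc (d ℕ.+ d′)) (λ D → ℕ.m≤m+n D (suc (d ℕ.+ d′))) (productPartial⟶ (2 ℕ.* r)))
          (λ D → term≤productPartial b q e u v (- t) 0≤q {D ℕ.+ suc (d ℕ.+ d′)} r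
            (partition∈partitionsBelow (ℕ.≤-trans (ℕ.s≤s (ℕ.m≤m+n d d′)) (ℕ.m≤n+m (suc (d ℕ.+ d′)) D)) μ⊢d)
            (partition∈partitionsBelow (ℕ.≤-trans (ℕ.s≤s (ℕ.m≤n+m d′ d)) (ℕ.m≤n+m (suc (d ℕ.+ d′)) D)) ν⊢d′))

  -- The sum over m and the two estimates for the coefficients.

  n!≤n^n : ∀ n → fromℕ (n !) ≤ fromℕ n ^ n
  n!≤n^n n = go ℕ.≤-refl
    where
    go : ∀ {k} → k ℕ.≤ n → fromℕ (k !) ≤ fromℕ n ^ k
    go {zero}  _   = ≈⇒≤ fromℕ-1
    go {suc k} k<n = ≤.trans (≈⇒≤ (fromℕ-* (suc k) (k !)))
      (*-mono-≤ (fromℕ-nonNeg (suc k)) (fromℕ-nonNeg (k !)) (fromℕ-mono-≤ k<n) (go (ℕ.<⇒≤ k<n)))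

  module _ {x C : ℝ} (0≤x : 0# ≤ x) (x<1 : x < 1#) (0≤C : 0# ≤ C)
           {f : ℤ → ℝ} (∣f∣≤ : ∀ m → ∣ f m ∣ ≤ C * x ^ ℤ.∣ m ∣) where

    private
      Q : ℝ
      Q = (1# - x) ⁻¹

      positive-≤ : ∀ n → ∣ f (ℤ.+ n) ∣ ≤ C * x ^ n
      positive-≤ n = ∣f∣≤ (ℤ.+ n)

      negative-≤ : ∀ n → ∣ f -[1+ n ] ∣ ≤ C * x ^ n
      -- The n-th negative index has absolute value n + 1; dropping one factor x gives both halves
      -- the same geometric bound.
      negative-≤ n = ≤.trans (∣f∣≤ -[1+ n ]) (*-monoˡ-≤ 0≤C (^-antitoneʳ-≤ 0≤x (<⇒≤ x<1) (ℕ.n≤1+n n)))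

      geometric : ∀ n → ∑< n (λ k → C * x ^ k) ≤ C * Q
      geometric = scaled-geometric-≤ 0≤C 0≤x x<1

    ∣∑ℤ∣≤ : ∣ ∑ℤ f ∣ ≤ C * Q + C * Q
    ∣∑ℤ∣≤ = ≤.trans (∣x+y∣≤∣x∣+∣y∣ (∑∞ (λ n → f (ℤ.+ n))) (∑∞ (λ n → f -[1+ n ])))
      (+-mono-≤ (dominated-∣∑∞∣≤ positive-≤ geometric) (dominated-∣∑∞∣≤ negative-≤ geometric))

    zeroth≤∑ℤ : (∀ m → 0# ≤ f m) → f (ℤ.+ 0) ≤ ∑ℤ f
    zeroth≤∑ℤ 0≤f = ≤.trans
      (term≤∑∞ (λ n → 0≤f (ℤ.+ n)) (dominated-summable positive-≤ geometric) 0)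
      -- The partial sum of length 0 is `0#`, so this is the nonnegativity of the negative half.
      (x≤x+y (partial≤∑∞ (λ n → 0≤f -[1+ n ]) (dominated-summable negative-≤ geometric) 0))

  module Estimates {s K : ℝ} (0<s : 0# < s) (0≤K : 0# ≤ K) {b t : ℝ} (0≤b : 0# ≤ b) (0<t : 0# < t)
                   (8s≤t : fromℕ 8 * s ≤ t) (tα²≤K : t * ((1# + b) * (1# + b)) ≤ K) where

    open Bounds {s} {K} 0<s 0≤K

    private
      α q : ℝ
      α = 1# + b
      q = qₜ b t

      e u v : ℤ → ℝ
      e m = ½ * b * α * t * fromℤ m ^ 2
      u m = - (α * t * fromℤ m)
      v m = α * t * fromℤ m

      g : ℤ → PowerSeries
      g m = exp[ e m x] ⊛ 𝓗-shifted b q (u m) (- t) ⊛ 𝓗-shifted b q (v m) (- t)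

      0≤α′ : 0# ≤ α
      0≤α′ = 0≤α 0≤b 0<t 8s≤t tα²≤K

      0≤αt : 0# ≤ α * t
      0≤αt = *-nonNeg 0≤α′ (<⇒≤ 0<t)

      ∣v∣≤ : ∀ m → ∣ v m ∣ ≤ α * t * fromℕ ℤ.∣ m ∣
      ∣v∣≤ m = ≈⇒≤ (trans (∣xy∣≈∣x∣∣y∣ (α * t) (fromℤ m)) (*-cong (0≤x⇒∣x∣≈x 0≤αt) (∣fromℤ∣ m)))

      ∣u∣≤ : ∀ m → ∣ u m ∣ ≤ α * t * fromℕ ℤ.∣ m ∣
      ∣u∣≤ m = ≤.trans (≈⇒≤ (∣-x∣≈∣x∣ (v m))) (∣v∣≤ m)

      ∣e∣≤ : ∀ m → ∣ e m ∣ ≤ K * (fromℕ ℤ.∣ m ∣ * fromℕ ℤ.∣ m ∣)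
      ∣e∣≤ m = begin
        ∣ e m ∣                          ≈⟨ ∣x∣-cong (*-congˡ (fromℤ^2≈ m)) ⟩
        ∣ ½ * b * α * t * (N * N) ∣      ≈⟨ 0≤x⇒∣x∣≈x (*-nonNeg (*-nonNeg (*-nonNeg 0≤½b 0≤α′) (<⇒≤ 0<t)) (square-nonNeg N)) ⟩
        ½ * b * α * t * (N * N)          ≤⟨ *-monoʳ-≤ (square-nonNeg N) (*-monoʳ-≤ (<⇒≤ 0<t) (*-monoʳ-≤ 0≤α′ ½b≤α)) ⟩
        α * α * t * (N * N)              ≈⟨ *-congʳ (*-comm (α * α) t) ⟩
        t * (α * α) * (N * N)            ≤⟨ *-monoʳ-≤ (square-nonNeg N) tα²≤K ⟩
        K * (N * N)                      ∎
        where
        N : ℝ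
        N = fromℕ ℤ.∣ m ∣

        0≤½b : 0# ≤ ½ * b
        0≤½b = *-nonNeg (<⇒≤ 0<½) 0≤b

        ½b≤α : ½ * b ≤ α
        ½b≤α = ≤.trans (*-monoʳ-≤ 0≤b (<⇒≤ ½<1)) (≤.trans (≈⇒≤ (*-identityˡ b)) (x≤y+x 0≤1))

      ∣g∣≤ : ∀ m n → ∣ g m n ∣ ≤ B ^ n * fromℕ (n !) * (V * V) * y ^ ℤ.∣ m ∣
      ∣g∣≤ m = ∣product∣≤ 0≤b 0<t 8s≤t tα²≤K {ℤ.∣ m ∣} {e m} {u m} {v m} (∣e∣≤ m) (∣u∣≤ m) (∣v∣≤ m)

      g-even-nonNeg : ∀ m r → 0# ≤ g m (2 ℕ.* r)
      g-even-nonNeg m = product-even-nonNeg 0≤b 0<t 8s≤t tα²≤K {ℤ.∣ m ∣} {e m} {u m} {v m} (∣e∣≤ m) (∣u∣≤ m) (∣v∣≤ m)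

      0<weight : ∀ m → 0# < weight b t m
      0<weight m = exp-pos (- (t * ½ * α * fromℤ m ^ 2))

      weight-≤ : ∀ m → ∣ weight b t m ∣ ≤ 1# * x ^ ℤ.∣ m ∣
      weight-≤ m = begin
        ∣ weight b t m ∣                ≈⟨ 0≤x⇒∣x∣≈x (<⇒≤ (0<weight m)) ⟩
        weight b t m                    ≈⟨ *-identityʳ (weight b t m) ⟨
        weight b t m * 1#               ≤⟨ *-monoˡ-≤ (<⇒≤ (0<weight m)) (1≤x^n ℤ.∣ m ∣ (1≤exp (<⇒≤ 0<s))) ⟩
        weight b t m * y ^ ℤ.∣ m ∣      ≤⟨ weight*y^∣m∣≤x^∣m∣ 0≤b 0<t 8s≤t tα²≤K m ⟩
        x ^ ℤ.∣ m ∣                     ≈⟨ *-identityˡ (x ^ ℤ.∣ m ∣) ⟨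
        1# * x ^ ℤ.∣ m ∣                ∎

      -- The term m = 0 bounds Θ from below once the series is known to converge. Positivity is what
      -- allows Θ to cancel against its inverse in both estimates.
      0<Θ : 0# < Θ b t
      0<Θ = begin-strict
        0#                      <⟨ 0<weight (ℤ.+ 0) ⟩
        weight b t (ℤ.+ 0)      ≤⟨ zeroth≤∑ℤ 0≤x x<1 0≤1 {weight b t} weight-≤ (λ m → <⇒≤ (0<weight m)) ⟩
        Θ b t                   ∎

      0<Θ⁻¹ : 0# < Θ b t ⁻¹
      0<Θ⁻¹ = ⁻¹-pos 0<Θ

      G : ℕ → ℝ
      G n = B ^ n * fromℕ (n !) * (V * V)

      0≤G : ∀ n → 0# ≤ G n
      0≤G n = *-nonNeg (*-nonNeg (^-nonNeg n 0≤B) (fromℕ-nonNeg (n !))) (square-nonNeg V)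

      summand : ℕ → ℤ → ℝ
      summand n m = weight b t m * Θ b t ⁻¹ * g m n

      0≤ℙ : ∀ m → 0# ≤ weight b t m * Θ b t ⁻¹
      0≤ℙ m = *-nonNeg (<⇒≤ (0<weight m)) (<⇒≤ 0<Θ⁻¹)

      ∣summand∣≤ : ∀ n m → ∣ summand n m ∣ ≤ Θ b t ⁻¹ * G n * x ^ ℤ.∣ m ∣
      ∣summand∣≤ n m = begin
        ∣ summand n m ∣                                      ≈⟨ trans (∣xy∣≈∣x∣∣y∣ (weight b t m * Θ b t ⁻¹) (g m n)) (*-congʳ (0≤x⇒∣x∣≈x (0≤ℙ m))) ⟩
        weight b t m * Θ b t ⁻¹ * ∣ g m n ∣                  ≤⟨ *-monoˡ-≤ (0≤ℙ m) (∣g∣≤ m n) ⟩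
        weight b t m * Θ b t ⁻¹ * (G n * y ^ ℤ.∣ m ∣)        ≈⟨ solve 4 (λ w i g z → w :* i :* (g :* z) := i :* g :* (w :* z)) refl (weight b t m) (Θ b t ⁻¹) (G n) (y ^ ℤ.∣ m ∣) ⟩
        Θ b t ⁻¹ * G n * (weight b t m * y ^ ℤ.∣ m ∣)        ≤⟨ *-monoˡ-≤ (*-nonNeg (<⇒≤ 0<Θ⁻¹) (0≤G n)) (weight*y^∣m∣≤x^∣m∣ 0≤b 0<t 8s≤t tα²≤K m) ⟩
        Θ b t ⁻¹ * G n * x ^ ℤ.∣ m ∣                         ∎

    -- The prefactor Θ cancels the normalisation of `ℙ[M≡_]`, so the constants depend on s and K
    -- alone, as uniformity in (t, b) requires. The sum Q + Q comes from the two halves of `∑ℤ`.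
    upper : ∀ n → ∣ 𝓩 b t n ∣ ≤ V * V * (Q + Q) * B ^ n * fromℕ (n !)
    upper n = begin
      ∣ Θ b t * ∑ℤ (summand n) ∣                  ≈⟨ trans (∣xy∣≈∣x∣∣y∣ (Θ b t) (∑ℤ (summand n))) (*-congʳ (0≤x⇒∣x∣≈x (<⇒≤ 0<Θ))) ⟩
      Θ b t * ∣ ∑ℤ (summand n) ∣                  ≤⟨ *-monoˡ-≤ (<⇒≤ 0<Θ) (∣∑ℤ∣≤ 0≤x x<1 (*-nonNeg (<⇒≤ 0<Θ⁻¹) (0≤G n)) {summand n} (∣summand∣≤ n)) ⟩
      Θ b t * (Θ b t ⁻¹ * G n * Q + Θ b t ⁻¹ * G n * Q)
        ≈⟨ solve 4 (λ h i g q → h :* (i :* g :* q :+ i :* g :* q) := h :* i :* (g :* (q :+ q))) refl (Θ b t) (Θ b t ⁻¹) (G n) Q ⟩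
      Θ b t * Θ b t ⁻¹ * (G n * (Q + Q))          ≈⟨ trans (*-congʳ (inverseʳ 0<Θ)) (*-identityˡ (G n * (Q + Q))) ⟩
      G n * (Q + Q)                               ≈⟨ solve 4 (λ p f v q → p :* f :* v :* q := v :* q :* p :* f) refl (B ^ n) (fromℕ (n !)) (V * V) (Q + Q) ⟩
      V * V * (Q + Q) * B ^ n * fromℕ (n !)       ∎

    module _ {T : ℝ} (t≤T : t ≤ T) where

      private
        -- To be uniform, c may involve T but not t, so q is replaced by its lower bound p =
        -- e^(-T/2). Two factors p per degree suffice because q^(n+1) ≥ p^(2n) for n ≥ 1, and 4s is
        -- the constant in `rowContent≥`.
        p c : ℝ
        p = exp (- (T * ½))
        c = p * p * (fromℕ 4 * s)

        0≤p : 0# ≤ p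
        0≤p = <⇒≤ (exp-pos (- (T * ½)))

        p≤1 : p ≤ 1#
        p≤1 = ≤.trans (exp-mono (neg-nonPos (*-nonNeg (≤.trans (<⇒≤ 0<t) t≤T) (<⇒≤ 0<½)))) (≈⇒≤ exp-0)

        p≤q : p ≤ q
        p≤q = exp-mono (neg-mono-≤ (*-monoʳ-≤ (<⇒≤ 0<½) t≤T))

        0≤4s : 0# ≤ fromℕ 4 * s
        0≤4s = *-nonNeg (fromℕ-nonNeg 4) (<⇒≤ 0<s)

      rowContent≥ : ∀ n → fromℕ 4 * s * (fromℕ n * fromℕ n) ≤ t * 𝖢 α (suc n ∷ [])
      rowContent≥ n = begin
        fromℕ 4 * s * (fromℕ n * fromℕ n)           ≤⟨ *-mono-≤ 0≤4s (square-nonNeg (fromℕ n)) (4s≤½t 0≤b 0<t 8s≤t tα²≤K) (𝖢-row (1≤α 0≤b 0<t 8s≤t tα²≤K) n) ⟩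
        t * ½ * (fromℕ 2 * C)                       ≈⟨ solve 3 (λ t h c → t :* h :* (con (ℤ.+ 2) :* c) := con (ℤ.+ 2) :* h :* (t :* c)) refl t ½ C ⟩
        fromℕ 2 * ½ * (t * C)                       ≈⟨ trans (*-congʳ (inverseʳ 0<2)) (*-identityˡ (t * C)) ⟩
        t * C                                       ∎
        where
        C : ℝ
        C = 𝖢 α (suc n ∷ [])

      -- For n = 2r the chosen term is at least p^(2n) (4 s n²)^n / n!, and applying n^n ≥ n! twice
      -- leaves p^(2n) (4s)^n n!. The hypothesis r ≥ 1 gives n + 1 ≤ 2n.
      lower : ∀ r → 1 ℕ.≤ r → c ^ (2 ℕ.* r) * fromℕ ((2 ℕ.* r) !) ≤ 𝓩 b t (2 ℕ.* r)
      lower r 1≤r = begin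
        c ^ n * n!ᴿ                                             ≈⟨ *-identityʳ (c ^ n * n!ᴿ) ⟨
        c ^ n * n!ᴿ * 1#                                        ≈⟨ *-cong (*-congʳ (trans (^-distrib-* (p * p) (fromℕ 4 * s) n) (*-congʳ (^-distrib-* p p n)))) (sym (inverseʳ (0<n! n))) ⟩
        p ^ n * p ^ n * (fromℕ 4 * s) ^ n * n!ᴿ * (n!ᴿ * n!⁻¹)  ≈⟨ solve 4 (λ p z f i → p :* p :* z :* f :* (f :* i) := p :* p :* (z :* (f :* f) :* i)) refl (p ^ n) ((fromℕ 4 * s) ^ n) n!ᴿ n!⁻¹ ⟩
        p ^ n * p ^ n * ((fromℕ 4 * s) ^ n * (n!ᴿ * n!ᴿ) * n!⁻¹) ≤⟨ *-mono-≤ (*-nonNeg (^-nonNeg n 0≤p) (^-nonNeg n 0≤p))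
                                                                      (*-nonNeg (*-nonNeg (^-nonNeg n 0≤4s) (square-nonNeg n!ᴿ)) 0≤n!⁻¹)
                                                                      p^n*p^n≤ (*-monoʳ-≤ 0≤n!⁻¹ power≤) ⟩
        q ^ suc n * ((t * C) ^ n * n!⁻¹)                        ≈⟨ *-cong (reflexive (≡.cong (q ^_) (≡.sym (ℕ.+-identityʳ (suc n)))))
                                                                      (trans (*-congʳ even-power) (sym (*-identityˡ (exp[ a x] n)))) ⟩
        q ^ sum row * (q ^ 0 * exp[ a x] n)                     ≤⟨ term≤product 0≤b 0<t 8s≤t tα²≤K {0} {e 0ℤ} {u 0ℤ} {v 0ℤ} (∣e∣≤ 0ℤ) (∣u∣≤ 0ℤ) (∣v∣≤ 0ℤ) r row⊢ []⊢ ⟩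
        g 0ℤ n                                                  ≈⟨ trans (*-congʳ weight-0≈1) (*-identityˡ (g 0ℤ n)) ⟨
        weight b t 0ℤ * g 0ℤ n                                  ≈⟨ trans (*-congʳ (inverseʳ 0<Θ)) (*-identityˡ (weight b t 0ℤ * g 0ℤ n)) ⟨
        Θ b t * Θ b t ⁻¹ * (weight b t 0ℤ * g 0ℤ n)             ≈⟨ solve 4 (λ h i w g → h :* i :* (w :* g) := h :* (w :* i :* g)) refl (Θ b t) (Θ b t ⁻¹) (weight b t 0ℤ) (g 0ℤ n) ⟩
        Θ b t * summand n 0ℤ                                    ≤⟨ *-monoˡ-≤ (<⇒≤ 0<Θ) (zeroth≤∑ℤ 0≤x x<1 (*-nonNeg (<⇒≤ 0<Θ⁻¹) (0≤G n)) {summand n} (∣summand∣≤ n)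
                                                                      (λ m → *-nonNeg (0≤ℙ m) (g-even-nonNeg m r))) ⟩
        Θ b t * ∑ℤ (summand n)                                  ∎
        where
        n : ℕ
        n = 2 ℕ.* r

        0ℤ : ℤ
        0ℤ = ℤ.+ 0

        -- One box more than n, since by `𝖢-row` a row of n + 1 boxes has content at least n²/2.
        row : List ℕ
        row = suc n ∷ []

        n!ᴿ n!⁻¹ C a : ℝ
        n!ᴿ = fromℕ (n !)
        n!⁻¹ = fromℕ (n !) ⁻¹
        C = 𝖢 α row
        a = pairExponent b q (e 0ℤ) (u 0ℤ) (v 0ℤ) (- t) row []

        0≤n!⁻¹ : 0# ≤ n!⁻¹
        0≤n!⁻¹ = <⇒≤ (⁻¹-pos (0<n! n))

        row⊢ : IsPartition (sum row) row
        row⊢ = isPartition [-] (ℕ.s≤s ℕ.z≤n ∷ []) ≡.refl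

        []⊢ : IsPartition 0 []
        []⊢ = isPartition [] [] ≡.refl

        -- At m = 0 the Gaussian term and both shifts vanish, and ν is empty. The remaining sign
        -- disappears because n is even.
        a≈ : a ≈ - (t * C)
        a≈ = solve 6 (λ h b α t S C →
            h :* b :* α :* t :* (con (ℤ.+ 0) :^ 2) :+ (S :* (:- (α :* t :* con (ℤ.+ 0))) :+ (:- t) :* C) :+ (con (ℤ.+ 0) :* (α :* t :* con (ℤ.+ 0)) :+ (:- t) :* con (ℤ.+ 0))
            := :- (t :* C))
          refl ½ b α t (fromℕ (sum row)) C

        even-power : (t * C) ^ n ≈ a ^ n
        even-power = begin-equality
          (t * C) ^ n                  ≈⟨ ^2n≈[x*x]^n (t * C) r ⟩
          (t * C * (t * C)) ^ r        ≈⟨ ^-congˡ r (solve 1 (λ z → z :* z := (:- z) :* (:- z)) refl (t * C)) ⟩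
          (- (t * C) * - (t * C)) ^ r  ≈⟨ ^2n≈[x*x]^n (- (t * C)) r ⟨
          (- (t * C)) ^ n              ≈⟨ ^-congˡ n a≈ ⟨
          a ^ n                        ∎

        power≤ : (fromℕ 4 * s) ^ n * (n!ᴿ * n!ᴿ) ≤ (t * C) ^ n
        power≤ = begin
          (fromℕ 4 * s) ^ n * (n!ᴿ * n!ᴿ)                 ≤⟨ *-monoˡ-≤ (^-nonNeg n 0≤4s) (*-mono-≤ (fromℕ-nonNeg (n !)) (fromℕ-nonNeg (n !)) (n!≤n^n n) (n!≤n^n n)) ⟩
          (fromℕ 4 * s) ^ n * (fromℕ n ^ n * fromℕ n ^ n) ≈⟨ trans (^-distrib-* (fromℕ 4 * s) (fromℕ n * fromℕ n) n) (*-congˡ (^-distrib-* (fromℕ n) (fromℕ n) n)) ⟨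
          (fromℕ 4 * s * (fromℕ n * fromℕ n)) ^ n         ≤⟨ ^-monoˡ-≤ n (*-nonNeg 0≤4s (square-nonNeg (fromℕ n))) (rowContent≥ n) ⟩
          (t * C) ^ n                                     ∎

        p^n*p^n≤ : p ^ n * p ^ n ≤ q ^ suc n
        p^n*p^n≤ = begin
          p ^ n * p ^ n      ≈⟨ ^-homo-* p n n ⟨
          p ^ (n ℕ.+ n)      ≤⟨ ^-antitoneʳ-≤ 0≤p p≤1 (ℕ.+-monoˡ-≤ n (ℕ.≤-trans 1≤r (ℕ.m≤m+n r (r ℕ.+ 0)))) ⟩
          p ^ suc n          ≤⟨ ^-monoˡ-≤ (suc n) 0≤p p≤q ⟩
          q ^ suc n          ∎

        weight-0≈1 : weight b t 0ℤ ≈ 1#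
        weight-0≈1 = trans (exp-cong (solve 1 (λ z → :- (z :* con (ℤ.+ 0) :^ 2) := con (ℤ.+ 0)) refl (t * ½ * α))) exp-0

  -- Compact sets are contained in boxes.

  ⁻¹-antitone-≤ : ∀ {x y} → 0# < x → x ≤ y → y ⁻¹ ≤ x ⁻¹
  ⁻¹-antitone-≤ {x} {y} 0<x x≤y = *-cancelˡ-≤ 0<x (begin
    x * y ⁻¹  ≤⟨ *-monoʳ-≤ (<⇒≤ (⁻¹-pos 0<y)) x≤y ⟩
    y * y ⁻¹  ≈⟨ inverseʳ 0<y ⟩
    1#        ≈⟨ inverseʳ 0<x ⟨
    x * x ⁻¹  ∎)
    where
    0<y : 0# < y
    0<y = begin-strict
      0#  <⟨ 0<x ⟩
      x   ≤⟨ x≤y ⟩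
      y   ∎

  archimedean-< : ∀ x → ∃[ n ] x < fromℕ (suc n)
  archimedean-< x = proj₁ (archimedean x) , (begin-strict
    x                                   ≤⟨ proj₂ (archimedean x) ⟩
    fromℕ (proj₁ (archimedean x))       <⟨ x<x+y 0<1 ⟩
    fromℕ (proj₁ (archimedean x)) + 1#  ≈⟨ +-comm (fromℕ (proj₁ (archimedean x))) 1# ⟩
    fromℕ (suc (proj₁ (archimedean x))) ∎)

  archimedean-⁻¹ : ∀ {x} → 0# < x → ∃[ n ] fromℕ (suc n) ⁻¹ < x
  archimedean-⁻¹ {x} 0<x = below (archimedean-< (x ⁻¹))
    where
    below : ∃[ n ] x ⁻¹ < fromℕ (suc n) → ∃[ n ] fromℕ (suc n) ⁻¹ < x
    below (n , x⁻¹<n) = n , ≰⇒> λ x≤n⁻¹ → <⇒≱ x⁻¹<n (*-cancelˡ-≤ 0<x (begin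
      x * fromℕ (suc n)                ≤⟨ *-monoʳ-≤ (fromℕ-nonNeg (suc n)) x≤n⁻¹ ⟩
      fromℕ (suc n) ⁻¹ * fromℕ (suc n) ≈⟨ inverseˡ (fromℕ-pos {suc n} (ℕ.s≤s ℕ.z≤n)) ⟩
      1#                               ≈⟨ inverseʳ 0<x ⟨
      x * x ⁻¹                         ∎))

  right-open : ∀ {x x′ a} → ∣ x′ - x ∣ < x - a → a < x′
  right-open {x} {x′} {a} close = ≰⇒> λ x′≤a → <⇒≱ (∣x-y∣<ε⇒y<x+ε close) (begin
    x′ + (x - a)  ≤⟨ +-monoˡ-≤ (x - a) x′≤a ⟩
    a + (x - a)   ≈⟨ x+[y-x]≈y a x ⟩
    x             ∎)

  left-open : ∀ {x x′ a} → ∣ x′ - x ∣ < a - x → x′ < a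
  left-open {x} {x′} {a} close = begin-strict
    x′           <⟨ ∣x-y∣<ε⇒x<y+ε close ⟩
    x + (a - x)  ≈⟨ x+[y-x]≈y x a ⟩
    a            ∎

  -- A finite subcover is a list of indices. Their sum is at least each of them, so by nestedness
  -- the set with that index already covers K.
  nested-cover : ∀ {K} → IsCompact K → (U : ℕ → Pred (ℝ × ℝ) 0ℓ) → (∀ n → IsOpen (U n)) →
                 (∀ {m n} → m ℕ.≤ n → ∀ {p} → U m p → U n p) → (∀ p → K p → ∃[ n ] U n p) →
                 ∃[ n ] ∀ p → K p → U n p
  nested-cover {K} compact U open′ nested cover = finite (compact ℕ U open′ cover)
    where
    any⇒sum : ∀ {p ns} → Any (λ n → U n p) ns → U (sum ns) p
    any⇒sum {ns = n ∷ ns} (here  Unp) = nested (ℕ.m≤m+n n (sum ns)) Unp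
    any⇒sum {ns = n ∷ ns} (there any) = nested (ℕ.m≤n+m (sum ns) n) (any⇒sum any)

    finite : ∃[ ns ] (∀ p → K p → Any (λ n → U n p) ns) → ∃[ n ] ∀ p → K p → U n p
    finite (ns , covers) = sum ns , λ p Kp → any⇒sum (covers p Kp)

  -- Three nested open covers, by t > 1/(n + 1), by t < n + 1 and by b < n + 1. The first covers K
  -- because t > 0 on it, and keeps K away from t = 0.
  compact⇒box : ∀ {K} → IsCompact K → (∀ t b → K (t , b) → 0# < t × 0# ≤ b) →
                ∃[ t₀ ] ∃[ T ] ∃[ b₁ ] 0# < t₀ × 0# < T × 0# ≤ b₁ × (∀ t b → K (t , b) → t₀ ≤ t × t ≤ T × b ≤ b₁)
  compact⇒box {K} compact inside = box
    (nested-cover compact (λ n p → fromℕ (suc n) ⁻¹ < proj₁ p)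
      (λ n x y lt → x - fromℕ (suc n) ⁻¹ , 0<diff lt , λ x′ y′ close _ → right-open close)
      (λ {m} {n} m≤n {p} lt → begin-strict
        fromℕ (suc n) ⁻¹ ≤⟨ ⁻¹-antitone-≤ (fromℕ-pos {suc m} (ℕ.s≤s ℕ.z≤n)) (fromℕ-mono-≤ (ℕ.s≤s m≤n)) ⟩
        fromℕ (suc m) ⁻¹ <⟨ lt ⟩
        proj₁ p          ∎)
      (λ p Kp → archimedean-⁻¹ (proj₁ (inside (proj₁ p) (proj₂ p) Kp))))
    (nested-cover compact (λ n p → proj₁ p < fromℕ (suc n))
      (λ n x y lt → fromℕ (suc n) - x , 0<diff lt , λ x′ y′ close _ → left-open close)
      (λ m≤n lt → enlarge m≤n lt)
      (λ p _ → archimedean-< (proj₁ p)))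
    (nested-cover compact (λ n p → proj₂ p < fromℕ (suc n))
      (λ n x y lt → fromℕ (suc n) - y , 0<diff lt , λ x′ y′ _ close → left-open close)
      (λ m≤n lt → enlarge m≤n lt)
      (λ p _ → archimedean-< (proj₂ p)))
    where
    enlarge : ∀ {m n z} → m ℕ.≤ n → z < fromℕ (suc m) → z < fromℕ (suc n)
    enlarge {m} {n} {z} m≤n lt = begin-strict
      z              <⟨ lt ⟩
      fromℕ (suc m)  ≤⟨ fromℕ-mono-≤ (ℕ.s≤s m≤n) ⟩
      fromℕ (suc n)  ∎

    box : ∃[ i ] (∀ p → K p → fromℕ (suc i) ⁻¹ < proj₁ p) →
          ∃[ j ] (∀ p → K p → proj₁ p < fromℕ (suc j)) →
          ∃[ k ] (∀ p → K p → proj₂ p < fromℕ (suc k)) →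
          ∃[ t₀ ] ∃[ T ] ∃[ b₁ ] 0# < t₀ × 0# < T × 0# ≤ b₁ × (∀ t b → K (t , b) → t₀ ≤ t × t ≤ T × b ≤ b₁)
    box (i , t>) (j , t<) (k , b<) =
      fromℕ (suc i) ⁻¹ , fromℕ (suc j) , fromℕ (suc k) ,
      ⁻¹-pos (fromℕ-pos {suc i} (ℕ.s≤s ℕ.z≤n)) , fromℕ-pos {suc j} (ℕ.s≤s ℕ.z≤n) , fromℕ-nonNeg (suc k) ,
      λ t b Ktb → <⇒≤ (t> (t , b) Ktb) , <⇒≤ (t< (t , b) Ktb) , <⇒≤ (b< (t , b) Ktb)

  -- Uniform constants and the conclusion.

  UniformBounds : (A B c : ℝ) (r₀ : ℕ) (t b : ℝ) → Set
  UniformBounds A B c r₀ t b =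
    (∀ m → ∣ 𝓩 b t m ∣ ≤ A * B ^ m * fromℕ (m !)) ×
    (∀ r → r₀ ℕ.≤ r → c ^ (2 ℕ.* r) * fromℕ ((2 ℕ.* r) !) ≤ 𝓩 b t (2 ℕ.* r))

  -- Each constant is read off at the worst corner of the box: s = t₀/8 gives 8s ≤ t throughout, K
  -- takes the largest t and b, and p the largest t. The threshold 1 is the one of `lower`.
  box-bounds : ∀ {t₀ T b₁} → 0# < t₀ → 0# < T → 0# ≤ b₁ →
               ∃[ A ] ∃[ B ] ∃[ c ] ∃[ r₀ ] 0# < A × 0# < B × 0# < c ×
                 (∀ t b → 0# ≤ b → t₀ ≤ t → t ≤ T → b ≤ b₁ → UniformBounds A B c r₀ t b)
  box-bounds {t₀} {T} {b₁} 0<t₀ 0<T 0≤b₁ =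
    V * V * (Q + Q) , B , p * p * (fromℕ 4 * s) , 1 ,
    *-pos (*-pos 0<V 0<V) (+-pos 0<Q (<⇒≤ 0<Q)) ,
    *-pos 0<4 (*-pos 0<K (⁻¹-pos 0<s²)) ,
    *-pos (*-pos 0<p 0<p) (*-pos 0<4 0<s) ,
    λ t b 0≤b t₀≤t t≤T b≤b₁ →
      let open Estimates 0<s (<⇒≤ 0<K) 0≤b (0<t t₀≤t) (≤.trans (≈⇒≤ 8s≈t₀) t₀≤t) (tα²≤K 0≤b t≤T b≤b₁)
      in upper , lower t≤T
    where
    s K p : ℝ
    s = t₀ * fromℕ 8 ⁻¹
    K = T * ((1# + b₁) * (1# + b₁))
    p = exp (- (T * ½))

    0<4 : 0# < fromℕ 4
    0<4 = fromℕ-pos {4} (ℕ.s≤s ℕ.z≤n)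

    0<8 : 0# < fromℕ 8
    0<8 = fromℕ-pos {8} (ℕ.s≤s ℕ.z≤n)

    0<s : 0# < s
    0<s = *-pos 0<t₀ (⁻¹-pos 0<8)

    0<p : 0# < p
    0<p = exp-pos (- (T * ½))

    0<1+b₁ : 0# < 1# + b₁
    0<1+b₁ = +-pos 0<1 0≤b₁

    0<K : 0# < K
    0<K = *-pos 0<T (*-pos 0<1+b₁ 0<1+b₁)

    8s≈t₀ : fromℕ 8 * s ≈ t₀
    8s≈t₀ = begin-equality
      fromℕ 8 * (t₀ * fromℕ 8 ⁻¹)  ≈⟨ solve 3 (λ e t i → e :* (t :* i) := t :* (e :* i)) refl (fromℕ 8) t₀ (fromℕ 8 ⁻¹) ⟩
      t₀ * (fromℕ 8 * fromℕ 8 ⁻¹)  ≈⟨ *-congˡ (inverseʳ 0<8) ⟩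
      t₀ * 1#                      ≈⟨ *-identityʳ t₀ ⟩
      t₀                           ∎

    0<t : ∀ {t} → t₀ ≤ t → 0# < t
    0<t {t} t₀≤t = begin-strict
      0#  <⟨ 0<t₀ ⟩
      t₀  ≤⟨ t₀≤t ⟩
      t   ∎

    tα²≤K : ∀ {t b} → 0# ≤ b → t ≤ T → b ≤ b₁ → t * ((1# + b) * (1# + b)) ≤ K
    tα²≤K {t} {b} 0≤b t≤T b≤b₁ = ≤.trans (*-monoʳ-≤ (square-nonNeg (1# + b)) t≤T) (*-monoˡ-≤ (<⇒≤ 0<T)
      (*-mono-≤ 0≤1+b 0≤1+b (+-monoʳ-≤ 1# b≤b₁) (+-monoʳ-≤ 1# b≤b₁)))
      where
      0≤1+b : 0# ≤ 1# + b
      0≤1+b = +-nonNeg 0≤1 0≤b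

    open Bounds {s} {K} 0<s (<⇒≤ 0<K) using (V; Q; B; 0<V; 0<Q; 0<s²)

  compact-bounds : (K : Pred (ℝ × ℝ) 0ℓ) → IsCompact K → (∀ t b → K (t , b) → 0# < t × 0# ≤ b) →
                   ∃[ A ] ∃[ B ] ∃[ c ] ∃[ r₀ ] 0# < A × 0# < B × 0# < c ×
                     (∀ t b → K (t , b) → UniformBounds A B c r₀ t b)
  compact-bounds K compact inside = onBox (compact⇒box compact inside)
    where
    onBox : ∃[ t₀ ] ∃[ T ] ∃[ b₁ ] 0# < t₀ × 0# < T × 0# ≤ b₁ × (∀ t b → K (t , b) → t₀ ≤ t × t ≤ T × b ≤ b₁) →
            ∃[ A ] ∃[ B ] ∃[ c ] ∃[ r₀ ] 0# < A × 0# < B × 0# < c × (∀ t b → K (t , b) → UniformBounds A B c r₀ t b)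
    onBox (t₀ , T , b₁ , 0<t₀ , 0<T , 0≤b₁ , within) = restrict (box-bounds 0<t₀ 0<T 0≤b₁)
      where
      restrict : ∃[ A ] ∃[ B ] ∃[ c ] ∃[ r₀ ] 0# < A × 0# < B × 0# < c ×
                   (∀ t b → 0# ≤ b → t₀ ≤ t → t ≤ T → b ≤ b₁ → UniformBounds A B c r₀ t b) →
                 ∃[ A ] ∃[ B ] ∃[ c ] ∃[ r₀ ] 0# < A × 0# < B × 0# < c × (∀ t b → K (t , b) → UniformBounds A B c r₀ t b)
      restrict (A , B , c , r₀ , 0<A , 0<B , 0<c , bounds) = A , B , c , r₀ , 0<A , 0<B , 0<c , λ t b Ktb →
        let t₀≤t , t≤T , b≤b₁ = within t b Ktb
        in bounds t b (proj₂ (inside t b Ktb)) t₀≤t t≤T b≤b₁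

  -- A single point is the degenerate box with t₀ = T = t and b₁ = b.
  exact-gevrey-order : ∀ t b → 0# < t → 0# ≤ b → ExactGevreyOrderOne (𝓩 b t) × HasRadiusOfConvergence (𝓩 b t) 0#
  exact-gevrey-order t b 0<t 0≤b = atPoint (box-bounds 0<t 0<t 0≤b)
    where
    atPoint : ∃[ A ] ∃[ B ] ∃[ c ] ∃[ r₀ ] 0# < A × 0# < B × 0# < c ×
                (∀ t′ b′ → 0# ≤ b′ → t ≤ t′ → t′ ≤ t → b′ ≤ b → UniformBounds A B c r₀ t′ b′) →
              ExactGevreyOrderOne (𝓩 b t) × HasRadiusOfConvergence (𝓩 b t) 0#
    atPoint (A , B , c , r₀ , 0<A , 0<B , 0<c , bounds) =
      -- The Gevrey bound is phrased with `^ᴿ`; its exponent `1#` gives exp (log m!), which is m!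
      -- because m! ≥ 1.
      ((A , B , 0<A , 0<B , λ m → ≤.trans (proj₁ bounds-at m) (≈⇒≤ (*-congˡ (sym (fromℕ!^1≈ m))))) ,
       not-gevrey {𝓩 b t} {c} {r₀} 0<c (proj₂ bounds-at)) ,
      radius-zero {𝓩 b t} {c} {r₀} 0<c (proj₂ bounds-at)
      where
      bounds-at : UniformBounds A B c r₀ t b
      bounds-at = bounds t b 0≤b ≤.refl ≤.refl ≤.refl

  bounds-and-order :
    ((K : Pred (ℝ × ℝ) 0ℓ) → IsCompact K → (∀ t b → K (t , b) → 0# < t × 0# ≤ b) →
     ∃[ A ] ∃[ B ] ∃[ c ] ∃[ r₀ ] 0# < A × 0# < B × 0# < c ×
       (∀ t b → K (t , b) → UniformBounds A B c r₀ t b))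
    ×
    (∀ t b → 0# < t → 0# ≤ b → ExactGevreyOrderOne (𝓩 b t) × HasRadiusOfConvergence (𝓩 b t) 0#)
  bounds-and-order = compact-bounds , exact-gevrey-order

proposition4p2 :
  (em : ExcludedMiddle 0ℓ) (𝓡 : CompleteOrderedField) →
  let open CompleteOrderedField 𝓡
      open RealAnalysis em 𝓡
  in
  ((K : Pred (ℝ × ℝ) 0ℓ) → IsCompact K →
   (∀ t b → K (t , b) → 0# < t × 0# ≤ b) →
   ∃[ A ] ∃[ B ] ∃[ c ] ∃[ r₀ ]
     0# < A × 0# < B × 0# < c ×
     (∀ t b → K (t , b) →
       (∀ m → ∣ 𝓩 b t m ∣ ≤ A * B ^ m * fromℕ (m !)) ×
       (∀ r → r₀ ℕ.≤ r → c ^ (2 ℕ.* r) * fromℕ ((2 ℕ.* r) !) ≤ 𝓩 b t (2 ℕ.* r))))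
  ×
  (∀ t b → 0# < t → 0# ≤ b →
    ExactGevreyOrderOne (𝓩 b t) × HasRadiusOfConvergence (𝓩 b t) 0#)
-- Written without arguments: applying the lemma to em would η-expand em, and
-- comparing the two types then unfolds 𝓩 completely.
proposition4p2 = Growth.bounds-and-order
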